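{- Let $A$ be a nonsingular $d\times d$ integer matrix and let $w\in\mathbb{R}^d$. Then for every integer $n\geq 1$, $$\sum_{\xi\in T_A^*}\langle w,\cos(2\pi\xi)\rangle^n=\frac{|\det A|}{2^n}\sum_{x\in A\mathbb{Z}^d}\ \sum_{y\in \mathscr{P}\left(\frac{n-|x|}{2},d\right)}\frac{n!}{(\mathrm{abs}(x)+y)!\,y!}\,w^{\mathrm{abs}(x)+2y}.$$
   Context: Here $T_A^*=(A^{T})^{ -1}\mathbb{Z}^d/\mathbb{Z}^d$ (a finite quotient group). For $\xi\in T_A^*$, $\cos(2\pi\xi):=(\cos(2\pi\xi_1),\dots,\cos(2\pi\xi_d))\in\mathbb{R}^d$ (computed from any representative of $\xi$), and $\langle\cdot,\cdot\rangle$ is the standard inner product of $\mathbb{R}^d$. For $x\in\mathbb{Z}^d$: $\mathrm{abs}(x)=(|x_1|,\dots,|x_d|)$ and $|x|=\sum_{i=1}^d|x_i|$. For $x\in\mathbb{Z}_{\geq 0}^d$: $x!=x_1!x_2!\cdots x_d!$ and $w^x=w_1^{x_1}w_2^{x_2}\cdots w_d^{x_d}$ (with $0^0=1$). For $k\in\mathbb{Z}_{\geq 0}$, $\mathscr{P}(k,d)=\{x\in\mathbb{Z}_{\geq 0}^d : |x|=k\}$; when $k<0$ or $k\notin\mathbb{Z}$, $\mathscr{P}(k,d)=\emptyset$ (so only finitely many terms on the right-hand side are nonzero). -}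

module Defs where

open import Level using (Level; _⊔_) renaming (suc to lsuc)
open import Algebra.Bundles using (CommutativeRing)
open import Algebra.Apartness.Bundles using (HeytingField)
open import Data.Empty using (⊥-elim)
open import Data.Fin.Base using (Fin; toℕ; punchIn)
import Data.Fin.Base as Fin
open import Data.Integer.Base using (ℤ; +_; -[1+_]; 0ℤ; 1ℤ; -1ℤ; ∣_∣; _⊖_)
import Data.Integer.Base as ℤ
import Data.Integer.Properties as ℤₚ
open import Data.List.Base using (List; foldr; map)
import Data.List.Membership.Setoid as Membership
import Data.List.Relation.Unary.Unique.Setoid as UniqueSetoid
open import Data.Nat.Base using (ℕ; zero; suc; NonZero; _!; z≤n; s≤s)
import Data.Nat.Base as ℕ
import Data.Nat.Properties as ℕₚ
open import Data.Product.Base using (Σ-syntax; ∃-syntax; _×_; _,_; proj₁; proj₂)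
open import Data.Rational.Base using (ℚ)
import Data.Rational.Base as ℚ
open import Data.Sum.Base using (_⊎_; inj₁; inj₂)
open import Data.Vec.Functional using (Vector; zipWith; transpose)
import Data.Vec.Functional as Vector
import Data.Vec.Functional.Relation.Binary.Equality.Setoid as VectorEquality
open import Function.Base using (_∘_)
open import Relation.Binary.Bundles using (Setoid)
open import Relation.Binary.Core using (Rel)
import Relation.Binary.Construct.On as On
open import Relation.Binary.PropositionalEquality using (_≡_; _≢_)
import Relation.Binary.PropositionalEquality as ≡
open import Relation.Binary.Structures using (IsStrictPartialOrder)
open import Relation.Nullary.Negation using (¬_)
import Algebra.Properties.CommutativeMonoid.Sum as CMSum
import Algebra.Apartness.Properties.HeytingCommutativeRing as HCRProperties
import Algebra.Properties.Ring as RingProperties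
import Algebra.Properties.Semiring.Exp as Exp
import Algebra.Properties.Semiring.Mult as Mult
import Algebra.Solver.Ring.NaturalCoefficients.Default as SemiringSolver
import Relation.Binary.Reasoning.Setoid as SetoidReasoning

infix  9 _!ᵛ
infixl 6 _+ᵛ_
infixr 7 _·ᵛ_
infixr 7 _·ℤ_

private
  module ∑ℕ = CMSum ℕₚ.+-0-commutativeMonoid
  module ∏ℕ = CMSum ℕₚ.*-1-commutativeMonoid
  module ∑ℤ = CMSum ℤₚ.+-0-commutativeMonoid

Matrix : ∀ {a} → Set a → ℕ → Set a
Matrix X d = Vector (Vector X d) d

-- Laplace expansion along the first row.
det : ∀ {d} → Matrix ℤ d → ℤ
det {zero}  A = 1ℤ
det {suc d} A = ∑ℤ.sum λ j →
  (-1ℤ ℤ.^ toℕ j) ℤ.* A Fin.zero j ℤ.* det (λ i k → A (Fin.suc i) (punchIn j k))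

_·ℤ_ : ∀ {d} → Matrix ℤ d → Vector ℤ d → Vector ℤ d
(A ·ℤ m) i = ∑ℤ.sum λ j → A i j ℤ.* m j

-- The set Aℤᵈ; elements are compared as vectors, ignoring the preimage.
Image : ∀ {d} → Matrix ℤ d → Setoid _ _
Image {d} A = On.setoid {B = Σ[ x ∈ Vector ℤ d ] ∃[ m ] (∀ i → (A ·ℤ m) i ≡ x i)}
  (VectorEquality.≋-setoid (≡.setoid ℤ) d) proj₁

abs : ∀ {d} → Vector ℤ d → Vector ℕ d
abs x i = ∣ x i ∣

∣_∣₁ : ∀ {d} → Vector ℕ d → ℕ
∣ y ∣₁ = ∑ℕ.sum y

_+ᵛ_ : ∀ {d} → Vector ℕ d → Vector ℕ d → Vector ℕ d
_+ᵛ_ = zipWith ℕ._+_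

_·ᵛ_ : ∀ {d} → ℕ → Vector ℕ d → Vector ℕ d
(k ·ᵛ y) i = k ℕ.* y i

_!ᵛ : ∀ {d} → Vector ℕ d → ℕ
y !ᵛ = ∏ℕ.sum λ i → y i !

_!ᵛ≢0 : ∀ {d} (y : Vector ℕ d) → NonZero (y !ᵛ)
_!ᵛ≢0 {zero}  y = _
_!ᵛ≢0 {suc d} y =
  ℕₚ.m*n≢0 _ _ {{y Fin.zero ℕₚ.!≢0}} {{(y ∘ Fin.suc) !ᵛ≢0}}

-- The index k is rational, so that the set is empty when k is negative
-- or not an integer.
𝒫 : ℚ → ℕ → Setoid _ _
𝒫 k d = On.setoid {B = Σ[ y ∈ Vector ℕ d ] (+ ∣ y ∣₁) ℚ./ 1 ≡ k}
  (VectorEquality.≋-setoid (≡.setoid ℕ) d) proj₁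

-- A Cauchy complete Archimedean ordered field: classically this is ℝ up
-- to unique isomorphism, and constructively the Cauchy reals are a model.
record RealNumbers c ℓ₁ ℓ₂ : Set (lsuc (c ⊔ ℓ₁ ⊔ ℓ₂)) where
  infix 4 _<_
  field
    heytingField : HeytingField c ℓ₁ ℓ₂

  open HeytingField heytingField public
    renaming (Carrier to ℝ)

  commutativeRing : CommutativeRing c ℓ₁
  commutativeRing = record { isCommutativeRing = isCommutativeRing }

  open CommutativeRing commutativeRing public
    using (ring; semiring; commutativeSemiring; *-commutativeMonoid; +-commutativeMonoid)

  open Mult semiring public using () renaming (_×_ to infixl 8 _×ℕ_)

  field
    _<_                  : Rel ℝ ℓ₂
    <-isStrictPartialOrder : IsStrictPartialOrder _≈_ _<_
    #⇒<⊎>                : ∀ {x y} → x # y → x < y ⊎ y < x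
    <⇒#                  : ∀ {x y} → x < y → x # y
    +-monoˡ-<            : ∀ z {x y} → x < y → x + z < y + z
    *-pos                : ∀ {x y} → 0# < x → 0# < y → 0# < x * y
    archimedean          : ∀ x → ∃[ n ] x < n ×ℕ 1#

  Cauchy : (ℕ → ℝ) → Set _
  Cauchy s = ∀ ε → 0# < ε →
    ∃[ N ] (∀ m n → N ℕ.≤ m → N ℕ.≤ n → s m - s n < ε)

  _⟶_ : (ℕ → ℝ) → ℝ → Set _
  s ⟶ l = ∀ ε → 0# < ε →
    ∃[ N ] (∀ n → N ℕ.≤ n → s n - l < ε × l - s n < ε)

  field
    complete : ∀ s → Cauchy s → ∃[ l ] s ⟶ l

module Reals {c ℓ₁ ℓ₂} (ℛ : RealNumbers c ℓ₁ ℓ₂) where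
  open RealNumbers ℛ public
  open Exp semiring public using (_^_)

  infixl 7 _/ℕ_
  infixr 8 _^ᵛ_
  infixr 7 _·ℝ_

  private
    module ∑ = CMSum +-commutativeMonoid
    module ∏ = CMSum *-commutativeMonoid
    module × = Mult semiring
    module R = RingProperties ring
    module H = HCRProperties (HeytingField.heytingCommutativeRing heytingField)
    module < = IsStrictPartialOrder <-isStrictPartialOrder
    open SetoidReasoning setoid

  fromℕ : ℕ → ℝ
  fromℕ n = n ×ℕ 1#

  fromℤ : ℤ → ℝ
  fromℤ (+ n)    = fromℕ n
  fromℤ -[1+ n ] = - fromℕ (suc n)

  cancelˡ : ∀ z x y → (z + x) - (z + y) ≈ x - y
  cancelˡ z x y = begin
    (z + x) - (z + y)       ≈⟨ +-cong (+-comm z x) (sym (R.-‿+-comm z y)) ⟩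
    (x + z) + (- z + - y)   ≈⟨ +-assoc x z _ ⟩
    x + (z + (- z + - y))   ≈⟨ +-congˡ (+-assoc z (- z) _) ⟨
    x + ((z - z) + - y)     ≈⟨ +-congˡ (+-congʳ (-‿inverseʳ z)) ⟩
    x + (0# + - y)          ≈⟨ +-congˡ (+-identityˡ _) ⟩
    x - y                   ∎

  fromℤ-⊖ : ∀ m n → fromℤ (m ⊖ n) ≈ fromℕ m - fromℕ n
  fromℤ-⊖ zero    zero    = sym (-‿inverseʳ 0#)
  fromℤ-⊖ zero    (suc n) = sym (+-identityˡ _)
  fromℤ-⊖ (suc m) zero    = sym (trans (+-congˡ R.-0#≈0#) (+-identityʳ _))
  fromℤ-⊖ (suc m) (suc n) = begin
    fromℤ (suc m ⊖ suc n)         ≡⟨ ≡.cong fromℤ (ℤₚ.[1+m]⊖[1+n]≡m⊖n m n) ⟩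
    fromℤ (m ⊖ n)                 ≈⟨ fromℤ-⊖ m n ⟩
    fromℕ m - fromℕ n             ≈⟨ cancelˡ 1# _ _ ⟨
    fromℕ (suc m) - fromℕ (suc n) ∎

  fromℤ-homo-+ : ∀ i j → fromℤ (i ℤ.+ j) ≈ fromℤ i + fromℤ j
  fromℤ-homo-+ (+ m)    (+ n)    = ×.×-homo-+ 1# m n
  fromℤ-homo-+ (+ m)    -[1+ n ] = fromℤ-⊖ m (suc n)
  fromℤ-homo-+ -[1+ m ] (+ n)    = trans (fromℤ-⊖ n (suc m)) (+-comm _ _)
  fromℤ-homo-+ -[1+ m ] -[1+ n ] = begin
    - fromℕ (suc (suc (m ℕ.+ n)))     ≡⟨ ≡.cong (λ k → - fromℕ (suc k)) (ℕₚ.+-suc m n) ⟨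
    - fromℕ (suc m ℕ.+ suc n)         ≈⟨ -‿cong (×.×-homo-+ 1# (suc m) (suc n)) ⟩
    - (fromℕ (suc m) + fromℕ (suc n)) ≈⟨ R.-‿+-comm _ _ ⟨
    - fromℕ (suc m) - fromℕ (suc n)   ∎

  fromℤ-homo-neg : ∀ i → fromℤ (ℤ.- i) ≈ - fromℤ i
  fromℤ-homo-neg (+ zero)  = sym R.-0#≈0#
  fromℤ-homo-neg (+ suc n) = refl
  fromℤ-homo-neg -[1+ n ]  = sym (R.-‿involutive _)

  <-resp : ∀ {x x′ y y′} → x ≈ x′ → y ≈ y′ → x < y → x′ < y′
  <-resp x≈x′ y≈y′ = <.<-respˡ-≈ x≈x′ ∘ <.<-respʳ-≈ y≈y′

  +-mono-< : ∀ {x y u v} → x < y → u < v → x + u < y + v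
  +-mono-< {x} {y} {u} {v} x<y u<v = <.trans (+-monoˡ-< u x<y)
    (<-resp (+-comm u y) (+-comm v y) (+-monoˡ-< y u<v))

  +-cancelʳ : ∀ x z → (x + z) + - z ≈ x
  +-cancelʳ x z = trans (+-assoc x z _) (trans (+-congˡ (-‿inverseʳ z)) (+-identityʳ x))

  -‿cancelʳ : ∀ x z → (x - z) + z ≈ x
  -‿cancelʳ x z = trans (+-assoc x _ z) (trans (+-congˡ (-‿inverseˡ z)) (+-identityʳ x))

  x<y⇒0<y-x : ∀ {x y} → x < y → 0# < y - x
  x<y⇒0<y-x {x} x<y = <.<-respˡ-≈ (-‿inverseʳ x) (+-monoˡ-< (- x) x<y)

  0<y-x⇒x<y : ∀ {x y} → 0# < y - x → x < y
  0<y-x⇒x<y {x} {y} p = <-resp (+-identityˡ x) (-‿cancelʳ y x) (+-monoˡ-< x p)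

  0<1 : 0# < 1#
  0<1 with #⇒<⊎> H.1#0
  ... | inj₂ 0<1 = 0<1
  ... | inj₁ 1<0 = <.<-respʳ-≈ eq (*-pos 0<-1 0<-1)
    where
    0<-1 : 0# < - 1#
    0<-1 = <.<-respʳ-≈ (+-identityˡ _) (x<y⇒0<y-x 1<0)

    eq : - 1# * - 1# ≈ 1#
    eq = trans (R.-1*x≈-x _) (R.-‿involutive 1#)

  *-monoʳ-< : ∀ {x y} z → 0# < z → x < y → x * z < y * z
  *-monoʳ-< {x} {y} z 0<z x<y = 0<y-x⇒x<y
    (<.<-respʳ-≈ (trans (distribʳ z y (- x)) (+-congˡ (sym (R.-‿distribˡ-* x z))))
      (*-pos (x<y⇒0<y-x x<y) 0<z))

  0<fromℕ : ∀ n → 0# < fromℕ (suc n)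
  0<fromℕ zero    = <.<-respʳ-≈ (sym (+-identityʳ 1#)) 0<1
  0<fromℕ (suc n) = <.<-respˡ-≈ (+-identityˡ 0#) (+-mono-< 0<1 (0<fromℕ n))

  1/ℕ : (n : ℕ) .{{_ : NonZero n}} → ℝ
  1/ℕ (suc n) = proj₁ (#⇒invertible (#-sym (<⇒# (0<fromℕ n))))

  1/ℕ-inverse : ∀ n .{{_ : NonZero n}} → 1/ℕ n * fromℕ n ≈ 1#
  1/ℕ-inverse (suc n) = trans (*-congˡ (sym (H.x-0≈x _)))
    (proj₁ (proj₂ (#⇒invertible (#-sym (<⇒# (0<fromℕ n))))))

  _/ℕ_ : ℕ → (n : ℕ) .{{_ : NonZero n}} → ℝ
  m /ℕ n = fromℕ m * 1/ℕ n

  cosTerm : ℝ → ℕ → ℝ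
  cosTerm x k = (- 1#) ^ k * x ^ (2 ℕ.* k) * 1/ℕ ((2 ℕ.* k) !) {{(2 ℕ.* k) ℕₚ.!≢0}}

  partialSum : (ℕ → ℝ) → ℕ → ℝ
  partialSum t zero    = 0#
  partialSum t (suc n) = partialSum t n + t n

  module CauchyProof where
    open SemiringSolver commutativeSemiring using (solve; _:=_; _:+_; _:*_; con)

    ½ : ℝ
    ½ = 1/ℕ 2

    ½+½≈1 : ½ + ½ ≈ 1#
    ½+½≈1 = trans (solve 1 (λ h → h :+ h := h :* con 2) refl ½)
      (trans (*-congˡ (+-congˡ (sym (+-identityʳ 1#)))) (1/ℕ-inverse 2))

    0<1/ℕ : ∀ n .{{_ : NonZero n}} → 0# < 1/ℕ n
    0<1/ℕ n@(suc n-1) with #⇒<⊎> (H.invertibleʳ⇒# (fromℕ n , trans (*-congʳ (H.x-0≈x _)) (1/ℕ-inverse n)))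
    ... | inj₂ 0<r = 0<r
    ... | inj₁ r<0 = ⊥-elim (<.irrefl refl (<.trans 0<1
          (<-resp (1/ℕ-inverse n) (zeroˡ _) (*-monoʳ-< _ (0<fromℕ n-1) r<0))))

    -- Bounded u s is the inequality |s| < u.
    Bounded : ℝ → ℝ → Set _
    Bounded u s = s < u × - s < u

    bounded-resp : ∀ {u v s t} → u ≈ v → s ≈ t → Bounded u s → Bounded v t
    bounded-resp u≈v s≈t (p , q) = <-resp s≈t u≈v p , <-resp (-‿cong s≈t) u≈v q

    bounded-+ : ∀ {u s v t} → Bounded u s → Bounded v t → Bounded (u + v) (s + t)
    bounded-+ (p , q) (p′ , q′) =
      +-mono-< p p′ , <.<-respˡ-≈ (R.-‿+-comm _ _) (+-mono-< q q′)

    halve : ∀ {x y} → x + x < y + y → x < y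
    halve {x} {y} p = <-resp (eq x) (eq y) (*-monoʳ-< ½ (0<1/ℕ 2) p)
      where
      eq : ∀ z → (z + z) * ½ ≈ z
      eq z = trans (solve 2 (λ z h → (z :+ z) :* h := z :* (h :+ h)) refl z ½)
        (trans (*-congˡ ½+½≈1) (*-identityʳ z))

    -- 2(uv - st) = (u + s)(v - t) + (u - s)(v + t)
    *-bound : ∀ {u v} s t → Bounded u s → Bounded v t → s * t < u * v
    *-bound {u} {v} s t (s<u , -s<u) (t<v , -t<v) =
      halve (<-resp (+-identityˡ _) eq (+-monoˡ-< (s * t + s * t) 0<X))
      where
      s′ t′ X : ℝ
      s′ = - s
      t′ = - t
      X = (u + s) * (v + t′) + (u + s′) * (v + t)

      0<u+s : 0# < u + s
      0<u+s = <.<-respʳ-≈ (+-congˡ (R.-‿involutive s)) (x<y⇒0<y-x -s<u)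

      0<v+t : 0# < v + t
      0<v+t = <.<-respʳ-≈ (+-congˡ (R.-‿involutive t)) (x<y⇒0<y-x -t<v)

      0<X : 0# < X
      0<X = <.<-respˡ-≈ (+-identityˡ 0#)
        (+-mono-< (*-pos 0<u+s (x<y⇒0<y-x t<v)) (*-pos (x<y⇒0<y-x s<u) 0<v+t))

      eq : X + (s * t + s * t) ≈ u * v + u * v
      eq = begin
        X + (s * t + s * t)
          ≈⟨ solve 6 (λ u v s s′ t t′ →
               ((u :+ s) :* (v :+ t′) :+ (u :+ s′) :* (v :+ t)) :+ (s :* t :+ s :* t) :=
               (u :* v :+ u :* v)
                 :+ ((u :+ s) :* (t :+ t′) :+ (v :+ t) :* (s :+ s′)))
               refl u v s s′ t t′ ⟩
        (u * v + u * v) + ((u + s) * (t + t′) + (v + t) * (s + s′))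
          ≈⟨ +-congˡ (+-cong (*-congˡ (-‿inverseʳ t)) (*-congˡ (-‿inverseʳ s))) ⟩
        (u * v + u * v) + ((u + s) * 0# + (v + t) * 0#)
          ≈⟨ +-congˡ (trans (+-cong (zeroʳ _) (zeroʳ _)) (+-identityˡ 0#)) ⟩
        (u * v + u * v) + 0#
          ≈⟨ +-identityʳ _ ⟩
        u * v + u * v ∎

    bounded-* : ∀ {u s v t} → Bounded u s → Bounded v t → Bounded (u * v) (s * t)
    bounded-* {s = s} {t = t} bs bt@(t<v , -t<v) = *-bound s t bs bt ,
      <.<-respˡ-≈ (sym (R.-‿distribʳ-* s t))
        (*-bound s (- t) bs (-t<v , <.<-respˡ-≈ (sym (R.-‿involutive t)) t<v))

    bounded-scale : ∀ {u s} r → 0# < r → Bounded u s → Bounded (u * r) (s * r)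
    bounded-scale {s = s} r 0<r (p , q) = *-monoʳ-< r 0<r p ,
      <.<-respˡ-≈ (sym (R.-‿distribˡ-* s r)) (*-monoʳ-< r 0<r q)

    fromℕ-mono-≤ : ∀ {m n x} → m ℕ.≤ n → x < fromℕ m → x < fromℕ n
    fromℕ-mono-≤ {m} {n} {x} m≤n x<m with ℕₚ.m≤n⇒∃[o]m+o≡n m≤n
    ... | zero  , ≡.refl = <.<-respʳ-≈ (sym (trans (×.×-homo-+ 1# m 0) (+-identityʳ _))) x<m
    ... | suc o , ≡.refl = <-resp (+-identityʳ x) (sym (×.×-homo-+ 1# m (suc o)))
          (+-mono-< x<m (0<fromℕ o))

    bound : ∀ x → ∃[ n ] Bounded (fromℕ n) x
    bound x with archimedean x | archimedean (- x)
    ... | m , x<m | n , -x<n = m ℕ.+ n ,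
      fromℕ-mono-≤ (ℕₚ.m≤m+n m n) x<m , fromℕ-mono-≤ (ℕₚ.m≤n+m n m) -x<n

    0<½^ : ∀ n → 0# < ½ ^ n
    0<½^ zero    = 0<1
    0<½^ (suc n) = *-pos (0<1/ℕ 2) (0<½^ n)

    ½^-double : ∀ n → ½ ^ suc n + ½ ^ suc n ≈ ½ ^ n
    ½^-double n = trans (sym (distribʳ _ ½ ½)) (trans (*-congʳ ½+½≈1) (*-identityˡ _))

    0<2 : 0# < 1# + 1#
    0<2 = <.<-respˡ-≈ (+-identityˡ 0#) (+-mono-< 0<1 0<1)

    1<2 : 1# < 1# + 1#
    1<2 = <.<-respˡ-≈ (+-identityˡ 1#) (+-monoˡ-< 1# 0<1)

    ½^<2 : ∀ n → ½ ^ n < 1# + 1#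
    ½^<2 zero    = 1<2
    ½^<2 (suc n) = halve (<.<-respˡ-≈ (sym (½^-double n)) (<.trans (½^<2 n)
      (<.<-respˡ-≈ (+-identityˡ _) (+-monoˡ-< _ 0<2))))

    n½^n<2 : ∀ n → fromℕ (suc n) * ½ ^ n < 1# + 1#
    n½^n<2 zero    = <.<-respˡ-≈ (sym (trans (*-identityʳ _) (+-identityʳ 1#))) 1<2
    n½^n<2 (suc n) = halve (<.<-respˡ-≈ eq (+-mono-< (½^<2 n) (n½^n<2 n)))
      where
      eq : ½ ^ n + fromℕ (suc n) * ½ ^ n
         ≈ fromℕ (suc (suc n)) * ½ ^ suc n + fromℕ (suc (suc n)) * ½ ^ suc n
      eq = trans
        (trans (+-congʳ (sym (*-identityˡ _))) (sym (distribʳ _ 1# (fromℕ (suc n)))))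
        (trans (*-congˡ (sym (½^-double n))) (distribˡ _ _ _))

    bounded⇒0< : ∀ {u s} → Bounded u s → 0# < u
    bounded⇒0< {u} {s} (p , q) = halve
      (<.<-respˡ-≈ (trans (-‿inverseʳ s) (sym (+-identityˡ 0#))) (+-mono-< p q))

    quadruple : ℝ → ℝ
    quadruple x = (x + x) + (x + x)

    module _ (t : ℕ → ℝ) where
      private p = partialSum t

      tail-bound : ∀ K E → (∀ i → Bounded (E * ½ ^ i) (t (i ℕ.+ K))) →
                   ∀ i → Bounded (quadruple E) (p (i ℕ.+ K) - p K)
      tail-bound K E t-bound i = drop i (proj₁ (strong i)) , drop i (proj₂ (strong i))
        where
        g S : ℕ → ℝ
        g i = E * ½ ^ i
        S i = p (i ℕ.+ K) - p K

        0<g+g : ∀ i → 0# < g i + g i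
        0<g+g i = <.<-respˡ-≈ (+-identityˡ 0#)
          (+-mono-< (bounded⇒0< (t-bound i)) (bounded⇒0< (t-bound i)))

        drop : ∀ i {y z} → y + (g i + g i) < z → y < z
        drop i {y} = <.trans (<-resp (+-identityˡ y) (+-comm _ y) (+-monoˡ-< y (0<g+g i)))

        S-suc : ∀ i → S (suc i) ≈ S i + t (i ℕ.+ K)
        S-suc i = trans (+-assoc _ _ _) (trans (+-congˡ (+-comm _ _)) (sym (+-assoc _ _ _)))

        g-suc : ∀ i → g (suc i) + g (suc i) ≈ g i
        g-suc i = trans (sym (distribˡ E _ _)) (*-congˡ (½^-double i))

        base : ∀ {y} → y ≈ 0# → y + (g 0 + g 0) < quadruple E
        base y≈0 = <-resp
          (sym (trans (+-congʳ y≈0) (trans (+-identityˡ _) (+-cong (*-identityʳ E) (*-identityʳ E)))))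
          refl
          (<.<-respˡ-≈ (+-identityˡ _) (+-monoˡ-< _
            (<.<-respʳ-≈ (+-cong (*-identityʳ E) (*-identityʳ E)) (0<g+g 0))))

        advance : ∀ i {y y′ z} → y′ ≈ y + z → z < g i → y + (g i + g i) < quadruple E →
               y′ + (g (suc i) + g (suc i)) < quadruple E
        advance i {y} {z = z} eq z<g h = <.trans (<-resp
          (trans (+-comm _ _) (trans (sym (+-assoc y z (g i)))
            (+-cong (sym eq) (sym (g-suc i)))))
          (+-comm _ _)
          (+-monoˡ-< y (+-monoˡ-< (g i) z<g))) h

        strong : ∀ i → S i + (g i + g i) < quadruple E × - S i + (g i + g i) < quadruple E
        strong zero = base (-‿inverseʳ _) , base (trans (-‿cong (-‿inverseʳ _)) R.-0#≈0#)
        strong (suc i) =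
          advance i (S-suc i) (proj₁ (t-bound i)) (proj₁ (strong i)) ,
          advance i (trans (-‿cong (S-suc i)) (sym (R.-‿+-comm _ _)))
            (proj₂ (t-bound i)) (proj₂ (strong i))

      -- A ratio test: if |tₖ₊₁/tₖ| < ½ for k ≥ K then ∑ tₖ is Cauchy.
      ratio-test : ∀ K (r : ℕ → ℝ) → (∀ k → t (suc k) ≈ t k * r k) →
                   (∀ k → K ℕ.≤ k → Bounded ½ (r k)) → Cauchy p
      ratio-test K r t-suc r-bound ε 0<ε = J ℕ.+ K , result
        where
        M : ℝ
        M = fromℕ (proj₁ (bound (t K)))

        t-bound : ∀ i → Bounded (M * ½ ^ i) (t (i ℕ.+ K))
        t-bound zero    = bounded-resp (sym (*-identityʳ M)) refl (proj₂ (bound (t K)))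
        t-bound (suc i) = bounded-resp
          (trans (*-assoc M _ ½) (*-congˡ (*-comm _ ½))) (sym (t-suc _))
          (bounded-* (t-bound i) (r-bound _ (ℕₚ.m≤n+m K i)))

        ε⁻¹ : ℝ
        ε⁻¹ = proj₁ (#⇒invertible (#-sym (<⇒# 0<ε)))

        ε⁻¹*ε : ε⁻¹ * ε ≈ 1#
        ε⁻¹*ε = trans (*-congˡ (sym (H.x-0≈x ε)))
          (proj₁ (proj₂ (#⇒invertible (#-sym (<⇒# 0<ε)))))

        M₁₆ : ℝ
        M₁₆ = quadruple (quadruple M)

        J : ℕ
        J = proj₁ (archimedean (M₁₆ * ε⁻¹))

        E : ℝ
        E = M * ½ ^ J

        M₁₆<Jε : M₁₆ < fromℕ (suc J) * ε
        M₁₆<Jε = <.<-respˡ-≈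
          (trans (*-assoc _ _ _) (trans (*-congˡ ε⁻¹*ε) (*-identityʳ _)))
          (*-monoʳ-< ε 0<ε (fromℕ-mono-≤ (ℕₚ.n≤1+n J) (proj₂ (archimedean (M₁₆ * ε⁻¹)))))

        E-small : quadruple E + quadruple E < ε
        E-small = halve (<-resp
          (solve 2 (λ m h → let q = λ x → (x :+ x) :+ (x :+ x) in
              q (q m) :* h := (q (m :* h) :+ q (m :* h)) :+ (q (m :* h) :+ q (m :* h)))
            refl M (½ ^ J))
          (trans (distribʳ ε 1# 1#) (+-cong (*-identityˡ ε) (*-identityˡ ε)))
          (<.trans
            (*-monoʳ-< (½ ^ J) (0<½^ J) M₁₆<Jε)
            (<.<-respˡ-≈
              (solve 3 (λ a b c → (a :* b) :* c := (a :* c) :* b) refl (fromℕ (suc J)) (½ ^ J) ε)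
              (*-monoʳ-< ε 0<ε (n½^n<2 J)))))

        tail : ∀ i → Bounded (quadruple E) (p (i ℕ.+ (J ℕ.+ K)) - p (J ℕ.+ K))
        tail = tail-bound (J ℕ.+ K) E λ i → bounded-resp
          (trans (*-congˡ (trans (^-homo i) (*-comm _ _))) (sym (*-assoc M _ _)))
          (reflexive (≡.cong t (ℕₚ.+-assoc i J K)))
          (t-bound (i ℕ.+ J))
          where
          ^-homo : ∀ i → ½ ^ (i ℕ.+ J) ≈ ½ ^ i * ½ ^ J
          ^-homo i = Exp.^-homo-* semiring ½ i J

        tail≤ : ∀ m → J ℕ.+ K ℕ.≤ m → Bounded (quadruple E) (p m - p (J ℕ.+ K))
        tail≤ m N≤m with ℕₚ.m≤n⇒∃[o]m+o≡n N≤m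
        ... | o , ≡.refl = bounded-resp refl
          (reflexive (≡.cong (λ k → p k - p (J ℕ.+ K)) (ℕₚ.+-comm o (J ℕ.+ K)))) (tail o)

        result : ∀ m n → J ℕ.+ K ℕ.≤ m → J ℕ.+ K ℕ.≤ n → p m - p n < ε
        result m n N≤m N≤n = <.trans
          (<.<-respˡ-≈ eq (+-mono-< (proj₁ (tail≤ m N≤m)) (proj₂ (tail≤ n N≤n)))) E-small
          where
          a = p (J ℕ.+ K)

          eq : (p m - a) + - (p n - a) ≈ p m - p n
          eq = begin
            (p m - a) + - (p n - a)       ≈⟨ +-congˡ (R.-‿+-comm _ _) ⟨
            (p m - a) + (- p n + - - a)   ≈⟨ +-congˡ (+-congˡ (R.-‿involutive a)) ⟩
            (p m - a) + (- p n + a)       ≈⟨ +-congˡ (+-comm _ _) ⟩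
            (p m - a) + (a - p n)         ≈⟨ +-assoc _ _ _ ⟨
            ((p m - a) + a) - p n         ≈⟨ +-congʳ (-‿cancelʳ _ _) ⟩
            p m - p n                     ∎

    1/ℕ-unique : ∀ {y} n .{{_ : NonZero n}} → y * fromℕ n ≈ 1# → 1/ℕ n ≈ y
    1/ℕ-unique {y} n p = begin
      1/ℕ n                   ≈⟨ *-identityˡ _ ⟨
      1# * 1/ℕ n              ≈⟨ *-congʳ p ⟨
      y * fromℕ n * 1/ℕ n     ≈⟨ *-assoc _ _ _ ⟩
      y * (fromℕ n * 1/ℕ n)   ≈⟨ *-congˡ (*-comm _ _) ⟩
      y * (1/ℕ n * fromℕ n)   ≈⟨ *-congˡ (1/ℕ-inverse n) ⟩
      y * 1#                  ≈⟨ *-identityʳ y ⟩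
      y                       ∎

    module _ (x : ℝ) where

      evenTerm : ℝ → ℕ → ℝ
      evenTerm s N = s * x ^ N * 1/ℕ (N !) {{N ℕₚ.!≢0}}

      den : ℕ → ℕ
      den N = suc (suc N) ℕ.* suc N

      r : ℕ → ℝ
      r k = (- (x * x)) * 1/ℕ (den (2 ℕ.* k))

      evenTerm-suc : ∀ s N →
        evenTerm (- 1# * s) (2 ℕ.+ N) ≈ evenTerm s N * ((- (x * x)) * 1/ℕ (den N))
      evenTerm-suc s N = begin
        evenTerm (- 1# * s) (2 ℕ.+ N)
          ≈⟨ *-congˡ (1/ℕ-unique ((2 ℕ.+ N) !) {{(2 ℕ.+ N) ℕₚ.!≢0}} inv) ⟩
        - 1# * s * (x * (x * x ^ N)) * (1/ℕ (den N) * f)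
          ≈⟨ solve 6 (λ o s x y c f →
               ((o :* s) :* (x :* (x :* y))) :* (c :* f) :=
               ((s :* y) :* f) :* ((o :* (x :* x)) :* c)) refl (- 1#) s x (x ^ N) (1/ℕ (den N)) f ⟩
        evenTerm s N * (- 1# * (x * x) * 1/ℕ (den N))
          ≈⟨ *-congˡ (*-congʳ (R.-1*x≈-x _)) ⟩
        evenTerm s N * (- (x * x) * 1/ℕ (den N)) ∎
        where
        f : ℝ
        f = 1/ℕ (N !) {{N ℕₚ.!≢0}}

        inv : (1/ℕ (den N) * f) * fromℕ ((2 ℕ.+ N) !) ≈ 1#
        inv = begin
          (1/ℕ (den N) * f) * fromℕ ((2 ℕ.+ N) !)
            ≡⟨ ≡.cong (λ m → (1/ℕ (den N) * f) * fromℕ m) (ℕₚ.*-assoc (2 ℕ.+ N) (suc N) (N !)) ⟨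
          (1/ℕ (den N) * f) * fromℕ (den N ℕ.* N !)
            ≈⟨ *-congˡ (×.×1-homo-* (den N) (N !)) ⟩
          (1/ℕ (den N) * f) * (fromℕ (den N) * fromℕ (N !))
            ≈⟨ solve 4 (λ a b c d → (a :* b) :* (c :* d) := (a :* c) :* (b :* d))
                 refl (1/ℕ (den N)) f (fromℕ (den N)) (fromℕ (N !)) ⟩
          (1/ℕ (den N) * fromℕ (den N)) * (f * fromℕ (N !))
            ≈⟨ *-cong (1/ℕ-inverse (den N)) (1/ℕ-inverse (N !) {{N ℕₚ.!≢0}}) ⟩
          1# * 1#
            ≈⟨ *-identityˡ 1# ⟩
          1# ∎

      term-suc : ∀ k → cosTerm x (suc k) ≈ cosTerm x k * r k
      term-suc k = trans
        (reflexive (≡.cong (evenTerm ((- 1#) ^ suc k)) (ℕₚ.*-suc 2 k)))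
        (evenTerm-suc ((- 1#) ^ k) (2 ℕ.* k))

      K : ℕ
      K = proj₁ (bound (- (x * x)))

      K≤ : ∀ k → K ℕ.≤ k → K ℕ.+ K ℕ.≤ den (2 ℕ.* k)
      K≤ k K≤k = ℕₚ.≤-trans (ℕₚ.+-mono-≤ K≤k (ℕₚ.≤-trans K≤k (ℕₚ.m≤m+n k 0)))
        (ℕₚ.≤-trans (ℕₚ.m≤n+m (2 ℕ.* k) 2) (ℕₚ.m≤m*n (2 ℕ.+ 2 ℕ.* k) (suc (2 ℕ.* k))))

      r-bound : ∀ k → K ℕ.≤ k → Bounded ½ (r k)
      r-bound k K≤k = half (proj₁ b) , <.<-respˡ-≈ (sym (R.-‿distribˡ-* _ _)) (half (proj₂ b))
        where
        b = proj₂ (bound (- (x * x)))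
        n = den (2 ℕ.* k)

        half : ∀ {y} → y < fromℕ K → y * 1/ℕ n < ½
        half {y} y<K = halve (<-resp (distribʳ _ y y)
          (trans (trans (*-comm _ _) (1/ℕ-inverse n)) (sym ½+½≈1))
          (*-monoʳ-< (1/ℕ n) (0<1/ℕ n)
            (fromℕ-mono-≤ (K≤ k K≤k)
              (<.<-respʳ-≈ (sym (×.×-homo-+ 1# K K)) (+-mono-< y<K y<K)))))

  abstract
    cos-cauchy : ∀ x → Cauchy (partialSum (cosTerm x))
    cos-cauchy x = ratio-test (cosTerm x) (K x) (r x) (term-suc x) (r-bound x)
      where open CauchyProof

  cos : ℝ → ℝ
  cos x = proj₁ (complete _ (cos-cauchy x))

  -- π/2 is the least positive zero of cos.
  IsPi : ℝ → Set _
  IsPi π = 0# < π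
         × cos (π * 1/ℕ 2) ≈ 0#
         × (∀ x → 0# < x → x < π * 1/ℕ 2 → ¬ cos x ≈ 0#)

  ⟨_,_⟩ : ∀ {d} → Vector ℝ d → Vector ℝ d → ℝ
  ⟨ v , w ⟩ = ∑.sum λ i → v i * w i

  _^ᵛ_ : ∀ {d} → Vector ℝ d → Vector ℕ d → ℝ
  w ^ᵛ y = ∏.sum λ i → w i ^ y i

  _·ℝ_ : ∀ {d} → Matrix ℤ d → Vector ℝ d → Vector ℝ d
  (A ·ℝ ξ) i = ∑.sum λ j → fromℤ (A i j) * ξ j

  _≡_modℤ : ∀ {d} → Vector ℝ d → Vector ℝ d → Set _
  ξ ≡ η modℤ = Σ[ k ∈ Vector ℤ _ ] (∀ i → ξ i - η i ≈ fromℤ (k i))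

  -- (Aᵀ)⁻¹ℤᵈ / ℤᵈ; a real vector ξ lies in (Aᵀ)⁻¹ℤᵈ when Aᵀξ is integral.
  T* : ∀ {d} → Matrix ℤ d → Setoid _ _
  T* {d} A = record
    { Carrier       = Σ[ ξ ∈ Vector ℝ d ] Σ[ z ∈ Vector ℤ d ] (∀ i → (transpose A ·ℝ ξ) i ≈ fromℤ (z i))
    ; _≈_           = λ ξ η → proj₁ ξ ≡ proj₁ η modℤ
    ; isEquivalence = record
      { refl  = λ {ξ} → (λ _ → 0ℤ) , λ i → -‿inverseʳ (proj₁ ξ i)
      ; sym   = λ (k , p) → ℤ.-_ ∘ k , λ i → begin
          _  ≈⟨ +-congʳ (R.-‿involutive _) ⟨
          _  ≈⟨ R.-‿+-comm _ _ ⟩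
          _  ≈⟨ -‿cong (+-comm _ _) ⟩
          _  ≈⟨ -‿cong (p i) ⟩
          _  ≈⟨ fromℤ-homo-neg (k i) ⟨
          _  ∎
      ; trans = λ (k , p) (l , q) → (λ i → k i ℤ.+ l i) , λ i → begin
          _  ≈⟨ +-congʳ (-‿cancelʳ _ _) ⟨
          _  ≈⟨ +-assoc _ _ _ ⟩
          _  ≈⟨ +-cong (p i) (q i) ⟩
          _  ≈⟨ fromℤ-homo-+ (k i) (l i) ⟨
          _  ∎
      }
    }

  cos2π : ∀ {d} → ℝ → Vector ℝ d → Vector ℝ d
  cos2π π ξ i = cos (fromℕ 2 * π * ξ i)

  -- s is the sum of f over the elements of S up to its equality: f respects
  -- that equality, and all but the finitely many distinct listed terms vanish.
  record IsSum {a b} (S : Setoid a b) (f : Setoid.Carrier S → ℝ) (s : ℝ)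
         : Set (a ⊔ b ⊔ c ⊔ ℓ₁) where
    open Membership S using (_∉_)
    open UniqueSetoid S using (Unique)
    field
      well-defined : ∀ {x y} → Setoid._≈_ S x y → f x ≈ f y
      terms        : List (Setoid.Carrier S)
      distinct     : Unique terms
      support      : ∀ x → x ∉ terms → f x ≈ 0#
      total        : s ≈ foldr _+_ 0# (map f terms)

  multinomialTerm : ∀ {d} → Vector ℝ d → ℕ → Vector ℤ d → Vector ℕ d → ℝ
  multinomialTerm w n x y =
    ((n !) /ℕ ((abs x +ᵛ y) !ᵛ ℕ.* y !ᵛ))
      {{ℕₚ.m*n≢0 _ _ {{(abs x +ᵛ y) !ᵛ≢0}} {{y !ᵛ≢0}}}}
      * w ^ᵛ (abs x +ᵛ 2 ·ᵛ y)

{-# OPTIONS --safe #-}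
module Submission where

-- Expand (2⟨w, cos 2πξ⟩)ⁿ as a sum over the walks in ℤᵈ with pᵢ steps eᵢ and qᵢ
-- steps -eᵢ, each contributing n!/(p! q!) w^(p+q) cos 2π(p - q)·ξ; this only needs
-- cos(x + y) + cos(x - y) = 2 cos x cos y, so neither sine nor complex numbers.
-- Summing over ξ, orthogonality leaves |det A| times the walks ending in Aℤᵈ, and
-- in each coordinate {p, q} = {|x| + y, y} with x = p - q and y = min p q.
--
-- Column operations change neither Aℤᵈ, nor the dual group, nor |det A|, so for
-- the orthogonality A may be taken lower triangular. By induction on d it reduces
-- to ∑_{k<m} cos 2π(φ + kz/m) = 0 for m ∤ z: with T = 2πz/m, multiplying this sum
-- by 2 cos T doubles it, and cos T = 1 would force a zero of cos in (0, π/2).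

open import Defs
open import Data.Integer.Base using (ℤ; +_; 0ℤ; ∣_∣) renaming (_-_ to _-ℤ_)
open import Data.Nat.Base using (ℕ; _≥_) renaming (_^_ to _^ℕ_)
open import Data.Nat.Properties using (m^n≢0)
open import Data.Product.Base using (Σ-syntax; ∃-syntax; _×_; _,_; proj₁)
open import Data.Rational.Base using (_/_)
open import Data.Vec.Functional using (Vector)
open import Relation.Binary.Bundles using (Setoid)
open import Relation.Binary.PropositionalEquality using (_≢_)

open import Algebra.Apartness.Bundles using (HeytingField)
open import Algebra.Bundles using (CommutativeMonoid)
import Algebra.Properties.CommutativeMonoid.Sum as CMSum
import Algebra.Properties.Ring as RingProperties
import Algebra.Properties.Semiring.Exp as Exp
import Algebra.Properties.Semiring.Mult as Mult
import Algebra.Solver.Ring as RingSolver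
open import Algebra.Solver.Ring.AlmostCommutativeRing using (fromCommutativeRing; _-Raw-AlmostCommutative⟶_)
open import Data.Empty using (⊥; ⊥-elim)
open import Data.Fin.Base using (Fin; toℕ; punchIn; punchOut; zero; suc; _↑ˡ_; _↑ʳ_)
import Data.Fin.Base as Fin
import Data.Fin.Properties as Finₚ
open import Data.Integer.Base using (-[1+_]; 1ℤ; -1ℤ; _⊖_)
import Data.Integer.Base as ℤ
import Data.Integer.DivMod as ℤDiv
open import Data.Integer.Divisibility.Signed using (divides) renaming (_∣_ to _∣ℤ_; _∣?_ to _∣ℤ?_)
import Data.Integer.Properties as ℤₚ
open import Data.Integer.Solver renaming (module +-*-Solver to ℤS)
open import Data.List.Base using (List; []; _∷_; _++_; foldr; map; concatMap; applyUpTo; upTo; length; deduplicate)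
import Data.List.Membership.Setoid as Membership
import Data.List.Properties as Listₚ
open import Data.List.Relation.Unary.All using (All)
import Data.List.Relation.Unary.All as All
import Data.List.Relation.Unary.All.Properties as Allₚ
open import Data.List.Relation.Unary.AllPairs using (AllPairs)
import Data.List.Relation.Unary.AllPairs as AllPairs
import Data.List.Relation.Unary.AllPairs.Properties as AllPairsₚ
open import Data.List.Relation.Unary.Any using (Any; here; there)
import Data.List.Relation.Unary.Any as Any
import Data.List.Relation.Unary.Any.Properties as Anyₚ
import Data.List.Relation.Unary.Unique.DecSetoid.Properties as UniqueDecₚ
import Data.List.Relation.Unary.Unique.Propositional.Properties as Unique≡ₚ
import Data.List.Relation.Unary.Unique.Setoid as UniqueSetoid
import Data.List.Relation.Unary.Unique.Setoid.Properties as Uniqueₚ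
import Data.Maybe.Base as Maybe
open import Data.Nat.Base using (zero; suc; NonZero; _!; _⊓_; z<s)
import Data.Nat.Base as ℕ
open import Data.Nat.Induction using (<-wellFounded)
import Data.Nat.Properties as ℕₚ
open import Data.Nat.Solver renaming (module +-*-Solver to ℕSolver)
open import Data.Product.Base using (Σ; proj₂)
open import Data.Rational.Properties using (/-injective-≃; fromℚᵘ-cong)
open import Data.Rational.Unnormalised.Base using (mkℚᵘ; *≡*)
open import Data.Sum.Base using (_⊎_; inj₁; inj₂)
open import Data.Vec.Functional using (transpose; head; tail) renaming (_∷_ to _∷ᵛ_; _++_ to _++ᵛ_)
import Data.Vec.Functional.Properties as Vectorₚ
import Data.Vec.Functional.Relation.Binary.Equality.Setoid as VectorEquality
open import Function.Base using (_∘_)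
open import Induction.WellFounded using (Acc; acc)
open import Level using (Level; 0ℓ; _⊔_) renaming (suc to lsuc)
open import Relation.Binary.Bundles using (DecSetoid)
open import Relation.Binary.Consequences using (dec⇒weaklyDec)
open import Relation.Binary.PropositionalEquality using (_≡_; _≗_)
import Relation.Binary.PropositionalEquality as ≡
import Relation.Binary.Reasoning.Setoid as SetoidReasoning
open import Relation.Binary.Structures using (IsStrictPartialOrder)
open import Relation.Nullary.Decidable using (Dec; yes; no; _×-dec_)
import Relation.Nullary.Decidable as Dec
open import Relation.Nullary.Negation using (¬_)

-- Order and equality of the reals are not assumed decidable, and this shapes the proof. Angles are
-- compared by counting steps of a 4m-th of a period, so that the comparison is one of naturals;
-- membership in Aℤᵈ is decided by divisibility. A quantity known only to be nonzero need not be
-- invertible and is cancelled through the tightness of apartness. Each sum in the theorem has to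
-- come with a finite list of representatives and a proof that it is duplicate-free and covers the
-- support. Hence the dual group is enumerated explicitly, fibre by fibre along the induction on d,
-- and the walks supply the lists on the right-hand side. Without complex exponentials there is no
-- multiplicative character to factor out. An arbitrary phase φ takes its place: multiplication by
-- exp θ becomes the translation from φ to φ + θ. This is why `multinomialSum` and
-- `cos₁-arithmetic-sum` are stated for all phases.

-- Integers inside the reals, reciprocals of naturals, and cancellation.

module RealAlgebra {c ℓ₁ ℓ₂} (ℛ : RealNumbers c ℓ₁ ℓ₂) where
  open Reals ℛ hiding (zero)
  private
    module R = RingProperties ring
  open SetoidReasoning setoid

  fromℤ-homo-* : ∀ i j → fromℤ (i ℤ.* j) ≈ fromℤ i * fromℤ j
  fromℤ-homo-* (+ m) j = go m
    where
    go : ∀ m → fromℤ (+ m ℤ.* j) ≈ fromℕ m * fromℤ j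
    go zero    = trans (reflexive (≡.cong fromℤ (ℤₚ.*-zeroˡ j))) (sym (zeroˡ _))
    go (suc m) = begin
      fromℤ (+ suc m ℤ.* j)              ≡⟨ ≡.cong fromℤ (ℤₚ.suc-* (+ m) j) ⟩
      fromℤ (j ℤ.+ + m ℤ.* j)            ≈⟨ fromℤ-homo-+ j _ ⟩
      fromℤ j + fromℤ (+ m ℤ.* j)        ≈⟨ +-cong (sym (*-identityˡ _)) (go m) ⟩
      1# * fromℤ j + fromℕ m * fromℤ j   ≈⟨ distribʳ _ _ _ ⟨
      fromℕ (suc m) * fromℤ j            ∎
  fromℤ-homo-* -[1+ m ] j = begin
    fromℤ (ℤ.- (+ suc m) ℤ.* j)     ≡⟨ ≡.cong fromℤ (ℤₚ.neg-distribˡ-* (+ suc m) j) ⟨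
    fromℤ (ℤ.- (+ suc m ℤ.* j))     ≈⟨ fromℤ-homo-neg (+ suc m ℤ.* j) ⟩
    - fromℤ (+ suc m ℤ.* j)         ≈⟨ -‿cong (fromℤ-homo-* (+ suc m) j) ⟩
    - (fromℕ (suc m) * fromℤ j)     ≈⟨ R.-‿distribˡ-* _ _ ⟩
    - fromℕ (suc m) * fromℤ j       ∎

  private
    -- Unlike fromℤ, this sends 1ℤ to 1# on the nose.
    coefficientℕ : ℕ → ℝ
    coefficientℕ zero          = 0#
    coefficientℕ (suc zero)    = 1#
    coefficientℕ (suc (suc n)) = 1# + coefficientℕ (suc n)

    coefficient : ℤ → ℝ
    coefficient (+ n)    = coefficientℕ n
    coefficient -[1+ n ] = - coefficientℕ (suc n)

    coefficientℕ≈fromℕ : ∀ n → coefficientℕ n ≈ fromℕ n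
    coefficientℕ≈fromℕ zero          = refl
    coefficientℕ≈fromℕ (suc zero)    = sym (+-identityʳ 1#)
    coefficientℕ≈fromℕ (suc (suc n)) = +-congˡ (coefficientℕ≈fromℕ (suc n))

    coefficient≈fromℤ : ∀ i → coefficient i ≈ fromℤ i
    coefficient≈fromℤ (+ n)    = coefficientℕ≈fromℕ n
    coefficient≈fromℤ -[1+ n ] = -‿cong (coefficientℕ≈fromℕ (suc n))

    ℤ⟶ℝ : ℤ.+-*-rawRing -Raw-AlmostCommutative⟶ fromCommutativeRing commutativeRing
    ℤ⟶ℝ = record
      { ⟦_⟧    = coefficient
      ; +-homo = λ i j → trans (coefficient≈fromℤ (i ℤ.+ j)) (trans (fromℤ-homo-+ i j)
                   (sym (+-cong (coefficient≈fromℤ i) (coefficient≈fromℤ j))))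
      ; *-homo = λ i j → trans (coefficient≈fromℤ (i ℤ.* j)) (trans (fromℤ-homo-* i j)
                   (sym (*-cong (coefficient≈fromℤ i) (coefficient≈fromℤ j))))
      ; -‿homo = λ i → trans (coefficient≈fromℤ (ℤ.- i)) (trans (fromℤ-homo-neg i)
                   (sym (-‿cong (coefficient≈fromℤ i))))
      ; 0-homo = refl
      ; 1-homo = refl
      }

  open RingSolver ℤ.+-*-rawRing (fromCommutativeRing commutativeRing) ℤ⟶ℝ
    (λ i j → Maybe.map (reflexive ∘ ≡.cong coefficient) (dec⇒weaklyDec ℤₚ._≟_ i j)) public
    using (solve; _:=_; _:+_; _:*_; _:-_; :-_; con)

  fromℕ-homo-+ : ∀ m n → fromℕ (m ℕ.+ n) ≈ fromℕ m + fromℕ n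
  fromℕ-homo-+ m n = fromℤ-homo-+ (+ m) (+ n)

  fromℕ-homo-* : ∀ m n → fromℕ (m ℕ.* n) ≈ fromℕ m * fromℕ n
  fromℕ-homo-* m n = Mult.×1-homo-* semiring m n

  1/ℕ-cancel : ∀ {x y} n .{{_ : NonZero n}} → fromℕ n * x ≈ y → x ≈ 1/ℕ n * y
  1/ℕ-cancel {x} {y} n p = begin
    x                       ≈⟨ *-identityˡ x ⟨
    1# * x                  ≈⟨ *-congʳ (1/ℕ-inverse n) ⟨
    1/ℕ n * fromℕ n * x     ≈⟨ *-assoc _ _ _ ⟩
    1/ℕ n * (fromℕ n * x)   ≈⟨ *-congˡ p ⟩
    1/ℕ n * y               ∎

  fromℕ-cancelˡ : ∀ {x y} n .{{_ : NonZero n}} → fromℕ n * x ≈ fromℕ n * y → x ≈ y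
  fromℕ-cancelˡ n p = trans (1/ℕ-cancel n p) (sym (1/ℕ-cancel n refl))

  1/ℕ-homo-* : ∀ m n .{{_ : NonZero m}} .{{_ : NonZero n}} .{{_ : NonZero (m ℕ.* n)}} →
               1/ℕ (m ℕ.* n) ≈ 1/ℕ m * 1/ℕ n
  1/ℕ-homo-* m n = CauchyProof.1/ℕ-unique (m ℕ.* n) (begin
    1/ℕ m * 1/ℕ n * fromℕ (m ℕ.* n)         ≈⟨ *-congˡ (fromℕ-homo-* m n) ⟩
    1/ℕ m * 1/ℕ n * (fromℕ m * fromℕ n)
      ≈⟨ solve 4 (λ a b x y → a :* b :* (x :* y) := a :* x :* (b :* y)) refl _ _ _ _ ⟩
    1/ℕ m * fromℕ m * (1/ℕ n * fromℕ n)     ≈⟨ *-cong (1/ℕ-inverse m) (1/ℕ-inverse n) ⟩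
    1# * 1#                                 ≈⟨ *-identityˡ 1# ⟩
    1#                                      ∎)

  1/ℕ-cong : ∀ {m n} .{{_ : NonZero m}} .{{_ : NonZero n}} → m ≡ n → 1/ℕ m ≈ 1/ℕ n
  1/ℕ-cong ≡.refl = refl

  1/ℕ-1 : 1/ℕ 1 ≈ 1#
  1/ℕ-1 = trans (sym (*-identityʳ _)) (trans (*-congˡ (sym (+-identityʳ 1#))) (1/ℕ-inverse 1))

  ¬#⇒≈ : ∀ {x y} → ¬ (x # y) → x ≈ y
  ¬#⇒≈ = proj₁ (HeytingField.tight heytingField _ _)

  -- A merely nonzero x need not be invertible; cancellation comes from tightness.
  *-zero-cancelˡ : ∀ {x y} → x * y ≈ 0# → ¬ (x ≈ 0#) → y ≈ 0#
  *-zero-cancelˡ {x} {y} xy≈0 x≉0 = ¬#⇒≈ λ y#0 →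
    let (y⁻¹ , _ , yy⁻¹≈1) = #⇒invertible y#0 in
    x≉0 (begin
      x                       ≈⟨ *-identityʳ x ⟨
      x * 1#                  ≈⟨ *-congˡ yy⁻¹≈1 ⟨
      x * ((y - 0#) * y⁻¹)    ≈⟨ solve 3 (λ x y z → x :* ((y :- con (+ 0)) :* z) := x :* y :* z) refl x y y⁻¹ ⟩
      x * y * y⁻¹             ≈⟨ *-congʳ xy≈0 ⟩
      0# * y⁻¹                ≈⟨ zeroˡ _ ⟩
      0#                      ∎)

  x²≈0⇒x≈0 : ∀ {x} → x * x ≈ 0# → x ≈ 0#
  x²≈0⇒x≈0 {x} x²≈0 = ¬#⇒≈ λ x#0 →
    proj₂ (HeytingField.tight heytingField _ _)
      (*-zero-cancelˡ x²≈0 λ x≈0 → proj₂ (HeytingField.tight heytingField _ _) x≈0 x#0) x#0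

-- Null sequences, geometric bounds, and the Cauchy product of two series.

module Limits {c ℓ₁ ℓ₂} (ℛ : RealNumbers c ℓ₁ ℓ₂) where
  open Reals ℛ hiding (zero)
  open RealAlgebra ℛ
  open CauchyProof hiding (K; r)
  private
    module < = IsStrictPartialOrder <-isStrictPartialOrder
    module R = RingProperties ring
  open SetoidReasoning setoid

  Null : (ℕ → ℝ) → Set _
  Null s = ∀ ε → 0# < ε → ∃[ N ] (∀ n → N ℕ.≤ n → Bounded ε (s n))

  bounded-weaken : ∀ {u v x} → u < v → Bounded u x → Bounded v x
  bounded-weaken u<v (p , q) = <.trans p u<v , <.trans q u<v

  bounded-neg : ∀ {u x} → Bounded u x → Bounded u (- x)
  bounded-neg (p , q) = q , <.<-respˡ-≈ (sym (R.-‿involutive _)) p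

  bounded-0 : ∀ {u} → 0# < u → Bounded u 0#
  bounded-0 0<u = 0<u , <.<-respˡ-≈ (sym R.-0#≈0#) 0<u

  -- The way identities between limits are proved below: the difference of the two sides, a constant
  -- sequence, is exhibited as a combination of null sequences. If x were apart from 0, then |x|
  -- itself would be an admissible ε.
  null-const⇒≈0 : ∀ {x} → Null (λ _ → x) → x ≈ 0#
  null-const⇒≈0 {x} null = ¬#⇒≈ λ x#0 → case (#⇒<⊎> x#0)
    where
    case : x < 0# ⊎ 0# < x → ⊥
    case (inj₂ 0<x) = let (N , p) = null x 0<x in <.irrefl refl (proj₁ (p N ℕₚ.≤-refl))
    case (inj₁ x<0) = let (N , p) = null (- x) 0<-x in <.irrefl refl (proj₂ (p N ℕₚ.≤-refl))
      where
      0<-x : 0# < - x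
      0<-x = <.<-respʳ-≈ (+-identityˡ _) (x<y⇒0<y-x x<0)

  null-resp : ∀ {s t} → (∀ n → s n ≈ t n) → Null s → Null t
  null-resp s≈t null ε 0<ε = let (N , p) = null ε 0<ε in
    N , λ n N≤n → bounded-resp refl (s≈t n) (p n N≤n)

  null-+ : ∀ {s t} → Null s → Null t → Null (λ n → s n + t n)
  null-+ ns nt ε 0<ε = M ℕ.⊔ N , λ n h → bounded-resp ½ε+½ε≈ε refl
    (bounded-+ (p n (ℕₚ.≤-trans (ℕₚ.m≤m⊔n M N) h)) (q n (ℕₚ.≤-trans (ℕₚ.m≤n⊔m M N) h)))
    where
    0<½ε : 0# < ½ * ε
    0<½ε = *-pos (0<1/ℕ 2) 0<ε
    M = proj₁ (ns (½ * ε) 0<½ε)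
    p = proj₂ (ns (½ * ε) 0<½ε)
    N = proj₁ (nt (½ * ε) 0<½ε)
    q = proj₂ (nt (½ * ε) 0<½ε)
    ½ε+½ε≈ε : ½ * ε + ½ * ε ≈ ε
    ½ε+½ε≈ε = trans (sym (distribʳ ε ½ ½)) (trans (*-congʳ ½+½≈1) (*-identityˡ ε))

  null-neg : ∀ {s} → Null s → Null (λ n → - s n)
  null-neg ns ε 0<ε = let (N , p) = ns ε 0<ε in N , λ n h → bounded-neg (p n h)

  null-* : ∀ {s t} → Null s → Null t → Null (λ n → s n * t n)
  null-* ns nt ε 0<ε = M ℕ.⊔ N , λ n h → bounded-resp (*-identityʳ ε) refl
    (bounded-* (p n (ℕₚ.≤-trans (ℕₚ.m≤m⊔n M N) h)) (q n (ℕₚ.≤-trans (ℕₚ.m≤n⊔m M N) h)))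
    where
    M = proj₁ (ns ε 0<ε)
    p = proj₂ (ns ε 0<ε)
    N = proj₁ (nt 1# 0<1)
    q = proj₂ (nt 1# 0<1)

  null-scale : ∀ {s} x → Null s → Null (λ n → x * s n)
  null-scale {s} x ns ε 0<ε = N , λ k h → bounded-resp eq refl (bounded-* x-bound (p k h))
    where
    n = proj₁ (bound x)
    -- The successor makes `B` visibly nonzero, hence invertible.
    B = suc n
    0<ε/B : 0# < 1/ℕ B * ε
    0<ε/B = *-pos (0<1/ℕ B) 0<ε
    N = proj₁ (ns _ 0<ε/B)
    p = proj₂ (ns _ 0<ε/B)
    x-bound : Bounded (fromℕ B) x
    x-bound = let (p , q) = proj₂ (bound x) in
      fromℕ-mono-≤ (ℕₚ.n≤1+n n) p , fromℕ-mono-≤ (ℕₚ.n≤1+n n) q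
    eq : fromℕ B * (1/ℕ B * ε) ≈ ε
    eq = trans (sym (*-assoc _ _ _)) (trans (*-congʳ (trans (*-comm _ _) (1/ℕ-inverse B))) (*-identityˡ ε))

  null-subsequence : ∀ {s} (f : ℕ → ℕ) → (∀ n → n ℕ.≤ f n) → Null s → Null (s ∘ f)
  null-subsequence f n≤f ns ε 0<ε = let (N , p) = ns ε 0<ε in
    N , λ n N≤n → p (f n) (ℕₚ.≤-trans N≤n (n≤f n))

  ⟶⇒null : ∀ {s l} → s ⟶ l → Null (λ n → l - s n)
  ⟶⇒null {s} {l} lim ε 0<ε = let (N , p) = lim ε 0<ε in
    N , λ n N≤n → proj₂ (p n N≤n) ,
      <.<-respˡ-≈ (solve 2 (λ a b → a :- b := :- (b :- a)) refl (s n) l) (proj₁ (p n N≤n))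

  -- For n ≥ N > 2C/ε the inequality (n+1)½ⁿ < 2 gives 2C½ⁿ < (n+1)ε½ⁿ < 2ε. The Archimedean
  -- property thus provides `N` without any logarithm.
  geometric-null : ∀ {s} C → 0# < C → (∀ n → Bounded (C * ½ ^ n) (s n)) → Null s
  geometric-null {s} C 0<C s-bound ε 0<ε = N , λ n N≤n → bounded-weaken (small n N≤n) (s-bound n)
    where
    ε⁻¹ = proj₁ (#⇒invertible (#-sym (<⇒# 0<ε)))

    ε⁻¹*ε : ε⁻¹ * ε ≈ 1#
    ε⁻¹*ε = trans (*-congˡ (solve 1 (λ e → e := e :- con (+ 0)) refl ε))
      (proj₁ (proj₂ (#⇒invertible (#-sym (<⇒# 0<ε)))))

    N = proj₁ (archimedean ((C + C) * ε⁻¹))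

    small : ∀ n → N ℕ.≤ n → C * ½ ^ n < ε
    small n N≤n = halve (<-resp
      (solve 2 (λ c h → (c :+ c) :* h := c :* h :+ c :* h) refl C (½ ^ n))
      (solve 1 (λ e → (con (+ 1) :+ con (+ 1)) :* e := e :+ e) refl ε)
      (<.trans (*-monoʳ-< (½ ^ n) (0<½^ n) 2C<nε)
        (<.<-respˡ-≈ (solve 3 (λ a h e → a :* h :* e := a :* e :* h) refl (fromℕ (suc n)) (½ ^ n) ε)
          (*-monoʳ-< ε 0<ε (n½^n<2 n)))))
      where
      2C<nε : C + C < fromℕ (suc n) * ε
      2C<nε = <.<-respˡ-≈
        (trans (*-assoc _ _ _) (trans (*-congˡ ε⁻¹*ε) (*-identityʳ _)))
        (*-monoʳ-< ε 0<ε (fromℕ-mono-≤ (ℕₚ.≤-trans N≤n (ℕₚ.n≤1+n n))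
          (proj₂ (archimedean ((C + C) * ε⁻¹)))))

  GeometricallyBounded : ℝ → (ℕ → ℝ) → Set _
  GeometricallyBounded M t = ∀ n → Bounded (M * ½ ^ n) (t n)

  -- Ratio estimates hold only from some index on; the finitely many earlier terms are absorbed one
  -- at a time by enlarging the constant.
  tail-bound⇒bound : ∀ (t : ℕ → ℝ) K {M} → GeometricallyBounded M (λ i → t (i ℕ.+ K)) →
                     ∃[ M ] GeometricallyBounded M t
  tail-bound⇒bound t zero {M} b = M , λ i →
    bounded-resp refl (reflexive (≡.cong t (ℕₚ.+-identityʳ i))) (b i)
  tail-bound⇒bound t (suc K) {M} b = tail-bound⇒bound t K {M′} λ where
      zero    → bounded-weaken
        (<-resp (+-identityˡ B) (sym (*-identityʳ M′)) (+-monoˡ-< B (+-pos 0<M 0<M)))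
        (proj₂ (bound (t K)))
      (suc i) → bounded-weaken
        (<-resp (trans (+-identityˡ _) (sym (M½^i≈ i)))
          (solve 3 (λ m b h → b :* h :+ (m :+ m) :* h := (m :+ m :+ b) :* h) refl M B (½ ^ suc i))
          (+-monoˡ-< ((M + M) * ½ ^ suc i) (*-pos 0<B (0<½^ (suc i)))))
        (≡.subst (λ k → Bounded (M * ½ ^ i) (t k)) (ℕₚ.+-suc i K) (b i))
    where
    B = fromℕ (proj₁ (bound (t K)))
    -- The doubled `M` pays for the factor ½ lost when every index moves up by one, and `B` bounds
    -- the new first term.
    M′ = M + M + B

    +-pos : ∀ {x y} → 0# < x → 0# < y → 0# < x + y
    +-pos 0<x 0<y = <.<-respˡ-≈ (+-identityˡ 0#) (+-mono-< 0<x 0<y)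

    0<B : 0# < B
    0<B = bounded⇒0< (proj₂ (bound (t K)))

    0<M : 0# < M
    0<M = <.<-respʳ-≈ (*-identityʳ M) (bounded⇒0< (b 0))

    M½^i≈ : ∀ i → M * ½ ^ i ≈ (M + M) * ½ ^ suc i
    M½^i≈ i = trans (*-congˡ (sym (½^-double i)))
      (solve 2 (λ m h → m :* (h :+ h) := (m :+ m) :* h) refl M (½ ^ suc i))

  partialSum-cong : ∀ {s t} → (∀ n → s n ≈ t n) → ∀ n → partialSum s n ≈ partialSum t n
  partialSum-cong s≈t zero    = refl
  partialSum-cong s≈t (suc n) = +-cong (partialSum-cong s≈t n) (s≈t n)

  partialSum-shift : ∀ t n → partialSum t (suc n) ≈ t 0 + partialSum (t ∘ suc) n
  partialSum-shift t zero    = +-comm _ _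
  partialSum-shift t (suc n) = trans (+-congʳ (partialSum-shift t n)) (+-assoc _ _ _)

  partialSum-+ : ∀ s t n → partialSum (λ k → s k + t k) n ≈ partialSum s n + partialSum t n
  partialSum-+ s t zero    = sym (+-identityˡ 0#)
  partialSum-+ s t (suc n) = trans (+-congʳ (partialSum-+ s t n))
    (solve 4 (λ a b c d → a :+ b :+ (c :+ d) := a :+ c :+ (b :+ d)) refl _ _ _ _)

  *-partialSum : ∀ x t n → partialSum (λ k → x * t k) n ≈ x * partialSum t n
  *-partialSum x t zero    = sym (zeroʳ x)
  *-partialSum x t (suc n) = trans (+-congʳ (*-partialSum x t n)) (sym (distribˡ x _ _))

  -- antidiagonal f n = ∑_{k+l=n} f k l
  antidiagonal : (ℕ → ℕ → ℝ) → ℕ → ℝ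
  antidiagonal f zero    = f 0 0
  antidiagonal f (suc n) = f 0 (suc n) + antidiagonal (f ∘ suc) n

  antidiagonal-cong : ∀ {f g} → (∀ k l → f k l ≈ g k l) → ∀ n → antidiagonal f n ≈ antidiagonal g n
  antidiagonal-cong f≈g zero    = f≈g 0 0
  antidiagonal-cong f≈g (suc n) = +-cong (f≈g 0 (suc n)) (antidiagonal-cong (f≈g ∘ suc) n)

  antidiagonal-+ : ∀ f g n → antidiagonal (λ k l → f k l + g k l) n ≈ antidiagonal f n + antidiagonal g n
  antidiagonal-+ f g zero    = refl
  antidiagonal-+ f g (suc n) = trans (+-congˡ (antidiagonal-+ (f ∘ suc) (g ∘ suc) n))
    (solve 4 (λ a b c d → a :+ b :+ (c :+ d) := a :+ c :+ (b :+ d)) refl _ _ _ _)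

  *-antidiagonal : ∀ x f n → antidiagonal (λ k l → x * f k l) n ≈ x * antidiagonal f n
  *-antidiagonal x f zero    = refl
  *-antidiagonal x f (suc n) = trans (+-congˡ (*-antidiagonal x (f ∘ suc) n)) (sym (distribˡ x _ _))

  antidiagonal-last : ∀ f n →
    antidiagonal f (suc n) ≈ antidiagonal (λ k l → f k (suc l)) n + f (suc n) 0
  antidiagonal-last f zero    = refl
  antidiagonal-last f (suc n) = trans (+-congˡ (antidiagonal-last (f ∘ suc) n)) (sym (+-assoc _ _ _))

  antidiagonal-weight : ∀ f n →
    fromℕ n * antidiagonal f n ≈
    antidiagonal (λ k l → fromℕ k * f k l) n + antidiagonal (λ k l → fromℕ l * f k l) n
  antidiagonal-weight f n = trans (go f 0 n) (+-congʳ (antidiagonal-cong (λ k l →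
      reflexive (≡.cong (λ m → fromℕ m * f k l) (ℕₚ.+-identityʳ k))) n))
    where
    -- The recursion passes to `f ∘ suc`, whose first index is one too small; `m` counts how often
    -- this has happened.
    go : ∀ f m n → fromℕ (m ℕ.+ n) * antidiagonal f n ≈
      antidiagonal (λ k l → fromℕ (k ℕ.+ m) * f k l) n + antidiagonal (λ k l → fromℕ l * f k l) n
    go f m zero    = trans (*-congʳ (reflexive (≡.cong fromℕ (ℕₚ.+-identityʳ m))))
      (sym (trans (+-congˡ (zeroˡ _)) (+-identityʳ _)))
    go f m (suc n) = begin
      fromℕ (m ℕ.+ suc n) * (f 0 (suc n) + A)
        ≈⟨ distribˡ _ _ _ ⟩
      fromℕ (m ℕ.+ suc n) * f 0 (suc n) + fromℕ (m ℕ.+ suc n) * A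
        ≈⟨ +-cong (trans (*-congʳ (fromℕ-homo-+ m (suc n))) (distribʳ _ _ _))
             (trans (*-congʳ (reflexive (≡.cong fromℕ (ℕₚ.+-suc m n)))) (go (f ∘ suc) (suc m) n)) ⟩
      (fromℕ m * f 0 (suc n) + fromℕ (suc n) * f 0 (suc n))
        + (antidiagonal (λ k l → fromℕ (k ℕ.+ suc m) * f (suc k) l) n + C)
        ≈⟨ +-congˡ (+-congʳ (antidiagonal-cong (λ k l →
             reflexive (≡.cong (λ j → fromℕ j * f (suc k) l) (ℕₚ.+-suc k m))) n)) ⟩
      (fromℕ m * f 0 (suc n) + fromℕ (suc n) * f 0 (suc n)) + (B + C)
        ≈⟨ solve 4 (λ a b c d → a :+ b :+ (c :+ d) := a :+ c :+ (b :+ d)) refl _ _ _ _ ⟩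
      (fromℕ m * f 0 (suc n) + B) + (fromℕ (suc n) * f 0 (suc n) + C) ∎
      where
      A = antidiagonal (f ∘ suc) n
      B = antidiagonal (λ k l → fromℕ (suc k ℕ.+ m) * f (suc k) l) n
      C = antidiagonal (λ k l → fromℕ l * f (suc k) l) n

  -- The Leibniz rule on coefficients: for f k l = aₖbₗ it says (ab)′ = a′b + ab′. Both the addition
  -- formula for `expTerm` and the multinomial recursion follow from it by induction on the degree.
  antidiagonal-suc : ∀ f n →
    fromℕ (suc n) * antidiagonal f (suc n) ≈
    antidiagonal (λ k l → fromℕ (suc k) * f (suc k) l) n
      + antidiagonal (λ k l → fromℕ (suc l) * f k (suc l)) n
  antidiagonal-suc f n = trans (antidiagonal-weight f (suc n)) (+-cong
    (trans (+-congʳ (zeroˡ _)) (+-identityˡ _))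
    (trans (antidiagonal-last (λ k l → fromℕ l * f k l) n)
      (trans (+-congˡ (zeroˡ _)) (+-identityʳ _))))

  -- A condition on the second index is enough, because k + l = 2n forces k and l to have the same
  -- parity.
  antidiagonal-even : ∀ f → (∀ k l → f k (suc (2 ℕ.* l)) ≈ 0#) → ∀ n →
    antidiagonal f (2 ℕ.* n) ≈ antidiagonal (λ k l → f (2 ℕ.* k) (2 ℕ.* l)) n
  antidiagonal-even f odd zero    = refl
  antidiagonal-even f odd (suc n) = begin
    antidiagonal f (2 ℕ.* suc n)
      ≡⟨ ≡.cong (antidiagonal f) (ℕₚ.*-suc 2 n) ⟩
    f 0 (suc (suc (2 ℕ.* n))) + (f 1 (suc (2 ℕ.* n)) + antidiagonal (λ k → f (2 ℕ.+ k)) (2 ℕ.* n))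
      ≈⟨ +-congˡ (trans (+-congʳ (odd 1 n)) (+-identityˡ _)) ⟩
    f 0 (suc (suc (2 ℕ.* n))) + antidiagonal (λ k → f (2 ℕ.+ k)) (2 ℕ.* n)
      ≈⟨ +-cong (reflexive (≡.cong (f 0) (≡.sym (ℕₚ.*-suc 2 n))))
           (trans (antidiagonal-even (λ k → f (2 ℕ.+ k)) (λ k → odd (2 ℕ.+ k)) n)
             (antidiagonal-cong (λ k l → reflexive (≡.cong (λ m → f m (2 ℕ.* l)) (≡.sym (ℕₚ.*-suc 2 k)))) n)) ⟩
    f 0 (2 ℕ.* suc n) + antidiagonal (λ k l → f (2 ℕ.* suc k) (2 ℕ.* l)) n ∎

  cauchyProduct : (ℕ → ℝ) → (ℕ → ℝ) → ℕ → ℝ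
  cauchyProduct s t = antidiagonal (λ k l → s k * t l)

  cauchyProduct-partialSum-shift : ∀ s t n →
    partialSum (cauchyProduct s t) (suc n) ≈
    s 0 * partialSum t (suc n) + partialSum (cauchyProduct (s ∘ suc) t) n
  cauchyProduct-partialSum-shift s t n = begin
    partialSum (cauchyProduct s t) (suc n)
      ≈⟨ partialSum-shift (cauchyProduct s t) n ⟩
    s 0 * t 0 + partialSum (λ k → s 0 * t (suc k) + cauchyProduct (s ∘ suc) t k) n
      ≈⟨ +-congˡ (trans (partialSum-+ (λ k → s 0 * t (suc k)) _ n) (+-congʳ (*-partialSum (s 0) (t ∘ suc) n))) ⟩
    s 0 * t 0 + (s 0 * partialSum (t ∘ suc) n + P)
      ≈⟨ solve 4 (λ a b c d → a :* b :+ (a :* c :+ d) := a :* (b :+ c) :+ d) refl (s 0) (t 0) _ P ⟩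
    s 0 * (t 0 + partialSum (t ∘ suc) n) + P
      ≈⟨ +-congʳ (*-congˡ (partialSum-shift t n)) ⟨
    s 0 * partialSum t (suc n) + P ∎
    where P = partialSum (cauchyProduct (s ∘ suc) t) n

  cauchyError : (ℕ → ℝ) → (ℕ → ℝ) → ℕ → ℝ
  cauchyError s t n = partialSum s n * partialSum t n - partialSum (cauchyProduct s t) n

  -- The products with s 0 occur in full in both partial sums and cancel. What remains is the error
  -- for the shifted sequence and the one column of products that the shorter sum misses.
  cauchyError-suc : ∀ s t n →
    cauchyError s t (suc n) ≈ cauchyError (s ∘ suc) t n + partialSum (s ∘ suc) n * t n
  cauchyError-suc s t n = trans
    (+-cong (*-congʳ (partialSum-shift s n)) (-‿cong (cauchyProduct-partialSum-shift s t n)))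
    (solve 5 (λ s₀ p q tₙ c → (s₀ :+ p) :* (q :+ tₙ) :- (s₀ :* (q :+ tₙ) :+ c) := p :* q :- c :+ p :* tₙ)
      refl (s 0) (partialSum (s ∘ suc) n) (partialSum t n) (t n) (partialSum (cauchyProduct (s ∘ suc) t) n))

  -- The constant 4 is that of `tail-bound`, applied to the tail that starts at index 0.
  partialSum-bounded : ∀ {M t} → GeometricallyBounded M t → ∀ n → Bounded (quadruple M) (partialSum t n)
  partialSum-bounded {M} {t} b n = bounded-resp
    (cong-quadruple (*-identityʳ M))
    (trans (+-cong (reflexive (≡.cong (partialSum t) (ℕₚ.+-identityʳ n))) R.-0#≈0#) (+-identityʳ _))
    (tail-bound t 0 (M * 1#) (λ i → bounded-resp (*-congʳ (sym (*-identityʳ M)))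
      (reflexive (≡.cong t (≡.sym (ℕₚ.+-identityʳ i)))) (b i)) n)
    where
    cong-quadruple : ∀ {x y} → x ≈ y → quadruple x ≈ quadruple y
    cong-quadruple p = +-cong (+-cong p p) (+-cong p p)

  geometricallyBounded-suc : ∀ {M t} → GeometricallyBounded M t → GeometricallyBounded (M * ½) (t ∘ suc)
  geometricallyBounded-suc b n = bounded-resp (sym (*-assoc _ _ _)) refl (b (suc n))

  -- Induction on n with s varying. Shifting s halves its constant, so the inherited error amounts
  -- to n+1 copies of 4MM′½ⁿ⁺¹, and the new product contributes exactly one more copy. Hence the
  -- linear factor.
  cauchyError-bounded : ∀ {M M′ s t} → GeometricallyBounded M s → GeometricallyBounded M′ t →
    ∀ n → Bounded (fromℕ (suc n) * (quadruple (M * M′) * ½ ^ n)) (cauchyError s t n)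
  cauchyError-bounded {M} {M′} {s} {t} bs bt zero =
    bounded-resp (solve 1 (λ q → q := (con (+ 1) :+ con (+ 0)) :* (q :* con (+ 1))) refl _)
      (solve 0 (con (+ 0) := con (+ 0) :* con (+ 0) :- con (+ 0)) refl)
      (bounded-0 (0<quadruple (*-pos (0<bound bs) (0<bound bt))))
    where
    0<bound : ∀ {M t} → GeometricallyBounded M t → 0# < M
    0<bound b = <.<-respʳ-≈ (*-identityʳ _) (bounded⇒0< (b 0))
    0<x+x : ∀ {x} → 0# < x → 0# < x + x
    0<x+x 0<x = <.<-respˡ-≈ (+-identityˡ 0#) (+-mono-< 0<x 0<x)
    0<quadruple : ∀ {x} → 0# < x → 0# < quadruple x
    0<quadruple 0<x = 0<x+x (0<x+x 0<x)
  cauchyError-bounded {M} {M′} {s} {t} bs bt (suc n) =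
    bounded-resp
      (solve 5 (λ k m m′ h ½ → let q = λ x → (x :+ x) :+ (x :+ x) in
          k :* (q (m :* ½ :* m′) :* h) :+ q (m :* ½) :* (m′ :* h) :=
          (con (+ 1) :+ k) :* (q (m :* m′) :* (½ :* h)))
        refl (fromℕ (suc n)) M M′ (½ ^ n) ½)
      (sym (cauchyError-suc s t n))
      (bounded-+ (cauchyError-bounded (geometricallyBounded-suc bs) bt n)
        (bounded-* (partialSum-bounded (geometricallyBounded-suc bs) n) (bt n)))

  -- Along even indices half of the exponent absorbs the linear factor: (2n+1)½ⁿ < 4 leaves the
  -- geometric bound 4C½ⁿ.
  cauchyError-null : ∀ {M M′ s t} → GeometricallyBounded M s → GeometricallyBounded M′ t →
                     Null (λ n → cauchyError s t (n ℕ.+ n))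
  cauchyError-null {M} {M′} {s} {t} bs bt = geometric-null (quadruple C) 0<C′ λ n →
      bounded-weaken (weak n) (cauchyError-bounded bs bt (n ℕ.+ n))
    where
    C = quadruple (M * M′)

    0<fx : ∀ k {x} → 0# < fromℕ (suc k) * x → 0# < x
    0<fx k {x} p = <-resp (zeroˡ _)
      (trans (*-comm _ _) (trans (sym (*-assoc _ _ _)) (trans (*-congʳ (1/ℕ-inverse (suc k))) (*-identityˡ x))))
      (*-monoʳ-< (1/ℕ (suc k)) (0<1/ℕ (suc k)) p)

    0<C : 0# < C
    0<C = <.<-respʳ-≈ (*-identityʳ C) (0<fx 0 (bounded⇒0< (cauchyError-bounded bs bt 0)))

    0<C′ : 0# < quadruple C
    0<C′ = <.<-respˡ-≈ (solve 0 ((con (+ 0) :+ con (+ 0)) :+ (con (+ 0) :+ con (+ 0)) := con (+ 0)) refl)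
      (+-mono-< (+-mono-< 0<C 0<C) (+-mono-< 0<C 0<C))

    weak : ∀ n → fromℕ (suc (n ℕ.+ n)) * (C * ½ ^ (n ℕ.+ n)) < quadruple C * ½ ^ n
    weak n = <.<-respˡ-≈ (*-congˡ (*-congˡ (sym (Exp.^-homo-* semiring ½ n n))))
      (<-resp (*-assoc _ C _) eq (<.trans
        (*-monoʳ-< (½ ^ n * ½ ^ n) (*-pos (0<½^ n) (0<½^ n))
          (*-monoʳ-< C 0<C 2n+1<)) last))
      where
      h = ½ ^ n
      2n+1< : fromℕ (suc (n ℕ.+ n)) < fromℕ (suc n) + fromℕ (suc n)
      2n+1< = <.<-respʳ-≈ (fromℕ-homo-+ (suc n) (suc n))
        (≡.subst (λ k → fromℕ (suc (n ℕ.+ n)) < fromℕ k) (≡.cong suc (≡.sym (ℕₚ.+-suc n n)))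
          (<.<-respˡ-≈ (+-identityˡ _) (+-monoˡ-< _ 0<1)))
      eq : (1# + 1# + (1# + 1#)) * (C * h) ≈ quadruple C * h
      eq = solve 2 (λ c h → let o = con (+ 1) in (o :+ o :+ (o :+ o)) :* (c :* h) :=
             ((c :+ c) :+ (c :+ c)) :* h) refl C h
      last : (fromℕ (suc n) + fromℕ (suc n)) * C * (h * h) < (1# + 1# + (1# + 1#)) * (C * h)
      last = <.<-respˡ-≈ (solve 3 (λ a c h → (a :* h :+ a :* h) :* (c :* h) := (a :+ a) :* c :* (h :* h))
          refl (fromℕ (suc n)) C h)
        (*-monoʳ-< (C * h) (*-pos 0<C (0<½^ n)) (+-mono-< (n½^n<2 n) (n½^n<2 n)))

-- The functional equation of the cosine, from its power series.

module Cosine {c ℓ₁ ℓ₂} (ℛ : RealNumbers c ℓ₁ ℓ₂) where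
  open Reals ℛ hiding (zero)
  open RealAlgebra ℛ
  open Limits ℛ
  private
    module R = RingProperties ring
    module C = CauchyProof
  open SetoidReasoning setoid

  expTerm : ℝ → ℕ → ℝ
  expTerm x k = x ^ k * 1/ℕ (k !) {{k ℕₚ.!≢0}}

  expTerm-suc : ∀ x k → fromℕ (suc k) * expTerm x (suc k) ≈ x * expTerm x k
  expTerm-suc x k = begin
    fromℕ (suc k) * (x * x ^ k * 1/ℕ (suc k !) {{suc k ℕₚ.!≢0}})
      ≈⟨ *-congˡ (*-congˡ (1/ℕ-homo-* (suc k) (k !) {{_}} {{k ℕₚ.!≢0}} {{suc k ℕₚ.!≢0}})) ⟩
    fromℕ (suc k) * (x * x ^ k * (1/ℕ (suc k) * 1/ℕ (k !) {{k ℕₚ.!≢0}}))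
      ≈⟨ solve 5 (λ a x p b f → a :* (x :* p :* (b :* f)) := (b :* a) :* (x :* (p :* f))) refl _ x _ _ _ ⟩
    (1/ℕ (suc k) * fromℕ (suc k)) * (x * expTerm x k)
      ≈⟨ trans (*-congʳ (1/ℕ-inverse (suc k))) (*-identityˡ _) ⟩
    x * expTerm x k ∎

  -- The binomial theorem in divided powers. Multiplying by n+1 turns the step into the Leibniz rule
  -- `antidiagonal-suc`, so no binomial coefficients are needed.
  expTerm-+ : ∀ x y n → expTerm (x + y) n ≈ cauchyProduct (expTerm x) (expTerm y) n
  expTerm-+ x y zero    = sym (trans (*-congʳ (trans (*-identityˡ _) 1/ℕ-1)) (*-identityˡ _))
  expTerm-+ x y (suc n) = fromℕ-cancelˡ (suc n) (begin
    fromℕ (suc n) * expTerm (x + y) (suc n)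
      ≈⟨ expTerm-suc (x + y) n ⟩
    (x + y) * expTerm (x + y) n
      ≈⟨ trans (distribʳ _ x y) (+-cong (*-congˡ (expTerm-+ x y n)) (*-congˡ (expTerm-+ x y n))) ⟩
    x * cauchyProduct (expTerm x) (expTerm y) n + y * cauchyProduct (expTerm x) (expTerm y) n
      ≈⟨ +-cong (*-antidiagonal x _ n) (*-antidiagonal y _ n) ⟨
    antidiagonal (λ k l → x * (expTerm x k * expTerm y l)) n
      + antidiagonal (λ k l → y * (expTerm x k * expTerm y l)) n
      ≈⟨ +-cong
           (antidiagonal-cong (λ k l → trans (sym (*-assoc _ _ _))
             (trans (*-congʳ (sym (expTerm-suc x k))) (*-assoc _ _ _))) n)
           (antidiagonal-cong (λ k l → trans (swap y _ _)
             (trans (*-congˡ (sym (expTerm-suc y l))) (swap _ _ _))) n) ⟩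
    antidiagonal (λ k l → fromℕ (suc k) * (expTerm x (suc k) * expTerm y l)) n
      + antidiagonal (λ k l → fromℕ (suc l) * (expTerm x k * expTerm y (suc l))) n
      ≈⟨ antidiagonal-suc (λ k l → expTerm x k * expTerm y l) n ⟨
    fromℕ (suc n) * cauchyProduct (expTerm x) (expTerm y) (suc n) ∎)
    where
    swap : ∀ a b c → a * (b * c) ≈ b * (a * c)
    swap = solve 3 (λ a b c → a :* (b :* c) := b :* (a :* c)) refl

  -‿^-even : ∀ x n → (- x) ^ (2 ℕ.* n) ≈ x ^ (2 ℕ.* n)
  -‿^-even x zero    = refl
  -‿^-even x (suc n) = begin
    (- x) ^ (2 ℕ.* suc n)             ≡⟨ ≡.cong ((- x) ^_) (ℕₚ.*-suc 2 n) ⟩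
    - x * (- x * (- x) ^ (2 ℕ.* n))   ≈⟨ *-congˡ (*-congˡ (-‿^-even x n)) ⟩
    - x * (- x * x ^ (2 ℕ.* n))       ≈⟨ solve 2 (λ x p → (:- x) :* ((:- x) :* p) := x :* (x :* p)) refl x _ ⟩
    x * (x * x ^ (2 ℕ.* n))           ≡⟨ ≡.cong (x ^_) (ℕₚ.*-suc 2 n) ⟨
    x ^ (2 ℕ.* suc n)                 ∎

  cosTerm≈ : ∀ x n → cosTerm x n ≈ (- 1#) ^ n * expTerm x (2 ℕ.* n)
  cosTerm≈ x n = *-assoc _ _ _

  cosTerm-cong : ∀ {x y} → x ≈ y → ∀ n → cosTerm x n ≈ cosTerm y n
  cosTerm-cong x≈y n = *-congʳ (*-congˡ (Exp.^-congˡ semiring (2 ℕ.* n) x≈y))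

  antidiagonal-^ : ∀ z f n → antidiagonal (λ k l → z ^ k * z ^ l * f k l) n ≈ z ^ n * antidiagonal f n
  antidiagonal-^ z f zero    = *-congʳ (*-identityˡ 1#)
  antidiagonal-^ z f (suc n) = begin
    1# * z ^ suc n * f 0 (suc n) + antidiagonal (λ k l → z ^ suc k * z ^ l * f (suc k) l) n
      ≈⟨ +-cong (*-congʳ (*-identityˡ _)) (antidiagonal-cong (λ k l →
           solve 4 (λ z a b f → z :* a :* b :* f := z :* (a :* b :* f)) refl z _ _ _) n) ⟩
    z ^ suc n * f 0 (suc n) + antidiagonal (λ k l → z * (z ^ k * z ^ l * f (suc k) l)) n
      ≈⟨ +-congˡ (trans (*-antidiagonal z _ n) (*-congˡ (antidiagonal-^ z (f ∘ suc) n))) ⟩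
    z ^ suc n * f 0 (suc n) + z * (z ^ n * antidiagonal (f ∘ suc) n)
      ≈⟨ solve 4 (λ z p a b → z :* p :* a :+ z :* (p :* b) := z :* p :* (a :+ b)) refl z _ _ _ ⟩
    z ^ suc n * antidiagonal f (suc n) ∎

  -- Adding the expansions for y and -y cancels the odd powers of y. As the total degree 2n is even,
  -- the odd powers of x disappear with them, and these are the terms in which the sine would have
  -- entered.
  cosTerm-add : ∀ x y n → cosTerm (x + y) n + cosTerm (x - y) n ≈
    cauchyProduct (cosTerm x) (cosTerm y) n + cauchyProduct (cosTerm x) (cosTerm y) n
  cosTerm-add x y n = begin
    cosTerm (x + y) n + cosTerm (x - y) n
      ≈⟨ +-cong (cosTerm≈ _ n) (cosTerm≈ _ n) ⟩
    s * expTerm (x + y) (2 ℕ.* n) + s * expTerm (x - y) (2 ℕ.* n)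
      ≈⟨ distribˡ _ _ _ ⟨
    s * (expTerm (x + y) (2 ℕ.* n) + expTerm (x - y) (2 ℕ.* n))
      ≈⟨ *-congˡ (+-cong (expTerm-+ x y (2 ℕ.* n)) (expTerm-+ x (- y) (2 ℕ.* n))) ⟩
    s * (cauchyProduct (expTerm x) (expTerm y) (2 ℕ.* n)
       + cauchyProduct (expTerm x) (expTerm (- y)) (2 ℕ.* n))
      ≈⟨ *-congˡ (antidiagonal-+ _ _ (2 ℕ.* n)) ⟨
    s * antidiagonal f (2 ℕ.* n)
      ≈⟨ *-congˡ (antidiagonal-even f odd n) ⟩
    s * antidiagonal (λ k l → f (2 ℕ.* k) (2 ℕ.* l)) n
      ≈⟨ *-congˡ (antidiagonal-cong even n) ⟩
    s * antidiagonal (λ k l → g k l + g k l) n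
      ≈⟨ *-congˡ (antidiagonal-+ g g n) ⟩
    s * (antidiagonal g n + antidiagonal g n)
      ≈⟨ distribˡ _ _ _ ⟩
    s * antidiagonal g n + s * antidiagonal g n
      ≈⟨ +-cong sign sign ⟨
    cauchyProduct (cosTerm x) (cosTerm y) n + cauchyProduct (cosTerm x) (cosTerm y) n ∎
    where
    s = (- 1#) ^ n
    f g : ℕ → ℕ → ℝ
    f k l = expTerm x k * expTerm y l + expTerm x k * expTerm (- y) l
    g k l = expTerm x (2 ℕ.* k) * expTerm y (2 ℕ.* l)
    odd : ∀ k l → f k (suc (2 ℕ.* l)) ≈ 0#
    odd k l = trans (+-congˡ (*-congˡ (*-congʳ (*-congˡ (-‿^-even y l)))))
      (solve 4 (λ a y p i → a :* (y :* p :* i) :+ a :* ((:- y) :* p :* i) := con (+ 0)) refl _ y _ _)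
    even : ∀ k l → f (2 ℕ.* k) (2 ℕ.* l) ≈ g k l + g k l
    even k l = +-congˡ (*-congˡ (*-congʳ (-‿^-even y l)))
    sign : cauchyProduct (cosTerm x) (cosTerm y) n ≈ s * antidiagonal g n
    sign = trans (antidiagonal-cong (λ k l → trans (*-cong (cosTerm≈ x k) (cosTerm≈ y l))
      (solve 4 (λ a b c d → a :* b :* (c :* d) := a :* c :* (b :* d)) refl _ _ _ _)) n)
      (antidiagonal-^ (- 1#) g n)

  -- From index `K x` on the ratio of consecutive terms is below ½, the estimate that made the
  -- partial sums Cauchy; `tail-bound⇒bound` takes care of the terms before.
  cosTerm-geometric : ∀ x → ∃[ M ] GeometricallyBounded M (cosTerm x)
  cosTerm-geometric x = tail-bound⇒bound (cosTerm x) (C.K x) eventually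
    where
    eventually : GeometricallyBounded (fromℕ (proj₁ (C.bound (cosTerm x (C.K x))))) (λ i → cosTerm x (i ℕ.+ C.K x))
    eventually zero    = C.bounded-resp (sym (*-identityʳ _)) refl (proj₂ (C.bound (cosTerm x (C.K x))))
    eventually (suc i) = C.bounded-resp
      (trans (*-assoc _ _ C.½) (*-congˡ (*-comm _ C.½))) (sym (C.term-suc x (i ℕ.+ C.K x)))
      (C.bounded-* (eventually i) (C.r-bound x (i ℕ.+ C.K x) (ℕₚ.m≤n+m (C.K x) i)))

  cosError : ℝ → ℕ → ℝ
  cosError x n = cos x - partialSum (cosTerm x) n

  cosError-null : ∀ x → Null (cosError x)
  cosError-null x = ⟶⇒null (proj₂ (complete _ (cos-cauchy x)))

  x-y≈0⇒x≈y : ∀ {x y} → x - y ≈ 0# → x ≈ y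
  x-y≈0⇒x≈y {x} {y} p = trans (solve 2 (λ x y → x := x :- y :+ y) refl x y)
    (trans (+-congʳ p) (+-identityˡ y))

  cos-cong : ∀ {x y} → x ≈ y → cos x ≈ cos y
  cos-cong {x} {y} x≈y = x-y≈0⇒x≈y (null-const⇒≈0 (null-resp
    (λ n → trans (+-congˡ (-‿cong (+-congˡ (-‿cong
        (partialSum-cong (λ k → sym (cosTerm-cong x≈y k)) n)))))
      (solve 3 (λ a b p → a :- p :- (b :- p) := a :- b) refl (cos x) (cos y) _))
    (null-+ (cosError-null x) (null-neg (cosError-null y)))))

  cos-0 : cos 0# ≈ 1#
  cos-0 = x-y≈0⇒x≈y (null-const⇒≈0 (null-resp
    (λ n → +-congˡ (-‿cong (one n)))
    (null-subsequence suc (λ n → ℕₚ.n≤1+n n) (cosError-null 0#))))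
    where
    one : ∀ n → partialSum (cosTerm 0#) (suc n) ≈ 1#
    one zero    = trans (+-identityˡ _) (trans (*-congʳ (*-identityˡ 1#)) (trans (*-identityˡ _) 1/ℕ-1))
    one (suc n) = trans (+-cong (one n) (trans (*-congʳ (trans (*-congˡ (zeroˡ _)) (zeroʳ _))) (zeroˡ _)))
      (+-identityʳ 1#)

  -- Let P, Q be the partial sums for x and y, and e = cos x - P, f = cos y - Q. Then cos x cos y =
  -- PQ + f cos x + e cos y - ef, and PQ differs from the partial sum of the Cauchy product by
  -- `cauchyError`. All the errors are null; they are sampled at even indices because
  -- `cauchyError-null` is about those.
  cos-add : ∀ x y → cos (x + y) + cos (x - y) ≈ cos x * cos y + cos x * cos y
  cos-add x y = x-y≈0⇒x≈y (null-const⇒≈0 (null-resp eq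
    (null-+
      (null-+ (double (cosError-null (x + y))) (double (cosError-null (x - y))))
      (null-+ (null-+ (twice (null-neg (null-scale (cos x) (double (cosError-null y)))))
                      (twice (null-neg (null-scale (cos y) (double (cosError-null x))))))
        (null-+ (twice (null-* (double (cosError-null x)) (double (cosError-null y))))
          (twice (null-neg (cauchyError-null (proj₂ (cosTerm-geometric x)) (proj₂ (cosTerm-geometric y))))))))))
    where
    double : ∀ {s} → Null s → Null (λ n → s (n ℕ.+ n))
    double = null-subsequence (λ n → n ℕ.+ n) (λ n → ℕₚ.m≤m+n n n)
    twice : ∀ {s} → Null s → Null (λ n → s n + s n)
    twice ns = null-+ ns ns
    eq : ∀ n → _ ≈ cos (x + y) + cos (x - y) - (cos x * cos y + cos x * cos y)
    eq n = trans
      (solve 9 (λ cp cm cx cy p m px py q →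
          let err = px :* py :- q
              a = :- (cx :* (cy :- py))
              b = :- (cy :* (cx :- px))
              e = (cx :- px) :* (cy :- py)
              f = :- err
          in ((cp :- p) :+ (cm :- m)) :+ (((a :+ a) :+ (b :+ b)) :+ ((e :+ e) :+ (f :+ f))) :=
             cp :+ cm :- (cx :* cy :+ cx :* cy) :- ((p :+ m) :- (q :+ q)))
        refl (cos (x + y)) (cos (x - y)) (cos x) (cos y)
        (P (x + y)) (P (x - y)) (P x) (P y) Q)
      (trans (+-congˡ (trans (-‿cong (trans (+-congʳ sums) (-‿inverseʳ (Q + Q)))) R.-0#≈0#)) (+-identityʳ _))
      where
      N = n ℕ.+ n
      P : ℝ → ℝ
      P z = partialSum (cosTerm z) N
      Q = partialSum (cauchyProduct (cosTerm x) (cosTerm y)) N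
      -- Here the identity between the power series enters: the partial sums satisfy the equation
      -- exactly, with the Cauchy product in place of the product.
      sums : P (x + y) + P (x - y) ≈ Q + Q
      sums = trans (sym (partialSum-+ _ _ N)) (trans (partialSum-cong (cosTerm-add x y) N) (partialSum-+ _ _ N))

  cos-neg : ∀ x → cos (- x) ≈ cos x
  cos-neg x = x-y≈0⇒x≈y (begin
    cos (- x) - cos x
      ≈⟨ solve 2 (λ a b → a :- b := b :+ a :- (con (+ 1) :* b :+ con (+ 1) :* b)) refl (cos (- x)) (cos x) ⟩
    cos x + cos (- x) - (1# * cos x + 1# * cos x)
      ≈⟨ +-cong (+-cong (cos-cong (sym (+-identityˡ x))) (cos-cong (sym (+-identityˡ (- x)))))
           (-‿cong (+-cong (*-congʳ (sym cos-0)) (*-congʳ (sym cos-0)))) ⟩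
    cos (0# + x) + cos (0# - x) - (cos 0# * cos x + cos 0# * cos x)
      ≈⟨ trans (+-congʳ (cos-add 0# x)) (-‿inverseʳ _) ⟩
    0# ∎)

-- Period and values of the cosine, deduced from its least positive zero.

module Periodicity {c ℓ₁ ℓ₂} (ℛ : RealNumbers c ℓ₁ ℓ₂) (π : Reals.ℝ ℛ) (isPi : Reals.IsPi ℛ π) where
  open Reals ℛ hiding (zero)
  open RealAlgebra ℛ
  open Limits ℛ
  open Cosine ℛ
  private
    module < = IsStrictPartialOrder <-isStrictPartialOrder
    module R = RingProperties ring
    module C = CauchyProof
  open SetoidReasoning setoid

  -- The cosine rescaled to period 1; the entries of `cos2π π ξ` are its values by definition.
  cos₁ : ℝ → ℝ
  cos₁ t = cos (fromℕ 2 * π * t)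

  cos₁-cong : ∀ {s t} → s ≈ t → cos₁ s ≈ cos₁ t
  cos₁-cong s≈t = cos-cong (*-congˡ s≈t)

  cos₁-0 : cos₁ 0# ≈ 1#
  cos₁-0 = trans (cos-cong (zeroʳ _)) cos-0

  cos₁-neg : ∀ t → cos₁ (- t) ≈ cos₁ t
  cos₁-neg t = trans (cos-cong (sym (R.-‿distribʳ-* _ t))) (cos-neg _)

  cos₁-add : ∀ s t → cos₁ (s + t) + cos₁ (s - t) ≈ cos₁ s * cos₁ t + cos₁ s * cos₁ t
  cos₁-add s t = trans
    (+-cong (cos-cong (distribˡ _ s t))
      (cos-cong (trans (distribˡ _ s (- t)) (+-congˡ (sym (R.-‿distribʳ-* _ t))))))
    (cos-add _ _)

  ¼ : ℝ
  ¼ = 1/ℕ 4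

  4¼≈1 : ¼ + ¼ + (¼ + ¼) ≈ 1#
  4¼≈1 = trans (solve 1 (λ q → let o = con (+ 1) in
    q :+ q :+ (q :+ q) := q :* (o :+ (o :+ (o :+ (o :+ con (+ 0)))))) refl ¼) (1/ℕ-inverse 4)

  2π¼ : fromℕ 2 * π * ¼ ≈ π * 1/ℕ 2
  2π¼ = fromℕ-cancelˡ 2 (begin
    fromℕ 2 * (fromℕ 2 * π * ¼)   ≈⟨ solve 3 (λ a p t → a :* (a :* p :* t) := t :* (a :* a) :* p) refl _ π ¼ ⟩
    ¼ * (fromℕ 2 * fromℕ 2) * π   ≈⟨ *-congʳ (*-congˡ (fromℕ-homo-* 2 2)) ⟨
    ¼ * fromℕ 4 * π               ≈⟨ *-congʳ (1/ℕ-inverse 4) ⟩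
    1# * π                        ≈⟨ *-congʳ (1/ℕ-inverse 2) ⟨
    1/ℕ 2 * fromℕ 2 * π           ≈⟨ solve 3 (λ a b p → b :* a :* p := a :* (p :* b)) refl _ _ π ⟩
    fromℕ 2 * (π * 1/ℕ 2)         ∎)

  cos₁-¼ : cos₁ ¼ ≈ 0#
  cos₁-¼ = trans (cos-cong 2π¼) (proj₁ (proj₂ isPi))

  cos₁≉0 : ∀ {t} → 0# < t → t < ¼ → ¬ cos₁ t ≈ 0#
  cos₁≉0 {t} 0<t t<¼ = proj₂ (proj₂ isPi) _ (*-pos 0<2π 0<t)
    (<-resp (*-comm _ _) (trans (*-comm _ _) 2π¼) (*-monoʳ-< _ 0<2π t<¼))
    where
    0<2π : 0# < fromℕ 2 * π
    0<2π = *-pos (0<fromℕ 1) (proj₁ isPi)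

  -- The addition formula around the midpoint t + ¼: the sum of the two values is twice a product
  -- with cos₁ ¼ = 0.
  cos₁-½ : ∀ t → cos₁ (t + (¼ + ¼)) ≈ - cos₁ t
  cos₁-½ t = begin
    cos₁ (t + (¼ + ¼))
      ≈⟨ solve 2 (λ a b → a := a :+ b :- b) refl (cos₁ (t + (¼ + ¼))) (cos₁ t) ⟩
    cos₁ (t + (¼ + ¼)) + cos₁ t - cos₁ t
      ≈⟨ +-congʳ (+-cong
           (cos₁-cong (solve 2 (λ t q → t :+ (q :+ q) := t :+ q :+ q) refl t ¼))
           (cos₁-cong (solve 2 (λ t q → t := t :+ q :- q) refl t ¼))) ⟩
    cos₁ (t + ¼ + ¼) + cos₁ (t + ¼ - ¼) - cos₁ t
      ≈⟨ +-congʳ (trans (cos₁-add (t + ¼) ¼) (+-cong (*-congˡ cos₁-¼) (*-congˡ cos₁-¼))) ⟩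
    cos₁ (t + ¼) * 0# + cos₁ (t + ¼) * 0# - cos₁ t
      ≈⟨ solve 2 (λ a b → a :* con (+ 0) :+ a :* con (+ 0) :- b := :- b) refl _ _ ⟩
    - cos₁ t ∎

  cos₁-+1 : ∀ t → cos₁ (t + 1#) ≈ cos₁ t
  cos₁-+1 t = begin
    cos₁ (t + 1#)                        ≈⟨ cos₁-cong (trans (+-congˡ (sym 4¼≈1)) (sym (+-assoc _ _ _))) ⟩
    cos₁ (t + (¼ + ¼) + (¼ + ¼))         ≈⟨ cos₁-½ _ ⟩
    - cos₁ (t + (¼ + ¼))                 ≈⟨ -‿cong (cos₁-½ t) ⟩
    - - cos₁ t                           ≈⟨ R.-‿involutive _ ⟩
    cos₁ t                               ∎

  cos₁-+ℕ : ∀ t n → cos₁ (t + fromℕ n) ≈ cos₁ t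
  cos₁-+ℕ t zero    = cos₁-cong (+-identityʳ t)
  cos₁-+ℕ t (suc n) = trans (cos₁-cong (sym (+-assoc t 1# _))) (trans (cos₁-+ℕ (t + 1#) n) (cos₁-+1 t))

  cos₁-+ℤ : ∀ t i → cos₁ (t + fromℤ i) ≈ cos₁ t
  cos₁-+ℤ t (+ n)    = cos₁-+ℕ t n
  cos₁-+ℤ t -[1+ n ] = trans (sym (cos₁-+ℕ (t - fromℕ (suc n)) (suc n))) (cos₁-cong (-‿cancelʳ t _))

  x+x≈0⇒x≈0 : ∀ {x} → x + x ≈ 0# → x ≈ 0#
  x+x≈0⇒x≈0 {x} p = fromℕ-cancelˡ 2 (begin
    fromℕ 2 * x   ≈⟨ solve 1 (λ x → (con (+ 1) :+ (con (+ 1) :+ con (+ 0))) :* x := x :+ x) refl x ⟩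
    x + x         ≈⟨ p ⟩
    0#            ≈⟨ zeroʳ _ ⟨
    fromℕ 2 * 0#  ∎)

  cos₁-double : ∀ t → cos₁ (t + t) + 1# ≈ cos₁ t * cos₁ t + cos₁ t * cos₁ t
  cos₁-double t = trans (+-congˡ (trans (sym cos₁-0) (cos₁-cong (sym (-‿inverseʳ t))))) (cos₁-add t t)

  -- In terms of the sine: sin² = 1 - cos².
  cos₁²≈1⇒ : ∀ {t} → cos₁ t * cos₁ t ≈ 1# → cos₁ (t - ¼) ≈ 0#
  cos₁²≈1⇒ {t} p = x²≈0⇒x≈0 (x+x≈0⇒x≈0 (begin
    cos₁ (t - ¼) * cos₁ (t - ¼) + cos₁ (t - ¼) * cos₁ (t - ¼)
      ≈⟨ cos₁-double (t - ¼) ⟨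
    cos₁ (t - ¼ + (t - ¼)) + 1#
      ≈⟨ +-congʳ (R.-‿involutive _) ⟨
    - - cos₁ (t - ¼ + (t - ¼)) + 1#
      ≈⟨ +-congʳ (-‿cong (sym (cos₁-½ _))) ⟩
    - cos₁ (t - ¼ + (t - ¼) + (¼ + ¼)) + 1#
      ≈⟨ +-congʳ (-‿cong (cos₁-cong (solve 2 (λ t q → t :- q :+ (t :- q) :+ (q :+ q) := t :+ t) refl t ¼))) ⟩
    - cos₁ (t + t) + 1#
      ≈⟨ solve 1 (λ x → :- x :+ con (+ 1) := :- (x :+ con (+ 1)) :+ (con (+ 1) :+ con (+ 1))) refl _ ⟩
    - (cos₁ (t + t) + 1#) + (1# + 1#)
      ≈⟨ +-congʳ (-‿cong (trans (cos₁-double t) (+-cong p p))) ⟩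
    - (1# + 1#) + (1# + 1#)
      ≈⟨ -‿inverseˡ _ ⟩
    0# ∎))

  1≉0 : ¬ 1# ≈ 0#
  1≉0 p = <.irrefl (sym p) 0<1

  module _ (m : ℕ) .{{_ : NonZero m}} where

    private
      u : ℝ
      -- A 4m-th of the period: m steps make the quarter period, where the cosine is known to
      -- vanish, and the fraction r/m is 4r steps.
      u = 1/ℕ m * ¼

    0<u : 0# < u
    0<u = *-pos (C.0<1/ℕ m) (C.0<1/ℕ 4)

    mu≈¼ : fromℕ m * u ≈ ¼
    mu≈¼ = trans (sym (*-assoc _ _ _)) (trans (*-congʳ (trans (*-comm _ _) (1/ℕ-inverse m))) (*-identityˡ ¼))

    [a+b]u : ∀ a b → fromℕ (a ℕ.+ b) * u ≈ fromℕ a * u + fromℕ b * u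
    [a+b]u a b = trans (*-congʳ (fromℕ-homo-+ a b)) (distribʳ _ _ _)

    cos₁-gap : ∀ b → suc b ℕ.< m → ¬ cos₁ (fromℕ (suc b) * u) ≈ 0#
    cos₁-gap b b<m with ℕₚ.m≤n⇒∃[o]m+o≡n b<m
    ... | o , eq = cos₁≉0 (*-pos (0<fromℕ b) 0<u)
      (<-resp (+-identityˡ _)
        (trans (+-comm _ _) (trans (sym ([a+b]u (suc b) (suc o)))
          (trans (*-congʳ (reflexive (≡.cong fromℕ (≡.trans (ℕₚ.+-suc (suc b) o) eq)))) mu≈¼)))
        (+-monoˡ-< (fromℕ (suc b) * u) (*-pos (0<fromℕ o) 0<u)))

    -- Where the square is 1, the cosine vanishes a quarter period away, that is, at distance |a -
    -- m| steps from 0. This distance is below m and, unless a = m, positive, which contradicts the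
    -- minimality of π/2. For a = m the square is 0 instead of 1.
    cos₁²≉1 : ∀ a → 0 ℕ.< a → a ℕ.< m ℕ.+ m → ¬ cos₁ (fromℕ a * u) * cos₁ (fromℕ a * u) ≈ 1#
    cos₁²≉1 a 0<a a<2m p with ℕ.compare a m
    ... | ℕ.less .a k = cos₁-gap k
      (≡.subst (suc k ℕ.<_) (ℕₚ.+-suc a k) (ℕₚ.+-monoˡ-≤ (suc k) 0<a))
      (trans (cos₁-cong eq) (trans (cos₁-neg _) (cos₁²≈1⇒ p)))
      where
      eq : fromℕ (suc k) * u ≈ - (fromℕ a * u - ¼)
      eq = begin
        fromℕ (suc k) * u                               ≈⟨ solve 2 (λ x y → x := :- (y :- (y :+ x))) refl _ _ ⟩
        - (fromℕ a * u - (fromℕ a * u + fromℕ (suc k) * u))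
          ≈⟨ -‿cong (+-congˡ (-‿cong (trans (sym ([a+b]u a (suc k)))
               (trans (*-congʳ (reflexive (≡.cong fromℕ (ℕₚ.+-suc a k)))) mu≈¼)))) ⟩
        - (fromℕ a * u - ¼)                             ∎
    ... | ℕ.equal .a = 1≉0 (trans (sym p) (trans (*-congʳ (trans (cos₁-cong mu≈¼) cos₁-¼)) (zeroˡ _)))
    ... | ℕ.greater .m k = cos₁-gap k
      (ℕₚ.+-cancelˡ-< m (suc k) m (≡.subst (ℕ._< m ℕ.+ m) (≡.sym (ℕₚ.+-suc m k)) a<2m))
      (trans (cos₁-cong eq) (cos₁²≈1⇒ p))
      where
      eq : fromℕ (suc k) * u ≈ fromℕ (suc (m ℕ.+ k)) * u - ¼
      eq = begin
        fromℕ (suc k) * u                               ≈⟨ solve 2 (λ x y → x := y :+ x :- y) refl _ _ ⟩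
        fromℕ m * u + fromℕ (suc k) * u - fromℕ m * u
          ≈⟨ +-cong (trans (sym ([a+b]u m (suc k))) (*-congʳ (reflexive (≡.cong fromℕ (ℕₚ.+-suc m k))))) (-‿cong mu≈¼) ⟩
        fromℕ (suc (m ℕ.+ k)) * u - ¼ ∎

    cos₁-2m : ∀ b → cos₁ (fromℕ (m ℕ.+ m ℕ.+ b) * u) ≈ - cos₁ (fromℕ b * u)
    cos₁-2m b = trans (cos₁-cong (trans ([a+b]u (m ℕ.+ m) b) (trans (+-comm _ _)
      (+-congˡ (trans ([a+b]u m m) (+-cong mu≈¼ mu≈¼)))))) (cos₁-½ _)

    -- From half a period on, the half-period shift turns the value 1 into -1. This is why the
    -- preceding lemma excludes both through their common square.
    cos₁≉1 : ∀ a → 0 ℕ.< a → a ℕ.< m ℕ.+ m ℕ.+ (m ℕ.+ m) → ¬ cos₁ (fromℕ a * u) ≈ 1#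
    cos₁≉1 a 0<a a<4m p with ℕₚ.<-≤-connex a (m ℕ.+ m)
    ... | inj₁ a<2m = cos₁²≉1 a 0<a a<2m (trans (*-cong p p) (*-identityˡ 1#))
    ... | inj₂ 2m≤a with ℕₚ.m≤n⇒∃[o]m+o≡n 2m≤a
    ... | zero  , ≡.refl = 1≉0 (x+x≈0⇒x≈0 (trans (+-congˡ (begin
        1#                                      ≈⟨ p ⟨
        cos₁ (fromℕ (m ℕ.+ m ℕ.+ 0) * u)        ≈⟨ cos₁-2m 0 ⟩
        - cos₁ (0# * u)                         ≈⟨ -‿cong (trans (cos₁-cong (zeroˡ u)) cos₁-0) ⟩
        - 1#                                    ∎)) (-‿inverseʳ 1#)))
    ... | suc b , ≡.refl = cos₁²≉1 (suc b) z<s (ℕₚ.+-cancelˡ-< (m ℕ.+ m) (suc b) (m ℕ.+ m) a<4m) (begin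
        x * x             ≈⟨ solve 1 (λ x → x :* x := (:- x) :* (:- x)) refl x ⟩
        - x * - x         ≈⟨ *-cong -x≈1 -x≈1 ⟩
        1# * 1#           ≈⟨ *-identityˡ 1# ⟩
        1#                ∎)
      where
      x = cos₁ (fromℕ (suc b) * u)
      -x≈1 : - x ≈ 1#
      -x≈1 = trans (sym (cos₁-2m (suc b))) p

    -- Modulo 1 the fraction z/m equals r/m with r = z mod m, which is 4r steps of `u`;
    -- non-divisibility makes r positive.
    cos₁-rational≉1 : ∀ z → ¬ (+ m ∣ℤ z) → ¬ cos₁ (fromℤ z * 1/ℕ m) ≈ 1#
    cos₁-rational≉1 z m∤z p = cos₁≉1 (4 ℕ.* r) 0<4r 4r<4m
      (trans (cos₁-cong eq) (trans (sym (cos₁-+ℤ _ q)) (trans (cos₁-cong eq′) p)))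
      where
      r = z ℤDiv.%ℕ m
      q = z ℤDiv./ℕ m

      0<4r : 0 ℕ.< 4 ℕ.* r
      0<4r with r in r≡
      ... | zero  = ⊥-elim (m∤z (divides q (≡.trans (ℤDiv.a≡a%ℕn+[a/ℕn]*n z m)
        (≡.trans (≡.cong (λ r → + r ℤ.+ q ℤ.* + m) r≡) (ℤₚ.+-identityˡ _)))))
      ... | suc _ = z<s

      4r<4m : 4 ℕ.* r ℕ.< m ℕ.+ m ℕ.+ (m ℕ.+ m)
      4r<4m = ≡.subst (4 ℕ.* r ℕ.<_)
        (≡.trans (≡.cong (λ k → m ℕ.+ (m ℕ.+ (m ℕ.+ k))) (ℕₚ.+-identityʳ m)) (≡.sym (ℕₚ.+-assoc m m (m ℕ.+ m))))
        (ℕₚ.*-monoʳ-< 4 (ℤDiv.n%ℕd<d z m))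

      eq : fromℕ (4 ℕ.* r) * u ≈ fromℕ r * 1/ℕ m
      eq = begin
        fromℕ (4 ℕ.* r) * u                 ≈⟨ *-congʳ (fromℕ-homo-* 4 r) ⟩
        fromℕ 4 * fromℕ r * (1/ℕ m * ¼)
          ≈⟨ solve 4 (λ a b c d → a :* b :* (c :* d) := b :* c :* (d :* a)) refl _ _ _ _ ⟩
        fromℕ r * 1/ℕ m * (¼ * fromℕ 4)     ≈⟨ trans (*-congˡ (1/ℕ-inverse 4)) (*-identityʳ _) ⟩
        fromℕ r * 1/ℕ m                     ∎

      eq′ : fromℕ r * 1/ℕ m + fromℤ q ≈ fromℤ z * 1/ℕ m
      eq′ = begin
        fromℕ r * 1/ℕ m + fromℤ q                                 ≈⟨ +-congˡ (trans (*-congˡ (1/ℕ-inverse m)) (*-identityʳ _)) ⟨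
        fromℕ r * 1/ℕ m + fromℤ q * (1/ℕ m * fromℕ m)
          ≈⟨ solve 4 (λ r i q m → r :* i :+ q :* (i :* m) := (r :+ q :* m) :* i) refl _ _ _ _ ⟩
        (fromℤ (+ r) + fromℤ q * fromℤ (+ m)) * 1/ℕ m             ≈⟨ *-congʳ (+-congˡ (fromℤ-homo-* q (+ m))) ⟨
        (fromℤ (+ r) + fromℤ (q ℤ.* + m)) * 1/ℕ m                 ≈⟨ *-congʳ (fromℤ-homo-+ (+ r) (q ℤ.* + m)) ⟨
        fromℤ (+ r ℤ.+ q ℤ.* + m) * 1/ℕ m                         ≡⟨ ≡.cong (λ i → fromℤ i * 1/ℕ m) (ℤDiv.a≡a%ℕn+[a/ℕn]*n z m) ⟨
        fromℤ z * 1/ℕ m                                           ∎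

    -- The products by cos T are sums of a forward and a backward shift of the index. Since mT is an
    -- integer, either shift permutes the terms; the backward one is expressed as the phase φ - T,
    -- so the phase must be free. The factor cos T - 1 is only known to be nonzero, hence
    -- `*-zero-cancelˡ`.
    cos₁-arithmetic-sum : ∀ φ z → ¬ (+ m ∣ℤ z) →
      partialSum (λ k → cos₁ (φ + fromℕ k * (fromℤ z * 1/ℕ m))) m ≈ 0#
    cos₁-arithmetic-sum φ z m∤z = x+x≈0⇒x≈0 (*-zero-cancelˡ {cos₁ T - 1#} (begin
        (cos₁ T - 1#) * (S φ + S φ)
          ≈⟨ solve 2 (λ c s → (c :- con (+ 1)) :* (s :+ s) := c :* s :+ c :* s :- (s :+ s)) refl _ _ ⟩
        cos₁ T * S φ + cos₁ T * S φ - (S φ + S φ)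
          ≈⟨ +-congʳ (+-cong (sym (*-partialSum _ _ m)) (sym (*-partialSum _ _ m))) ⟩
        partialSum (λ k → cos₁ T * g φ k) m + partialSum (λ k → cos₁ T * g φ k) m - (S φ + S φ)
          ≈⟨ +-congʳ (partialSum-+ _ _ m) ⟨
        partialSum (λ k → cos₁ T * g φ k + cos₁ T * g φ k) m - (S φ + S φ)
          ≈⟨ +-congʳ (partialSum-cong shifts m) ⟩
        partialSum (λ k → g φ (suc k) + g (φ - T) k) m - (S φ + S φ)
          ≈⟨ +-congʳ (partialSum-+ _ _ m) ⟩
        partialSum (g φ ∘ suc) m + S (φ - T) - (S φ + S φ)
          ≈⟨ +-congʳ (+-cong (rotate φ) (trans (sym (rotate (φ - T))) (partialSum-cong (shift φ) m))) ⟩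
        S φ + S φ - (S φ + S φ)
          ≈⟨ -‿inverseʳ _ ⟩
        0# ∎) λ cosT-1≈0 → cos₁-rational≉1 z m∤z (x-y≈0⇒x≈y cosT-1≈0))
      where
      T = fromℤ z * 1/ℕ m

      g : ℝ → ℕ → ℝ
      g φ k = cos₁ (φ + fromℕ k * T)

      S : ℝ → ℝ
      S φ = partialSum (g φ) m

      shift : ∀ φ k → g (φ - T) (suc k) ≈ g φ k
      shift φ k = cos₁-cong (solve 3 (λ p t k → p :- t :+ (con (+ 1) :+ k) :* t := p :+ k :* t) refl φ T (fromℕ k))

      periodic : ∀ φ → g φ m ≈ g φ 0
      periodic φ = begin
        cos₁ (φ + fromℕ m * T)     ≈⟨ cos₁-cong (+-cong (solve 2 (λ p t → p := p :+ con (+ 0) :* t) refl φ T) mT≈z) ⟩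
        cos₁ (φ + 0# * T + fromℤ z) ≈⟨ cos₁-+ℤ _ z ⟩
        cos₁ (φ + 0# * T)          ∎
        where
        mT≈z : fromℕ m * T ≈ fromℤ z
        mT≈z = trans (solve 3 (λ m z i → m :* (z :* i) := z :* (i :* m)) refl _ _ _)
          (trans (*-congˡ (1/ℕ-inverse m)) (*-identityʳ _))

      rotate : ∀ φ → partialSum (g φ ∘ suc) m ≈ S φ
      rotate φ = begin
        partialSum (g φ ∘ suc) m
          ≈⟨ solve 2 (λ a p → p := a :+ p :- a) refl (g φ 0) _ ⟩
        g φ 0 + partialSum (g φ ∘ suc) m - g φ 0
          ≈⟨ +-cong (sym (partialSum-shift (g φ) m)) (-‿cong (sym (periodic φ))) ⟩
        S φ + g φ m - g φ m
          ≈⟨ +-cancelʳ _ _ ⟩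
        S φ ∎

      shifts : ∀ k → cos₁ T * g φ k + cos₁ T * g φ k ≈ g φ (suc k) + g (φ - T) k
      shifts k = begin
        cos₁ T * g φ k + cos₁ T * g φ k
          ≈⟨ +-cong (*-comm _ _) (*-comm _ _) ⟩
        g φ k * cos₁ T + g φ k * cos₁ T
          ≈⟨ cos₁-add _ T ⟨
        cos₁ (φ + fromℕ k * T + T) + cos₁ (φ + fromℕ k * T - T)
          ≈⟨ +-cong
               (cos₁-cong (solve 3 (λ p t k → p :+ k :* t :+ t := p :+ (con (+ 1) :+ k) :* t) refl φ T (fromℕ k)))
               (cos₁-cong (solve 3 (λ p t k → p :+ k :* t :- t := p :- t :+ k :* t) refl φ T (fromℕ k))) ⟩
        g φ (suc k) + g (φ - T) k ∎

-- Alternating multilinear maps, and the determinant as one of them.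

module Columns where
  open import Data.Integer.Base using (_+_; _*_; -_; _^_)
  open ≡ using (refl; sym; trans; cong; cong₂; subst; module ≡-Reasoning)
  open ℤS
  private module ∑ = CMSum ℤₚ.+-0-commutativeMonoid

  sum-zero : ∀ {n} {f : Vector ℤ n} → (∀ j → f j ≡ 0ℤ) → ∑.sum f ≡ 0ℤ
  sum-zero {n} f≗0 = trans (∑.sum-cong-≗ f≗0) (∑.sum-replicate-zero n)

  sum-linear : ∀ {n} a b (f g h : Vector ℤ n) → (∀ j → f j ≡ a * g j + b * h j) →
               ∑.sum f ≡ a * ∑.sum g + b * ∑.sum h
  sum-linear {zero}  a b f g h eq = solve 2 (λ a b → con 0ℤ := a :* con 0ℤ :+ b :* con 0ℤ) refl a b
  sum-linear {suc n} a b f g h eq = trans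
    (cong₂ _+_ (eq zero) (sum-linear a b (f ∘ suc) (g ∘ suc) (h ∘ suc) (eq ∘ suc)))
    (solve 6 (λ a b x y s t → a :* x :+ b :* y :+ (a :* s :+ b :* t) := a :* (x :+ s) :+ b :* (y :+ t))
      refl a b (g zero) (h zero) _ _)

  Columns : ℕ → ℕ → Set
  Columns r m = Vector (Vector ℤ r) m

  private variable r m n : ℕ

  -- Vectors are functions compared pointwise, so respect for this equality is an axiom, and
  -- multilinearity relates three families that agree off one column. Vanishing is asked for
  -- adjacent equal columns: two neighbours stay neighbours when another column is deleted, as in
  -- the Laplace expansion, and the reduction acts on the two leading columns only.
  record IsAlternating (H : Columns r m → ℤ) : Set where
    field
      congruent   : ∀ {M N} → (∀ j → M j ≗ N j) → H M ≡ H N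
      multilinear : ∀ j a b {M X Y} →
        (∀ k → k ≢ j → M k ≗ X k) → (∀ k → k ≢ j → M k ≗ Y k) →
        (∀ i → M j i ≡ a * X j i + b * Y j i) → H M ≡ a * H X + b * H Y
      adjacent    : ∀ i j {M} → toℕ j ≡ suc (toℕ i) → M i ≗ M j → H M ≡ 0ℤ

  private
    punchIn-adjacent : ∀ (k : Fin (suc n)) i j → toℕ j ≡ suc (toℕ i) → k ≢ i → k ≢ j →
      ∃[ i′ ] ∃[ j′ ] (toℕ j′ ≡ suc (toℕ i′) × punchIn k i′ ≡ i × punchIn k j′ ≡ j)
    punchIn-adjacent zero zero j adj k≢i k≢j = ⊥-elim (k≢i refl)
    punchIn-adjacent zero (suc i) (suc j) adj k≢i k≢j = i , j , ℕₚ.suc-injective adj , refl , refl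
    punchIn-adjacent {suc n} (suc zero) zero (suc zero) adj k≢i k≢j = ⊥-elim (k≢j refl)
    punchIn-adjacent {suc (suc n)} (suc (suc k)) zero (suc zero) adj k≢i k≢j =
      zero , suc zero , refl , refl , refl
    punchIn-adjacent {suc n} (suc k) (suc i) (suc j) adj k≢i k≢j
      with punchIn-adjacent k i j (ℕₚ.suc-injective adj) (k≢i ∘ cong suc) (k≢j ∘ cong suc)
    ... | i′ , j′ , adj′ , p , q = suc i′ , suc j′ , cong suc adj′ , cong suc p , cong suc q

    -- Makes the minors at the two equal columns coincide in `cancel`, so that their opposite signs
    -- annihilate them.
    punchIn-adjacent-≗ : ∀ (i j : Fin (suc n)) (M : Columns r (suc n)) → toℕ j ≡ suc (toℕ i) → M i ≗ M j →
      ∀ k → M (punchIn i k) ≗ M (punchIn j k)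
    punchIn-adjacent-≗ zero (suc zero) M adj eq zero    l = sym (eq l)
    punchIn-adjacent-≗ zero (suc zero) M adj eq (suc k) l = refl
    punchIn-adjacent-≗ (suc i) (suc j) M adj eq zero    l = refl
    punchIn-adjacent-≗ (suc i) (suc j) M adj eq (suc k) l =
      punchIn-adjacent-≗ i j (M ∘ suc) (ℕₚ.suc-injective adj) eq k l

    sum-adjacent : ∀ (i j : Fin n) {f : Vector ℤ n} → toℕ j ≡ suc (toℕ i) →
      (∀ k → k ≢ i → k ≢ j → f k ≡ 0ℤ) → f i + f j ≡ 0ℤ → ∑.sum f ≡ 0ℤ
    sum-adjacent zero (suc zero) {f} adj others eq = trans (sym (ℤₚ.+-assoc (f zero) _ _))
      (cong₂ _+_ eq (sum-zero λ k → others (suc (suc k)) (λ ()) (λ ())))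
    sum-adjacent (suc i) (suc j) adj others eq = cong₂ _+_ (others zero (λ ()) (λ ()))
      (sum-adjacent i j (ℕₚ.suc-injective adj)
        (λ k k≢i k≢j → others (suc k) (k≢i ∘ Finₚ.suc-injective) (k≢j ∘ Finₚ.suc-injective)) eq)

  -- The recursive clause of `det ∘ transpose`, with an arbitrary `H` for the smaller determinant;
  -- `det-isAlternating` therefore holds by induction without rewriting.
  laplace : (Columns r m → ℤ) → Columns (suc r) (suc m) → ℤ
  laplace H M = ∑.sum λ j → (-1ℤ ^ toℕ j) * M j zero * H (λ k i → M (punchIn j k) (suc i))

  laplace-isAlternating : {H : Columns r m → ℤ} → IsAlternating H → IsAlternating (laplace H)
  laplace-isAlternating {H = H} alt = record
    { congruent   = λ M≗N → ∑.sum-cong-≗ λ j →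
        cong₂ _*_ (cong (-1ℤ ^ toℕ j *_) (M≗N j zero)) (congruent λ k i → M≗N (punchIn j k) (suc i))
    ; multilinear = λ j a b M≗X M≗Y eq → sum-linear a b _ _ _ (linear j a b M≗X M≗Y eq)
    ; adjacent    = λ i j {M} adj Mi≗Mj → sum-adjacent i j adj
        (λ k k≢i k≢j → let (i′ , j′ , adj′ , p , q) = punchIn-adjacent k i j adj k≢i k≢j in
          trans (cong (-1ℤ ^ toℕ k * M k zero *_) (adjacent i′ j′ adj′ λ l →
            trans (cong (λ h → M h (suc l)) p) (trans (Mi≗Mj (suc l)) (cong (λ h → M h (suc l)) (sym q)))))
            (ℤₚ.*-zeroʳ (-1ℤ ^ toℕ k * M k zero)))
        (cancel i j M adj Mi≗Mj)
    }
    where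
    open IsAlternating alt

    linear : ∀ j a b {M X Y} →
      (∀ k → k ≢ j → M k ≗ X k) → (∀ k → k ≢ j → M k ≗ Y k) →
      (∀ i → M j i ≡ a * X j i + b * Y j i) → ∀ k →
      (-1ℤ ^ toℕ k) * M k zero * H (λ l i → M (punchIn k l) (suc i)) ≡
      a * ((-1ℤ ^ toℕ k) * X k zero * H (λ l i → X (punchIn k l) (suc i))) +
      b * ((-1ℤ ^ toℕ k) * Y k zero * H (λ l i → Y (punchIn k l) (suc i)))
    linear j a b {M} {X} {Y} M≗X M≗Y eq k with k Finₚ.≟ j
    ... | yes refl = begin
      s * M k zero * h M
        ≡⟨ cong (λ z → s * z * h M) (eq zero) ⟩
      s * (a * X k zero + b * Y k zero) * h M
        ≡⟨ solve 6 (λ s a b x y h → s :* (a :* x :+ b :* y) :* h := a :* (s :* x :* h) :+ b :* (s :* y :* h))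
             refl s a b (X k zero) (Y k zero) (h M) ⟩
      a * (s * X k zero * h M) + b * (s * Y k zero * h M)
        ≡⟨ cong₂ (λ u v → a * (s * X k zero * u) + b * (s * Y k zero * v))
             (congruent λ l i → M≗X (punchIn k l) (Finₚ.punchInᵢ≢i k l) (suc i))
             (congruent λ l i → M≗Y (punchIn k l) (Finₚ.punchInᵢ≢i k l) (suc i)) ⟩
      a * (s * X k zero * h X) + b * (s * Y k zero * h Y) ∎
      where
      open ≡-Reasoning
      s = -1ℤ ^ toℕ k
      h : Columns _ _ → ℤ
      h Z = H (λ l i → Z (punchIn k l) (suc i))
    ... | no k≢j = begin
      s * M k zero * h M
        ≡⟨ cong (s * M k zero *_) (multilinear j′ a b
             (λ l l≢j′ i → M≗X _ (off l l≢j′) (suc i)) (λ l l≢j′ i → M≗Y _ (off l l≢j′) (suc i))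
             (λ i → trans (cong (λ z → M z (suc i)) j′≡) (trans (eq (suc i))
               (cong₂ (λ u v → a * X u (suc i) + b * Y v (suc i)) (sym j′≡) (sym j′≡))))) ⟩
      s * M k zero * (a * h X + b * h Y)
        ≡⟨ solve 6 (λ s m a b x y → s :* m :* (a :* x :+ b :* y) := a :* (s :* m :* x) :+ b :* (s :* m :* y))
             refl s (M k zero) a b (h X) (h Y) ⟩
      a * (s * M k zero * h X) + b * (s * M k zero * h Y)
        ≡⟨ cong₂ (λ u v → a * (s * u * h X) + b * (s * v * h Y)) (M≗X k k≢j zero) (M≗Y k k≢j zero) ⟩
      a * (s * X k zero * h X) + b * (s * Y k zero * h Y) ∎
      where
      open ≡-Reasoning
      s = -1ℤ ^ toℕ k
      h : Columns _ _ → ℤ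
      h Z = H (λ l i → Z (punchIn k l) (suc i))
      j′ = punchOut k≢j
      j′≡ : punchIn k j′ ≡ j
      j′≡ = Finₚ.punchIn-punchOut k≢j
      off : ∀ l → l ≢ j′ → punchIn k l ≢ j
      off l l≢j′ p = l≢j′ (Finₚ.punchIn-injective k l j′ (trans p (sym j′≡)))

    cancel : ∀ i j (M : Columns _ _) → toℕ j ≡ suc (toℕ i) → M i ≗ M j →
      (-1ℤ ^ toℕ i) * M i zero * H (λ l k → M (punchIn i l) (suc k)) +
      (-1ℤ ^ toℕ j) * M j zero * H (λ l k → M (punchIn j l) (suc k)) ≡ 0ℤ
    cancel i j M adj Mi≗Mj = begin
      s * M i zero * h i + (-1ℤ ^ toℕ j) * M j zero * h j
        ≡⟨ cong₂ (λ z t → s * M i zero * h i + z * M j zero * t) (cong (-1ℤ ^_) adj) hj≡hi ⟩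
      s * M i zero * h i + -1ℤ * s * M j zero * h i
        ≡⟨ cong (λ z → s * z * h i + -1ℤ * s * M j zero * h i) (Mi≗Mj zero) ⟩
      s * M j zero * h i + -1ℤ * s * M j zero * h i
        ≡⟨ solve 3 (λ s m h → s :* m :* h :+ con -1ℤ :* s :* m :* h := con 0ℤ) refl s (M j zero) (h i) ⟩
      0ℤ ∎
      where
      open ≡-Reasoning
      s = -1ℤ ^ toℕ i
      h : Fin _ → ℤ
      h k = H (λ l i → M (punchIn k l) (suc i))
      hj≡hi : h j ≡ h i
      hj≡hi = congruent λ k l → sym (punchIn-adjacent-≗ i j M adj Mi≗Mj k (suc l))

  det-isAlternating : ∀ d → IsAlternating {d} {d} (det ∘ transpose)
  det-isAlternating zero    = record
    { congruent = λ _ → refl ; multilinear = λ () ; adjacent = λ () }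
  det-isAlternating (suc d) = laplace-isAlternating (det-isAlternating d)

-- Euclidean column reduction over the integers.

module Reduction where
  open import Data.Integer.Base using (_+_; _*_; -_; _-_; _^_)
  open ≡ using (refl; sym; trans; cong; cong₂; subst; module ≡-Reasoning)
  open ℤS
  open Columns
  private module ∑ = CMSum ℤₚ.+-0-commutativeMonoid

  private variable
    r m n : ℕ
    x y : Vector ℤ r
    ℓ : Level

  record Submodule ℓ r : Set (lsuc ℓ) where
    field
      Member      : Vector ℤ r → Set ℓ
      respects    : x ≗ y → Member x → Member y
      zeroVector  : Member (λ _ → 0ℤ)
      combination : ∀ a b → Member x → Member y → Member (λ i → a * x i + b * y i)

  open Submodule

  infix 4 _~_
  -- Equality of column spans, in the form that the same submodules contain both families: a column
  -- operation is then one use of `combination`, and choosing the image as submodule recovers the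
  -- inclusion. `∣det∣` speaks of every alternating map and so survives the prefixing of a column in
  -- `∷-~`.
  record _~_ (A B : Columns r m) : Set₁ where
    field
      to    : ∀ (S : Submodule 0ℓ r) → (∀ j → Member S (A j)) → ∀ j → Member S (B j)
      from  : ∀ (S : Submodule 0ℓ r) → (∀ j → Member S (B j)) → ∀ j → Member S (A j)
      ∣det∣ : ∀ {H} → IsAlternating H → ∣ H A ∣ ≡ ∣ H B ∣

  open _~_

  ∷-isAlternating : {H : Columns r (suc m) → ℤ} (x : Vector ℤ r) → IsAlternating H → IsAlternating (H ∘ (x ∷ᵛ_))
  ∷-isAlternating x alt = record
    { congruent   = λ M≗N → congruent λ { zero i → refl ; (suc j) i → M≗N j i }
    ; multilinear = λ j a b M≗X M≗Y eq → multilinear (suc j) a b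
        (λ { zero _ i → refl ; (suc k) k≢j i → M≗X k (k≢j ∘ cong suc) i })
        (λ { zero _ i → refl ; (suc k) k≢j i → M≗Y k (k≢j ∘ cong suc) i })
        eq
    ; adjacent    = λ i j adj eq → adjacent (suc i) (suc j) (cong suc adj) eq
    }
    where open IsAlternating alt

  module _ {H : Columns r (suc m) → ℤ} (alt : IsAlternating H) where
    open IsAlternating alt

    linear-head : ∀ a b (x y : Vector ℤ r) M →
      H ((λ i → a * x i + b * y i) ∷ᵛ M) ≡ a * H (x ∷ᵛ M) + b * H (y ∷ᵛ M)
    linear-head a b x y M = multilinear zero a b
      (λ { zero 0≢0 i → ⊥-elim (0≢0 refl) ; (suc k) _ i → refl })
      (λ { zero 0≢0 i → ⊥-elim (0≢0 refl) ; (suc k) _ i → refl })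
      (λ _ → refl)

  module _ {H : Columns r (suc (suc m)) → ℤ} (alt : IsAlternating H) where
    open IsAlternating alt

    -- Polarisation: of the four terms of h(x+y, x+y) = 0 the two diagonal ones vanish.
    swap-head : ∀ x y M → H (y ∷ᵛ x ∷ᵛ M) ≡ - H (x ∷ᵛ y ∷ᵛ M)
    swap-head x y M = begin
      H (y ∷ᵛ x ∷ᵛ M)
        ≡⟨ solve 4 (λ xx xy yx yy → yx :=
             (con 1ℤ :* (con 1ℤ :* xx :+ con 1ℤ :* xy) :+ con 1ℤ :* (con 1ℤ :* yx :+ con 1ℤ :* yy))
               :- xx :- yy :- xy)
             refl (h x x) (h x y) (h y x) (h y y) ⟩
      (1ℤ * (1ℤ * h x x + 1ℤ * h x y) + 1ℤ * (1ℤ * h y x + 1ℤ * h y y)) - h x x - h y y - h x y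
        ≡⟨ cong (λ z → z - h x x - h y y - h x y) expand ⟨
      h (x +ᵛ′ y) (x +ᵛ′ y) - h x x - h y y - h x y
        ≡⟨ cong₂ (λ u v → u - v - h y y - h x y) (diagonal (x +ᵛ′ y)) (diagonal x) ⟩
      0ℤ - 0ℤ - h y y - h x y
        ≡⟨ cong (λ u → 0ℤ - 0ℤ - u - h x y) (diagonal y) ⟩
      0ℤ - 0ℤ - 0ℤ - h x y
        ≡⟨ ℤₚ.+-identityˡ _ ⟩
      - h x y ∎
      where
      open ≡-Reasoning
      h : Vector ℤ r → Vector ℤ r → ℤ
      h u v = H (u ∷ᵛ v ∷ᵛ M)
      _+ᵛ′_ : Vector ℤ r → Vector ℤ r → Vector ℤ r
      (u +ᵛ′ v) i = 1ℤ * u i + 1ℤ * v i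
      diagonal : ∀ u → h u u ≡ 0ℤ
      diagonal u = adjacent zero (suc zero) refl (λ _ → refl)
      expand : h (x +ᵛ′ y) (x +ᵛ′ y) ≡ 1ℤ * (1ℤ * h x x + 1ℤ * h x y) + 1ℤ * (1ℤ * h y x + 1ℤ * h y y)
      expand = trans (linear-head alt 1ℤ 1ℤ x y _) (cong₂ (λ u v → 1ℤ * u + 1ℤ * v)
        (linear-head (∷-isAlternating x alt) 1ℤ 1ℤ x y M)
        (linear-head (∷-isAlternating y alt) 1ℤ 1ℤ x y M))

    euclid-head : ∀ x y q M → H (y ∷ᵛ (λ i → 1ℤ * x i + - q * y i) ∷ᵛ M) ≡ - H (x ∷ᵛ y ∷ᵛ M)
    euclid-head x y q M = begin
      H (y ∷ᵛ (λ i → 1ℤ * x i + - q * y i) ∷ᵛ M)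
        ≡⟨ linear-head (∷-isAlternating y alt) 1ℤ (- q) x y M ⟩
      1ℤ * H (y ∷ᵛ x ∷ᵛ M) + - q * H (y ∷ᵛ y ∷ᵛ M)
        ≡⟨ cong₂ (λ u v → 1ℤ * u + - q * v) (swap-head x y M) (adjacent zero (suc zero) refl (λ _ → refl)) ⟩
      1ℤ * - H (x ∷ᵛ y ∷ᵛ M) + - q * 0ℤ
        ≡⟨ solve 2 (λ h q → con 1ℤ :* (:- h) :+ (:- q) :* con 0ℤ := :- h) refl _ q ⟩
      - H (x ∷ᵛ y ∷ᵛ M) ∎
      where open ≡-Reasoning

  ~-trans : {A B C : Columns r m} → A ~ B → B ~ C → A ~ C
  ~-trans p q = record
    { to    = λ S → to q S ∘ to p S
    ; from  = λ S → from p S ∘ from q S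
    ; ∣det∣ = λ alt → trans (∣det∣ p alt) (∣det∣ q alt)
    }

  ≗⇒~ : {A B : Columns r m} → (∀ j → A j ≗ B j) → A ~ B
  ≗⇒~ eq = record
    { to    = λ S p j → respects S (eq j) (p j)
    ; from  = λ S p j → respects S (sym ∘ eq j) (p j)
    ; ∣det∣ = λ alt → cong ∣_∣ (IsAlternating.congruent alt eq)
    }

  ∷-~ : ∀ (x : Vector ℤ r) {A B : Columns r m} → A ~ B → x ∷ᵛ A ~ x ∷ᵛ B
  ∷-~ x p = record
    { to    = λ { S q zero → q zero ; S q (suc j) → to p S (q ∘ suc) j }
    ; from  = λ { S q zero → q zero ; S q (suc j) → from p S (q ∘ suc) j }
    ; ∣det∣ = λ alt → ∣det∣ p (∷-isAlternating x alt)
    }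

  -- A division step together with the exchange of the two columns, so that it can be iterated as it
  -- stands. The exchange costs a sign, whence the absolute value in `_~_`.
  euclid-step : ∀ (x y : Vector ℤ r) q (M : Columns r m) →
                x ∷ᵛ y ∷ᵛ M ~ y ∷ᵛ (λ i → 1ℤ * x i + - q * y i) ∷ᵛ M
  euclid-step x y q M = record
    { to    = λ
      { S p zero          → p (suc zero)
      ; S p (suc zero)    → combination S 1ℤ (- q) (p zero) (p (suc zero))
      ; S p (suc (suc j)) → p (suc (suc j)) }
    ; from  = λ
      { S p zero          → respects S
          (λ i → solve 3 (λ x y q → q :* y :+ con 1ℤ :* (con 1ℤ :* x :+ (:- q) :* y) := x) refl (x i) (y i) q)
          (combination S q 1ℤ (p zero) (p (suc zero)))
      ; S p (suc zero)    → p zero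
      ; S p (suc (suc j)) → p (suc (suc j)) }
    ; ∣det∣ = λ {H} alt → sym (trans (cong ∣_∣ (euclid-head alt x y q M)) (ℤₚ.∣-i∣≡∣i∣ (H (x ∷ᵛ y ∷ᵛ M))))
    }

  -- The zero multiple brings -x into the two-term shape to which `combination` and `linear-head`
  -- apply directly.
  negate-head : ∀ (x : Vector ℤ r) (M : Columns r m) → x ∷ᵛ M ~ (λ i → -1ℤ * x i + 0ℤ * x i) ∷ᵛ M
  negate-head x M = record
    { to    = λ { S p zero → combination S -1ℤ 0ℤ (p zero) (p zero) ; S p (suc j) → p (suc j) }
    ; from  = λ
      { S p zero    → respects S
          (λ i → solve 1 (λ x → let n = con -1ℤ :* x :+ con 0ℤ :* x in con -1ℤ :* n :+ con 0ℤ :* n := x) refl (x i))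
          (combination S -1ℤ 0ℤ (p zero) (p zero))
      ; S p (suc j) → p (suc j) }
    ; ∣det∣ = λ {H} alt → sym (trans
        (cong ∣_∣ (trans (linear-head alt -1ℤ 0ℤ x x M)
          (solve 1 (λ h → con -1ℤ :* h :+ con 0ℤ :* h := :- h) refl (H (x ∷ᵛ M)))))
        (ℤₚ.∣-i∣≡∣i∣ (H (x ∷ᵛ M))))
    }

  euclid : ∀ (x y : Vector ℤ (suc r)) → Acc ℕ._<_ ∣ y zero ∣ →
    Σ[ x′ ∈ Vector ℤ (suc r) ] Σ[ y′ ∈ Vector ℤ (suc r) ]
      (y′ zero ≡ 0ℤ × ∀ {m} (M : Columns (suc r) m) → x ∷ᵛ y ∷ᵛ M ~ x′ ∷ᵛ y′ ∷ᵛ M)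
  euclid x y (acc rec) with y zero ℤₚ.≟ 0ℤ
  ... | yes y₀≡0 = x , y , y₀≡0 , λ M → ≗⇒~ λ _ _ → refl
  ... | no  y₀≢0 =
    let (x″ , y″ , y″₀≡0 , equiv) = euclid y y′ (rec (subst (ℕ._< ∣ y zero ∣) (sym ∣y′₀∣≡) (ℤDiv.n%d<d (x zero) (y zero))))
    in x″ , y″ , y″₀≡0 , λ M → ~-trans (euclid-step x y q M) (equiv M)
    where
    instance _ = ℤ.≢-nonZero y₀≢0
    q = x zero ℤDiv./ y zero
    y′ : Vector ℤ _
    y′ i = 1ℤ * x i + - q * y i
    ∣y′₀∣≡ : ∣ y′ zero ∣ ≡ x zero ℤDiv.% y zero
    ∣y′₀∣≡ = cong ∣_∣ (trans (cong (λ z → 1ℤ * z + - q * y zero) (ℤDiv.a≡a%n+[a/n]*n (x zero) (y zero)))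
      (solve 3 (λ r q y → con 1ℤ :* (r :+ q :* y) :+ (:- q) :* y := r) refl (+ (x zero ℤDiv.% y zero)) q (y zero)))

  -- Once the tail is reduced, only its leading column can have a nonzero first entry, so a single
  -- run of Euclid on the two leading columns finishes the row.
  reduce : ∀ (A : Columns (suc r) (suc m)) →
    Σ[ B ∈ Columns (suc r) (suc m) ] ((∀ j → B (suc j) zero ≡ 0ℤ) × A ~ B)
  reduce {m = zero}  A = A , (λ ()) , ≗⇒~ λ _ _ → refl
  reduce {m = suc m} A =
    let (N , N₀≡0 , tail~N)   = reduce (tail A)
        (x , y , y₀≡0 , pair) = euclid (head A) (head N) (<-wellFounded _)
    in x ∷ᵛ y ∷ᵛ tail N ,
       (λ { zero → y₀≡0 ; (suc j) → N₀≡0 j }) ,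
       ~-trans (≗⇒~ λ { zero _ → refl ; (suc j) _ → refl })
         (~-trans (∷-~ (head A) tail~N)
           (~-trans (≗⇒~ λ { zero _ → refl ; (suc zero) _ → refl ; (suc (suc j)) _ → refl })
             (pair (tail N))))

  reduce⁺ : ∀ (A : Columns (suc r) (suc m)) →
    Σ[ n ∈ ℕ ] Σ[ B ∈ Columns (suc r) (suc m) ]
      (B zero zero ≡ + n × (∀ j → B (suc j) zero ≡ 0ℤ) × A ~ B)
  reduce⁺ A with reduce A
  ... | B , B₀≡0 , A~B with B zero zero in eq
  ... | + n      = n , B , eq , B₀≡0 , A~B
  ... | -[1+ n ] = suc n , (λ i → -1ℤ * B zero i + 0ℤ * B zero i) ∷ᵛ tail B ,
    trans (solve 1 (λ z → con -1ℤ :* z :+ con 0ℤ :* z := :- z) refl (B zero zero)) (cong -_ eq) , B₀≡0 ,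
    ~-trans A~B (~-trans (≗⇒~ λ { zero _ → refl ; (suc j) _ → refl }) (negate-head (head B) (tail B)))

  ∣det∣-triangular : ∀ {d} (A : Matrix ℤ (suc d)) → (∀ j → A zero (suc j) ≡ 0ℤ) →
    ∣ det A ∣ ≡ ∣ A zero zero ∣ ℕ.* ∣ det (λ i j → A (suc i) (suc j)) ∣
  ∣det∣-triangular A A₀≡0 = trans
    (cong ∣_∣ (trans (cong₂ _+_ (cong (_* minor) (ℤₚ.*-identityˡ (A zero zero)))
        (sum-zero λ j → trans (cong (λ z → -1ℤ ^ toℕ (suc j) * z * det (λ i k → A (suc i) (punchIn (suc j) k))) (A₀≡0 j))
          (cong (_* det (λ i k → A (suc i) (punchIn (suc j) k))) (ℤₚ.*-zeroʳ (-1ℤ ^ toℕ (suc j))))))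
      (ℤₚ.+-identityʳ (A zero zero * minor))))
    (ℤₚ.abs-* (A zero zero) minor)
    where minor = det (λ i j → A (suc i) (suc j))

  -- Applied to images, it compares the lattices of two matrices; applied to `integral ξ`, it pairs
  -- ξ with all of Aℤᵈ.
  image-combination : ∀ {d} (S : Submodule ℓ d) (A : Matrix ℤ d) → (∀ j → Member S (transpose A j)) →
    ∀ m → Member S (A ·ℤ m)
  image-combination {d = d} S A p m = go (transpose A) p m
    where
    go : ∀ {n} (M : Columns d n) → (∀ j → Member S (M j)) → ∀ (m : Vector ℤ n) →
         Member S (λ i → ∑.sum λ j → M j i * m j)
    go {zero}  M p m = zeroVector S
    go {suc n} M p m = respects S
      (λ i → cong₂ _+_ (ℤₚ.*-comm (m zero) (M zero i)) (ℤₚ.*-identityˡ _))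
      (combination S (m zero) 1ℤ (p zero) (go (M ∘ suc) (p ∘ suc) (m ∘ suc)))

  _∈Image_ : ∀ {d} → Vector ℤ d → Matrix ℤ d → Set
  x ∈Image A = ∃[ m ] (∀ i → (A ·ℤ m) i ≡ x i)

  imageSubmodule : ∀ {d} → Matrix ℤ d → Submodule 0ℓ d
  imageSubmodule A = record
    { Member      = _∈Image A
    ; respects    = λ x≗y (m , p) → m , λ i → trans (p i) (x≗y i)
    ; zeroVector  = (λ _ → 0ℤ) , λ i → sum-zero λ j → ℤₚ.*-zeroʳ (A i j)
    ; combination = λ a b (m , p) (n , q) → (λ j → a * m j + b * n j) , λ i →
        trans (sum-linear a b _ (λ j → A i j * m j) (λ j → A i j * n j) λ j →
          solve 5 (λ A a b m n → A :* (a :* m :+ b :* n) := a :* (A :* m) :+ b :* (A :* n)) refl (A i j) a b (m j) (n j))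
          (cong₂ (λ u v → a * u + b * v) (p i) (q i))
    }

  column∈Image : ∀ {d} (A : Matrix ℤ d) j → transpose A j ∈Image A
  column∈Image {d} A j = (λ k → δ j k) , λ i → sum-δ (A i) j
    where
    δ : ∀ {n} → Fin n → Fin n → ℤ
    δ zero    zero    = 1ℤ
    δ zero    (suc k) = 0ℤ
    δ (suc j) zero    = 0ℤ
    δ (suc j) (suc k) = δ j k
    sum-δ : ∀ {n} (f : Vector ℤ n) j → ∑.sum (λ k → f k * δ j k) ≡ f j
    sum-δ f zero    = trans
      (cong₂ _+_ (ℤₚ.*-identityʳ (f zero)) (sum-zero λ k → ℤₚ.*-zeroʳ (f (suc k))))
      (ℤₚ.+-identityʳ (f zero))
    sum-δ f (suc j) = trans (cong₂ _+_ (ℤₚ.*-zeroʳ (f zero)) (sum-δ (f ∘ suc) j)) (ℤₚ.+-identityˡ _)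

-- Concatenated lists: distinctness and length.

unique-concatMap : ∀ {a ℓ b ℓ′} (S : Setoid a ℓ) (T : Setoid b ℓ′) →
  let open Setoid S using () renaming (Carrier to A; _≈_ to _≈₁_)
      open Setoid T using () renaming (Carrier to B)
      open Membership T using (_∈_)
  in (F : A → List B) →
     (∀ x → UniqueSetoid.Unique T (F x)) → (∀ {x x′ y} → y ∈ F x → y ∈ F x′ → x ≈₁ x′) →
     ∀ {xs} → UniqueSetoid.Unique S xs → UniqueSetoid.Unique T (concatMap F xs)
unique-concatMap S T F F! inj {xs} xs! = Uniqueₚ.concat⁺ T
  (Allₚ.map⁺ (All.universal F! xs))
  (AllPairsₚ.map⁺ (AllPairs.map (λ { x≉x′ {_} (p , q) → x≉x′ (inj p q) }) xs!))

length-concatMap : ∀ {a b} {A : Set a} {B : Set b} (F : A → List B) n → (∀ x → length (F x) ≡ n) →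
                   ∀ xs → length (concatMap F xs) ≡ length xs ℕ.* n
length-concatMap F n eq []       = ≡.refl
length-concatMap F n eq (x ∷ xs) = ≡.trans (Listₚ.length-++ (F x))
  (≡.cong₂ ℕ._+_ (eq x) (length-concatMap F n eq xs))

-- Finite sums of reals over lists.

module ListSums {c ℓ₁ ℓ₂} (ℛ : RealNumbers c ℓ₁ ℓ₂) where
  open Reals ℛ hiding (zero)
  open RealAlgebra ℛ
  open Limits ℛ

  private variable
    a b : Level
    A B : Set a

  sumOver : List A → (A → ℝ) → ℝ
  sumOver xs f = foldr _+_ 0# (map f xs)

  sumOver-cong : ∀ (xs : List A) {f g} → (∀ x → f x ≈ g x) → sumOver xs f ≈ sumOver xs g
  sumOver-cong []       f≈g = refl
  sumOver-cong (x ∷ xs) f≈g = +-cong (f≈g x) (sumOver-cong xs f≈g)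

  sumOver-0 : ∀ (xs : List A) {f} → (∀ x → f x ≈ 0#) → sumOver xs f ≈ 0#
  sumOver-0 []       f≈0 = refl
  sumOver-0 (x ∷ xs) f≈0 = trans (+-cong (f≈0 x) (sumOver-0 xs f≈0)) (+-identityˡ 0#)

  sumOver-++ : ∀ (xs ys : List A) f → sumOver (xs ++ ys) f ≈ sumOver xs f + sumOver ys f
  sumOver-++ []       ys f = sym (+-identityˡ _)
  sumOver-++ (x ∷ xs) ys f = trans (+-congˡ (sumOver-++ xs ys f)) (sym (+-assoc _ _ _))

  sumOver-map : ∀ (g : A → B) xs f → sumOver (map g xs) f ≈ sumOver xs (f ∘ g)
  sumOver-map g []       f = refl
  sumOver-map g (x ∷ xs) f = +-congˡ (sumOver-map g xs f)

  sumOver-concatMap : ∀ (F : A → List B) xs f → sumOver (concatMap F xs) f ≈ sumOver xs (λ x → sumOver (F x) f)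
  sumOver-concatMap F []       f = refl
  sumOver-concatMap F (x ∷ xs) f = trans (sumOver-++ (F x) _ f) (+-congˡ (sumOver-concatMap F xs f))

  sumOver-+ : ∀ (xs : List A) f g → sumOver xs (λ x → f x + g x) ≈ sumOver xs f + sumOver xs g
  sumOver-+ []       f g = sym (+-identityˡ 0#)
  sumOver-+ (x ∷ xs) f g = trans (+-congˡ (sumOver-+ xs f g))
    (solve 4 (λ a b c d → a :+ b :+ (c :+ d) := a :+ c :+ (b :+ d)) refl _ _ _ _)

  *-sumOver : ∀ r (xs : List A) f → sumOver xs (λ x → r * f x) ≈ r * sumOver xs f
  *-sumOver r []       f = sym (zeroʳ r)
  *-sumOver r (x ∷ xs) f = trans (+-congˡ (*-sumOver r xs f)) (sym (distribˡ r _ _))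

  sumOver-comm : ∀ (xs : List A) (ys : List B) (f : A → B → ℝ) →
    sumOver xs (λ x → sumOver ys (f x)) ≈ sumOver ys (λ y → sumOver xs (λ x → f x y))
  sumOver-comm []       ys f = sym (sumOver-0 ys λ _ → refl)
  sumOver-comm (x ∷ xs) ys f = trans (+-congˡ (sumOver-comm xs ys f)) (sym (sumOver-+ ys _ _))

  sumOver-const : ∀ (xs : List A) r → sumOver xs (λ _ → r) ≈ fromℕ (length xs) * r
  sumOver-const []       r = sym (zeroˡ r)
  sumOver-const (x ∷ xs) r = trans (+-cong (sym (*-identityˡ r)) (sumOver-const xs r)) (sym (distribʳ r _ _))

  sumOver-applyUpTo : ∀ (g : ℕ → A) n f → sumOver (applyUpTo g n) f ≈ partialSum (f ∘ g) n
  sumOver-applyUpTo g zero    f = refl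
  sumOver-applyUpTo g (suc n) f = trans (+-congˡ (sumOver-applyUpTo (g ∘ suc) n f))
    (sym (partialSum-shift (f ∘ g) n))

-- The pairing of integer vectors with real vectors.

module InnerProduct {c ℓ₁ ℓ₂} (ℛ : RealNumbers c ℓ₁ ℓ₂) where
  open Reals ℛ hiding (zero)
  open RealAlgebra ℛ
  open Reduction
  private
    module ∑ = CMSum +-commutativeMonoid
    module ∑ℤ = CMSum ℤₚ.+-0-commutativeMonoid
    module < = IsStrictPartialOrder <-isStrictPartialOrder

  ∑-linear : ∀ {n} a b (f g h : Vector ℝ n) → (∀ j → f j ≈ a * g j + b * h j) →
             ∑.sum f ≈ a * ∑.sum g + b * ∑.sum h
  ∑-linear {zero}  a b f g h eq = solve 2 (λ a b → con 0ℤ := a :* con 0ℤ :+ b :* con 0ℤ) refl a b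
  ∑-linear {suc n} a b f g h eq = trans
    (+-cong (eq zero) (∑-linear a b (f ∘ suc) (g ∘ suc) (h ∘ suc) (eq ∘ suc)))
    (solve 6 (λ a b x y s t → a :* x :+ b :* y :+ (a :* s :+ b :* t) := a :* (x :+ s) :+ b :* (y :+ t))
      refl a b (g zero) (h zero) _ _)

  infix 8 _∙_
  _∙_ : ∀ {d} → Vector ℤ d → Vector ℝ d → ℝ
  x ∙ ξ = ∑.sum λ j → fromℤ (x j) * ξ j

  ∙-congˡ : ∀ {d} {x y : Vector ℤ d} (ξ : Vector ℝ d) → x ≗ y → x ∙ ξ ≈ y ∙ ξ
  ∙-congˡ ξ x≗y = ∑.sum-cong-≋ λ j → *-congʳ (reflexive (≡.cong fromℤ (x≗y j)))

  ∙-linearˡ : ∀ {d} a b (x y : Vector ℤ d) ξ →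
    (λ i → a ℤ.* x i ℤ.+ b ℤ.* y i) ∙ ξ ≈ fromℤ a * x ∙ ξ + fromℤ b * y ∙ ξ
  ∙-linearˡ a b x y ξ = ∑-linear _ _ _ _ _ λ j →
    trans (*-congʳ (trans (fromℤ-homo-+ (a ℤ.* x j) (b ℤ.* y j)) (+-cong (fromℤ-homo-* a (x j)) (fromℤ-homo-* b (y j)))))
      (solve 5 (λ a b x y z → (a :* x :+ b :* y) :* z := a :* (x :* z) :+ b :* (y :* z)) refl _ _ _ _ _)

  ∙-fromℤ : ∀ {d} (x l : Vector ℤ d) → x ∙ (fromℤ ∘ l) ≈ fromℤ (∑ℤ.sum λ j → x j ℤ.* l j)
  ∙-fromℤ {zero}  x l = refl
  ∙-fromℤ {suc d} x l = trans
    (+-cong (sym (fromℤ-homo-* (x zero) (l zero))) (∙-fromℤ (x ∘ suc) (l ∘ suc)))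
    (sym (fromℤ-homo-+ (x zero ℤ.* l zero) _))

  -- The integer is given explicitly because `lift-restrict` has to compute with it.
  ∙-shift : ∀ {d} (x : Vector ℤ d) {ξ η : Vector ℝ d} (ξ≡η : ξ ≡ η modℤ) →
    x ∙ ξ ≈ x ∙ η + fromℤ (∑ℤ.sum λ j → x j ℤ.* proj₁ ξ≡η j)
  ∙-shift x {ξ} {η} (l , ξ-η≈l) = begin
    x ∙ ξ
      ≈⟨ ∑-linear 1# 1# _ (λ j → fromℤ (x j) * η j) (λ j → fromℤ (x j) * fromℤ (l j)) (λ j →
           trans (solve 3 (λ x a b → x :* a := con 1ℤ :* (x :* b) :+ con 1ℤ :* (x :* (a :- b))) refl _ (ξ j) (η j))
             (+-congˡ (*-congˡ (*-congˡ (ξ-η≈l j))))) ⟩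
    1# * x ∙ η + 1# * x ∙ (fromℤ ∘ l)
      ≈⟨ +-cong (*-identityˡ _) (trans (*-identityˡ _) (∙-fromℤ x l)) ⟩
    x ∙ η + fromℤ (∑ℤ.sum λ j → x j ℤ.* l j) ∎
    where open SetoidReasoning setoid

  fromℤ-injective : ∀ {i j} → fromℤ i ≈ fromℤ j → i ≡ j
  fromℤ-injective {i} {j} eq = ℤₚ.i-j≡0⇒i≡j i j (nonzero (i ℤ.- j) (begin
    fromℤ (i ℤ.- j)             ≈⟨ fromℤ-homo-+ i (ℤ.- j) ⟩
    fromℤ i + fromℤ (ℤ.- j)     ≈⟨ +-cong eq (fromℤ-homo-neg j) ⟩
    fromℤ j - fromℤ j           ≈⟨ -‿inverseʳ _ ⟩
    0#                          ∎))
    where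
    open SetoidReasoning setoid
    nonzero : ∀ k → fromℤ k ≈ 0# → k ≡ 0ℤ
    nonzero (+ zero)  _ = ≡.refl
    nonzero (+ suc n) p = ⊥-elim (<.irrefl (sym p) (0<fromℕ n))
    nonzero -[1+ n ]  p = ⊥-elim (<.irrefl
      (sym (trans (solve 1 (λ x → x := :- :- x) refl _) (trans (-‿cong p) (solve 0 (:- con 0ℤ := con 0ℤ) refl))))
      (0<fromℕ n))

  -- The annihilator of ξ modulo 1: that the columns of A belong to it is the condition defining
  -- `T* A`.
  integral : ∀ {d} → Vector ℝ d → Submodule ℓ₁ d
  integral {d} ξ = record
    { Member      = λ x → Σ[ z ∈ ℤ ] (x ∙ ξ ≈ fromℤ z)
    ; respects    = λ x≗y (z , p) → z , trans (sym (∙-congˡ ξ x≗y)) p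
    ; zeroVector  = 0ℤ , trans (∑.sum-cong-≋ (λ j → zeroˡ (ξ j))) (∑.sum-replicate-zero d)
    ; combination = λ {x} {y} a b (z , p) (z′ , q) → a ℤ.* z ℤ.+ b ℤ.* z′ ,
        trans (∙-linearˡ a b x y ξ) (trans (+-cong (*-congˡ p) (*-congˡ q))
          (sym (trans (fromℤ-homo-+ (a ℤ.* z) (b ℤ.* z′)) (+-cong (fromℤ-homo-* a z) (fromℤ-homo-* b z′)))))
    }

-- Enumeration of the dual group, and orthogonality.

module DualTorus {c ℓ₁ ℓ₂} (ℛ : RealNumbers c ℓ₁ ℓ₂) (π : Reals.ℝ ℛ) (isPi : Reals.IsPi ℛ π) where
  open Reals ℛ hiding (zero)
  open RealAlgebra ℛ
  open Limits ℛ
  open Periodicity ℛ π isPi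
  open ListSums ℛ
  open InnerProduct ℛ
  open Reduction
  private
    module ∑ℤ = CMSum ℤₚ.+-0-commutativeMonoid
    module R = RingProperties ring

  cos₁-≈-+ℤ : ∀ {s t} i → s ≈ t + fromℤ i → cos₁ s ≈ cos₁ t
  cos₁-≈-+ℤ i p = trans (cos₁-cong p) (cos₁-+ℤ _ i)

  -- All that the induction on d has to carry. `image?` belongs here because the same triangular
  -- structure decides membership, and the walks have to be sorted by it.
  record Transversal {d} (A : Matrix ℤ d) : Set (c ⊔ ℓ₁) where
    open Setoid (T* A) using (Carrier)
    open Membership (T* A) using (_∈_)
    field
      terms     : List Carrier
      distinct  : UniqueSetoid.Unique (T* A) terms
      exhaustive : ∀ ξ → ξ ∈ terms
      count     : length terms ≡ ∣ det A ∣
      image?    : ∀ x → Dec (x ∈Image A)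
      vanishing : ∀ φ x → ¬ x ∈Image A → sumOver terms (λ (ξ , _) → cos₁ (φ + x ∙ ξ)) ≈ 0#

  -- The vector ξ is kept and only its integrality certificate is recomputed; equality in the dual
  -- group does not see the certificate, so distinctness is transported by the identity.
  dualMap : ∀ {d} (A B : Matrix ℤ d) → (∀ j → transpose B j ∈Image A) →
            Setoid.Carrier (T* A) → Setoid.Carrier (T* B)
  dualMap A B B⊆A (ξ , z , p) = ξ , (λ j → proj₁ (member j)) , (λ j → proj₂ (member j))
    where
    open Submodule (integral ξ)
    member : ∀ j → Member (transpose B j)
    member j = let (m , q) = B⊆A j in
      respects q (image-combination (integral ξ) A (λ k → z k , p k) m)

  image-monotone : ∀ {d} (A B : Matrix ℤ d) → (∀ j → transpose B j ∈Image A) → ∀ {x} → x ∈Image B → x ∈Image A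
  image-monotone A B B⊆A (m , p) =
    Submodule.respects (imageSubmodule A) p (image-combination (imageSubmodule A) B B⊆A m)

  transversal-~ : ∀ {d} (A B : Matrix ℤ d) → transpose A ~ transpose B → Transversal B → Transversal A
  transversal-~ A B A~B t = record
    { terms     = map (dualMap B A A⊆B) terms
    ; distinct  = Uniqueₚ.map⁺ (T* B) (T* A) (λ eq → eq) distinct
    ; exhaustive = λ ξ → Anyₚ.map⁺ {f = dualMap B A A⊆B} (exhaustive (dualMap A B B⊆A ξ))
    ; count     = ≡.trans (Listₚ.length-map _ terms)
        (≡.trans count (≡.sym (_~_.∣det∣ A~B (Columns.det-isAlternating _))))
    ; image?    = λ x → Dec.map′ (image-monotone A B B⊆A) (image-monotone B A A⊆B) (image? x)
    ; vanishing = λ φ x x∉A → trans (sumOver-map (dualMap B A A⊆B) terms _)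
        (vanishing φ x (x∉A ∘ image-monotone A B B⊆A))
    }
    where
    open Transversal t
    B⊆A : ∀ j → transpose B j ∈Image A
    B⊆A = _~_.to A~B (imageSubmodule A) (column∈Image A)
    A⊆B : ∀ j → transpose A j ∈Image B
    A⊆B = _~_.from A~B (imageSubmodule B) (column∈Image B)

  trivial-transversal : (A : Matrix ℤ 0) → Transversal A
  trivial-transversal A = record
    { terms      = ((λ ()) , (λ ()) , λ ()) ∷ []
    ; distinct   = All.[] AllPairs.∷ AllPairs.[]
    ; exhaustive = λ ξ → here ((λ ()) , λ ())
    ; count      = ≡.refl
    ; image?     = λ x → yes ((λ ()) , λ ())
    ; vanishing  = λ φ x x∉A → ⊥-elim (x∉A ((λ ()) , λ ()))
    }

  -- The matrix has blocks n, 0 over b, A′. Then (η₀, ξ) is dual to A when A′ᵀξ is integral and nη₀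
  -- + b·ξ is an integer. Dropping η₀ thus maps `T* A` onto `T* A′`, and the fibre over ξ consists
  -- of the n classes η₀ = (k - b·ξ)/n with k < n. This also accounts for the factor n in the
  -- determinant.
  module Triangular {d n-1} (A : Matrix ℤ (suc d)) (A₀₀ : A zero zero ≡ + suc n-1)
                    (A₀ⱼ : ∀ j → A zero (suc j) ≡ 0ℤ)
                    (t : Transversal {d} (λ i j → A (suc i) (suc j))) where
    open Transversal t

    private
      A′ : Matrix ℤ d
      A′ i j = A (suc i) (suc j)

      n = suc n-1
      S = T* A
      S′ = T* A′
      open Setoid S using () renaming (Carrier to Dual; _≈_ to _≈ᴬ_)
      open Setoid S′ using () renaming (Carrier to Dual′; _≈_ to _≈′_)
      open Membership S using (_∈_)

      b : Vector ℤ d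
      b i = A (suc i) zero

      n⁻¹ : ℝ
      n⁻¹ = 1/ℕ n

      n⁻¹n≈1 : n⁻¹ * fromℕ n ≈ 1#
      n⁻¹n≈1 = 1/ℕ-inverse n

    open SetoidReasoning setoid

    first : Vector ℝ d → ℕ → ℝ
    first ξ k = (fromℕ k - b ∙ ξ) * n⁻¹

    lift : Dual′ → ℕ → Dual
    lift (ξ , z , p) k = first ξ k ∷ᵛ ξ , + k ∷ᵛ z , λ
      { zero    → begin
          fromℤ (A zero zero) * first ξ k + b ∙ ξ        ≡⟨ ≡.cong (λ a → fromℤ a * first ξ k + b ∙ ξ) A₀₀ ⟩
          fromℕ n * first ξ k + b ∙ ξ
            ≈⟨ solve 4 (λ n i k β → n :* ((k :- β) :* i) :+ β := (k :- β) :* (i :* n) :+ β) refl _ n⁻¹ _ (b ∙ ξ) ⟩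
          (fromℕ k - b ∙ ξ) * (n⁻¹ * fromℕ n) + b ∙ ξ    ≈⟨ +-congʳ (trans (*-congˡ n⁻¹n≈1) (*-identityʳ _)) ⟩
          fromℕ k - b ∙ ξ + b ∙ ξ                        ≈⟨ -‿cancelʳ _ _ ⟩
          fromℕ k                                        ∎
      ; (suc j) → trans (trans (+-congʳ (trans (*-congʳ (reflexive (≡.cong fromℤ (A₀ⱼ j)))) (zeroˡ _))) (+-identityˡ _)) (p j)
      }

    restrict : Dual → Dual′
    restrict (η , z , p) = η ∘ suc , z ∘ suc , λ j →
      trans (sym (trans (+-congʳ (trans (*-congʳ (reflexive (≡.cong fromℤ (A₀ⱼ j)))) (zeroˡ _))) (+-identityˡ _))) (p (suc j))

    lifts : Dual′ → List Dual
    lifts ξ = applyUpTo (lift ξ) n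

    lifts-distinct : ∀ ξ → UniqueSetoid.Unique S (lifts ξ)
    lifts-distinct ζ@(ξ , _) = Uniqueₚ.applyUpTo⁺₁ S (lift ζ) n λ {i} {j} i<j j<n (l , q) → separate i<j j<n (l zero) (q zero)
      where
      separate : ∀ {i j} → i ℕ.< j → j ℕ.< n → ∀ l → ¬ first ξ i - first ξ j ≈ fromℤ l
      separate {i} {j} i<j j<n l eq with ℕₚ.m≤n⇒∃[o]m+o≡n i<j
      ... | o , ≡.refl = multiple ∣ l ∣ (≡.trans (≡.cong ∣_∣ equation) (ℤₚ.abs-* l (+ n)))
        where
        equation : ℤ.- (+ suc o) ≡ l ℤ.* + n
        equation = fromℤ-injective (begin
          - fromℕ (suc o)
            ≈⟨ solve 2 (λ i o → :- o := i :- (i :+ o)) refl (fromℕ i) _ ⟩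
          fromℕ i - (fromℕ i + fromℕ (suc o))
            ≈⟨ +-congˡ (-‿cong (trans (sym (fromℕ-homo-+ i (suc o))) (reflexive (≡.cong fromℕ (ℕₚ.+-suc i o))))) ⟩
          fromℕ i - fromℕ (suc (i ℕ.+ o))
            ≈⟨ solve 3 (λ i j β → i :- j := (i :- β) :- (j :- β)) refl _ _ (b ∙ ξ) ⟩
          x - y
            ≈⟨ trans (*-congˡ n⁻¹n≈1) (*-identityʳ _) ⟨
          (x - y) * (n⁻¹ * fromℕ n)
            ≈⟨ solve 4 (λ x y i n → (x :- y) :* (i :* n) := (x :* i :- y :* i) :* n) refl x y n⁻¹ (fromℕ n) ⟩
          (first ξ i - first ξ (suc (i ℕ.+ o))) * fromℕ n
            ≈⟨ *-congʳ eq ⟩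
          fromℤ l * fromℤ (+ n)
            ≈⟨ fromℤ-homo-* l (+ n) ⟨
          fromℤ (l ℤ.* + n) ∎)
          where
          x y : ℝ
          x = fromℕ i - b ∙ ξ
          y = fromℕ (suc (i ℕ.+ o)) - b ∙ ξ
        -- `suc o` is the difference of the two indices, positive and below n.
        multiple : ∀ k → suc o ≡ k ℕ.* n → ⊥
        multiple (suc k) o≡kn = ℕₚ.<⇒≱ j<n (ℕₚ.≤-trans (ℕₚ.m≤m+n n (k ℕ.* n))
          (ℕₚ.≤-trans (ℕₚ.≤-reflexive (≡.sym o≡kn)) (ℕ.s≤s (ℕₚ.m≤n+m o i))))

    lifts-disjoint : ∀ {ξ ξ′ η} → η ∈ lifts ξ → η ∈ lifts ξ′ → ξ ≈′ ξ′
    lifts-disjoint {ξ} {ξ′} {η} p q =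
      let (i , _ , l , eq)   = Anyₚ.applyUpTo⁻ (lift ξ) p
          (j , _ , l′ , eq′) = Anyₚ.applyUpTo⁻ (lift ξ′) q
          η′ = restrict η
      in Setoid.trans S′ {ξ} {η′} {ξ′} (Setoid.sym S′ {η′} {ξ} (l ∘ suc , eq ∘ suc)) (l′ ∘ suc , eq′ ∘ suc)

    -- Replacing the tail of η by ξ changes b·η by the integer s, so nη₀ = u - b·ξ with u = z₀ - s.
    -- The remainder of u modulo n then names the lift, and the quotient is the integer by which the
    -- first coordinates differ.
    lift-restrict : ∀ η ξ → restrict η ≈′ ξ → ∃[ k ] (k ℕ.< n × η ≈ᴬ lift ξ k)
    lift-restrict η@(η₀ , z , p) ξ@(ξ₀ , _) (l , η-ξ≈l) =
      r , ℤDiv.n%ℕd<d u n , (q ∷ᵛ l) , λ { zero → first-coordinate ; (suc j) → η-ξ≈l j }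
      where
      s u q : ℤ
      s = ∑ℤ.sum λ j → b j ℤ.* l j
      u = z zero ℤ.- s
      q = u ℤDiv./ℕ n
      r : ℕ
      r = u ℤDiv.%ℕ n
      first-coordinate : η₀ zero - first ξ₀ r ≈ fromℤ q
      first-coordinate = begin
        η₀ zero - first ξ₀ r
          ≈⟨ +-congʳ (trans (*-congˡ n⁻¹n≈1) (*-identityʳ _)) ⟨
        η₀ zero * (n⁻¹ * fromℕ n) - (fromℕ r - b ∙ ξ₀) * n⁻¹
          ≈⟨ solve 7 (λ x i n r β s bη → x :* (i :* n) :- (r :- β) :* i :=
               ((n :* x :+ bη) :- s :- r :- (bη :- (β :+ s))) :* i)
               refl (η₀ zero) n⁻¹ (fromℕ n) (fromℕ r) (b ∙ ξ₀) (fromℤ s) (b ∙ (η₀ ∘ suc)) ⟩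
        ((fromℕ n * η₀ zero + b ∙ (η₀ ∘ suc)) - fromℤ s - fromℕ r
           - (b ∙ (η₀ ∘ suc) - (b ∙ ξ₀ + fromℤ s))) * n⁻¹
          ≈⟨ *-congʳ (trans
               (+-cong (+-congʳ (+-congʳ row))
                 (trans (-‿cong (trans (+-congʳ (∙-shift b (l , η-ξ≈l))) (-‿inverseʳ _))) R.-0#≈0#))
               (+-identityʳ _)) ⟩
        (fromℤ (z zero) - fromℤ s - fromℕ r) * n⁻¹
          ≈⟨ *-congʳ (+-congʳ (trans (+-congˡ (sym (fromℤ-homo-neg s))) (sym (fromℤ-homo-+ (z zero) (ℤ.- s))))) ⟩
        (fromℤ u - fromℕ r) * n⁻¹
          ≈⟨ *-congʳ (+-congʳ (trans (reflexive (≡.cong fromℤ (ℤDiv.a≡a%ℕn+[a/ℕn]*n u n)))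
               (trans (fromℤ-homo-+ (+ r) (q ℤ.* + n)) (+-congˡ (fromℤ-homo-* q (+ n)))))) ⟩
        (fromℕ r + fromℤ q * fromℕ n - fromℕ r) * n⁻¹
          ≈⟨ solve 4 (λ r q n i → (r :+ q :* n :- r) :* i := q :* (i :* n)) refl _ _ _ _ ⟩
        fromℤ q * (n⁻¹ * fromℕ n)
          ≈⟨ trans (*-congˡ n⁻¹n≈1) (*-identityʳ _) ⟩
        fromℤ q ∎
        where
        row : fromℕ n * η₀ zero + b ∙ (η₀ ∘ suc) ≈ fromℤ (z zero)
        row = trans (+-congʳ (*-congʳ (reflexive (≡.cong fromℤ (≡.sym A₀₀))))) (p zero)

    -- Subtracts q times the first column and drops the first entry, which becomes 0 when x₀ = qn.
    -- The two-term form is that of `∙-linearˡ`.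
    reduceVector : ℤ → Vector ℤ (suc d) → Vector ℤ d
    reduceVector q x i = 1ℤ ℤ.* x (suc i) ℤ.+ ℤ.- q ℤ.* b i

    private
      row₀ : ∀ m → (A ·ℤ m) zero ≡ m zero ℤ.* + n
      row₀ m = ≡.trans (≡.cong₂ ℤ._+_ (≡.trans (≡.cong (ℤ._* m zero) A₀₀) (ℤₚ.*-comm (+ n) (m zero)))
        (Columns.sum-zero λ j → ≡.trans (≡.cong (ℤ._* m (suc j)) (A₀ⱼ j)) (ℤₚ.*-zeroˡ (m (suc j))))) (ℤₚ.+-identityʳ _)

    image⁺ : ∀ {x} q → x zero ≡ q ℤ.* + n → reduceVector q x ∈Image A′ → x ∈Image A
    image⁺ {x} q x₀≡qn (m , p) = q ∷ᵛ m , λ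
      { zero    → ≡.trans (row₀ (q ∷ᵛ m)) (≡.sym x₀≡qn)
      ; (suc i) → ≡.trans (≡.cong (λ z → b i ℤ.* q ℤ.+ z) (p i))
          (ℤS.solve 3 (λ b q x →
              b ℤS.:* q ℤS.:+ (ℤS.con 1ℤ ℤS.:* x ℤS.:+ (ℤS.:- q) ℤS.:* b) ℤS.:= x)
            ≡.refl (b i) q (x (suc i)))
      }

    image⁻-divides : ∀ {x} → x ∈Image A → + n ∣ℤ x zero
    image⁻-divides (m , p) = divides (m zero) (≡.trans (≡.sym (p zero)) (row₀ m))

    image⁻ : ∀ {x} q → x zero ≡ q ℤ.* + n → x ∈Image A → reduceVector q x ∈Image A′
    image⁻ {x} q x₀≡qn (m , p) = m ∘ suc , λ i →
      ≡.trans (ℤS.solve 3 (λ b m y →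
            y ℤS.:= ℤS.con 1ℤ ℤS.:* (b ℤS.:* m ℤS.:+ y) ℤS.:+ (ℤS.:- m) ℤS.:* b)
          ≡.refl (b i) (m zero) ((A′ ·ℤ (m ∘ suc)) i))
        (≡.cong₂ (λ y k → 1ℤ ℤ.* y ℤ.+ ℤ.- k ℤ.* b i) (p (suc i)) m₀≡q)
      where
      m₀≡q : m zero ≡ q
      m₀≡q = ℤₚ.*-cancelʳ-≡ (m zero) q (+ n) (≡.trans (≡.sym (row₀ m)) (≡.trans (p zero) x₀≡qn))

    imageA? : ∀ x → Dec (x ∈Image A)
    imageA? x with + n ∣ℤ? x zero
    ... | no  n∤x₀             = no (n∤x₀ ∘ image⁻-divides)
    ... | yes (divides q x₀≡qn) = Dec.map′ (image⁺ q x₀≡qn) (image⁻ q x₀≡qn) (image? (reduceVector q x))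

    -- Each fibre is summed first. If n does not divide x₀, the fibre is a progression with
    -- difference x₀/n and its sum vanishes by itself. If x₀ = qn, the k-th term differs in phase
    -- from a constant by the integer qk; the fibre contributes n equal terms, and the vector left
    -- over is outside the image of A′.
    vanishingA : ∀ φ x → ¬ x ∈Image A →
      sumOver (concatMap lifts terms) (λ (ξ , _) → cos₁ (φ + x ∙ ξ)) ≈ 0#
    vanishingA φ x x∉A = trans (sumOver-concatMap lifts terms _) (trans
        (sumOver-cong terms λ ξ → sumOver-applyUpTo (lift ξ) n _)
        (by-division (+ n ∣ℤ? x zero)))
      where
      f : Vector ℝ d → ℕ → ℝ
      f ξ k = cos₁ (φ + (fromℤ (x zero) * first ξ k + (x ∘ suc) ∙ ξ))

      by-division : Dec (+ n ∣ℤ x zero) → sumOver terms (λ (ξ , _) → partialSum (f ξ) n) ≈ 0#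
      by-division (no n∤x₀) = sumOver-0 terms λ (ξ , _) → trans
        (partialSum-cong (λ k → cos₁-cong
          (solve 6 (λ p x k β i y → p :+ (x :* ((k :- β) :* i) :+ y) := p :+ y :- x :* β :* i :+ k :* (x :* i))
            refl φ _ _ (b ∙ ξ) n⁻¹ _)) n)
        (cos₁-arithmetic-sum n _ (x zero) n∤x₀)
      by-division (yes (divides q x₀≡qn)) = begin
        sumOver terms (λ (ξ , _) → partialSum (f ξ) n)
          ≈⟨ sumOver-cong terms (λ (ξ , _) → trans (partialSum-cong (periods ξ) n) (partialSum-const n _)) ⟩
        sumOver terms (λ (ξ , _) → fromℕ n * cos₁ (φ + reduceVector q x ∙ ξ))
          ≈⟨ *-sumOver _ terms _ ⟩
        fromℕ n * sumOver terms (λ (ξ , _) → cos₁ (φ + reduceVector q x ∙ ξ))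
          ≈⟨ *-congˡ (vanishing φ (reduceVector q x) (x∉A ∘ image⁺ q x₀≡qn)) ⟩
        fromℕ n * 0#
          ≈⟨ zeroʳ _ ⟩
        0# ∎
        where
        partialSum-const : ∀ n r → partialSum (λ _ → r) n ≈ fromℕ n * r
        partialSum-const zero    r = sym (zeroˡ r)
        partialSum-const (suc n) r = trans (+-congʳ (partialSum-const n r))
          (solve 2 (λ n r → n :* r :+ r := (con 1ℤ :+ n) :* r) refl _ r)
        periods : ∀ ξ k → f ξ k ≈ cos₁ (φ + reduceVector q x ∙ ξ)
        periods ξ k = cos₁-≈-+ℤ (q ℤ.* + k) (begin
          φ + (fromℤ (x zero) * first ξ k + (x ∘ suc) ∙ ξ)
            ≈⟨ +-congˡ (+-congʳ (*-congʳ (trans (reflexive (≡.cong fromℤ x₀≡qn)) (fromℤ-homo-* q (+ n))))) ⟩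
          φ + (fromℤ q * fromℕ n * first ξ k + (x ∘ suc) ∙ ξ)
            ≈⟨ solve 7 (λ p q n k β i y → p :+ (q :* n :* ((k :- β) :* i) :+ y) :=
                 p :+ ((i :* n) :* (q :* (k :- β)) :+ y)) refl φ _ _ _ (b ∙ ξ) n⁻¹ _ ⟩
          φ + (n⁻¹ * fromℕ n * (fromℤ q * (fromℕ k - b ∙ ξ)) + (x ∘ suc) ∙ ξ)
            ≈⟨ +-congˡ (+-congʳ (trans (*-congʳ n⁻¹n≈1) (*-identityˡ _))) ⟩
          φ + (fromℤ q * (fromℕ k - b ∙ ξ) + (x ∘ suc) ∙ ξ)
            ≈⟨ solve 5 (λ p q k β y → p :+ (q :* (k :- β) :+ y) :=
                 p :+ ((con 1ℤ :* y) :+ (:- q) :* β) :+ q :* k) refl φ _ _ (b ∙ ξ) _ ⟩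
          φ + (1# * (x ∘ suc) ∙ ξ + - fromℤ q * b ∙ ξ) + fromℤ q * fromℕ k
            ≈⟨ +-cong (+-congˡ (trans (+-cong (*-congʳ (sym (+-identityʳ 1#))) (*-congʳ (sym (fromℤ-homo-neg q))))
                 (sym (∙-linearˡ 1ℤ (ℤ.- q) (x ∘ suc) b ξ)))) (sym (fromℤ-homo-* q (+ k))) ⟩
          φ + reduceVector q x ∙ ξ + fromℤ (q ℤ.* + k) ∎)

    transversal : Transversal A
    transversal = record
      { terms      = concatMap lifts terms
      ; distinct   = unique-concatMap S′ S lifts lifts-distinct
          (λ {ξ} {ξ′} {η} → lifts-disjoint {ξ} {ξ′} {η}) distinct
      ; exhaustive = λ η → Anyₚ.concatMap⁺ lifts (Any.map
          (λ {ξ} η≈ξ → let (k , k<n , η≈) = lift-restrict η ξ η≈ξ in Anyₚ.applyUpTo⁺ (lift ξ) η≈ k<n)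
          (exhaustive (restrict η)))
      ; count      = ≡.trans (length-concatMap lifts n (λ ξ → Listₚ.length-applyUpTo (lift ξ) n) terms)
          (≡.trans (≡.cong (ℕ._* n) count) (≡.trans (ℕₚ.*-comm ∣ det A′ ∣ n)
            (≡.sym (≡.trans (∣det∣-triangular A A₀ⱼ) (≡.cong (λ a → ∣ a ∣ ℕ.* ∣ det A′ ∣) A₀₀)))))
      ; image?     = imageA?
      ; vanishing  = vanishingA
      }

  transversal : ∀ {d} (A : Matrix ℤ d) → det A ≢ 0ℤ → Transversal A
  transversal {zero}  A _     = trivial-transversal A
  transversal {suc d} A det≢0 with reduce⁺ (transpose A)
  ... | n , B , B₀₀≡n , B₀≡0 , A~B = transversal-~ A (transpose B) A~B (triangular n B₀₀≡n)
    where
    B′ : Matrix ℤ d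
    B′ i j = B (suc j) (suc i)

    ∣det∣≡ : ∣ det A ∣ ≡ ∣ B zero zero ∣ ℕ.* ∣ det B′ ∣
    ∣det∣≡ = ≡.trans (_~_.∣det∣ A~B (Columns.det-isAlternating _)) (∣det∣-triangular (transpose B) B₀≡0)

    det≡0 : ∣ B zero zero ∣ ℕ.* ∣ det B′ ∣ ≡ 0 → ⊥
    det≡0 p = det≢0 (ℤₚ.∣i∣≡0⇒i≡0 (≡.trans ∣det∣≡ p))

    triangular : ∀ n → B zero zero ≡ + n → Transversal (transpose B)
    triangular zero    B₀₀ = ⊥-elim (det≡0 (≡.cong (λ z → ∣ z ∣ ℕ.* ∣ det B′ ∣) B₀₀))
    triangular (suc n) B₀₀ = Triangular.transversal (transpose B) B₀₀ B₀≡0 (transversal B′ λ det′≡0 →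
      det≡0 (≡.trans (≡.cong (λ z → ∣ B zero zero ∣ ℕ.* ∣ z ∣) det′≡0) (ℕₚ.*-zeroʳ ∣ B zero zero ∣)))

module _ {a ℓ} (M : CommutativeMonoid a ℓ) where
  open CommutativeMonoid M
  open CMSum M using (sum)

  -- Stated for commutative monoids because it splits sums and products alike, of reals and of
  -- naturals, into the two directions of steps.
  sum-↑ : ∀ m {n} (t : Vector Carrier (m ℕ.+ n)) → sum t ≈ sum (λ i → t (i ↑ˡ n)) ∙ sum (λ i → t (m ↑ʳ i))
  sum-↑ zero    t = sym (identityˡ _)
  sum-↑ (suc m) t = trans (∙-congˡ (sum-↑ m (t ∘ suc))) (sym (assoc _ _ _))

-- Compositions of a natural number into m parts.

module Compositions where
  private module ∑ℕ = CMSum ℕₚ.+-0-commutativeMonoid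

  vectorSetoid : ℕ → Setoid _ _
  vectorSetoid = VectorEquality.≋-setoid (≡.setoid ℕ)

  compositions : ∀ m → ℕ → List (Vector ℕ m)
  compositions zero    zero    = (λ ()) ∷ []
  compositions zero    (suc n) = []
  compositions (suc m) n       = concatMap (λ k → map (k ∷ᵛ_) (compositions m (n ℕ.∸ k))) (upTo (suc n))

  compositions-sound : ∀ m n → All (λ r → ∑ℕ.sum r ≡ n) (compositions m n)
  compositions-sound zero    zero    = ≡.refl All.∷ All.[]
  compositions-sound zero    (suc n) = All.[]
  compositions-sound (suc m) n       = Allₚ.concat⁺ (Allₚ.map⁺ (Allₚ.applyUpTo⁺₁ _ (suc n) λ {k} k<1+n →
    Allₚ.map⁺ (All.map (λ eq → ≡.trans (≡.cong (k ℕ.+_) eq) (ℕₚ.m+[n∸m]≡n (ℕ.s≤s⁻¹ k<1+n))) (compositions-sound m (n ℕ.∸ k)))))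

  compositions-complete : ∀ m n r → ∑ℕ.sum r ≡ n → Membership._∈_ (vectorSetoid m) r (compositions m n)
  compositions-complete zero    zero    r eq = here λ ()
  compositions-complete (suc m) n       r ≡.refl = Anyₚ.concatMap⁺ (λ k → map (k ∷ᵛ_) (compositions m (n ℕ.∸ k)))
    (Anyₚ.applyUpTo⁺ (λ k → k) (Anyₚ.map⁺ (Any.map (λ { eq zero → ≡.refl ; eq (suc i) → eq i })
      (compositions-complete m _ (r ∘ suc) (≡.sym (ℕₚ.m+n∸m≡n (r zero) _)))))
      (ℕ.s≤s (ℕₚ.m≤m+n (r zero) _)))

  compositions-unique : ∀ m n → UniqueSetoid.Unique (vectorSetoid m) (compositions m n)
  compositions-unique zero    zero    = All.[] AllPairs.∷ AllPairs.[]
  compositions-unique zero    (suc n) = AllPairs.[]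
  compositions-unique (suc m) n       = unique-concatMap (≡.setoid ℕ) (vectorSetoid (suc m)) _
    (λ k → Uniqueₚ.map⁺ (vectorSetoid m) (vectorSetoid (suc m)) (λ eq i → eq (suc i)) (compositions-unique m (n ℕ.∸ k)))
    (λ {k} {k′} p q → ≡.trans (≡.sym (head≡ k p)) (head≡ k′ q))
    (Unique≡ₚ.upTo⁺ (suc n))
    where
    head≡ : ∀ k {l r} → Membership._∈_ (vectorSetoid (suc m)) r (map (k ∷ᵛ_) l) → r zero ≡ k
    head≡ k p = proj₂ (Any.satisfied (Any.map (λ eq → eq zero) (Anyₚ.map⁻ p)))

-- The multinomial recursion for a function of the phase.

module Multinomial {c ℓ₁ ℓ₂} (ℛ : RealNumbers c ℓ₁ ℓ₂) where
  open Reals ℛ hiding (zero)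
  open RealAlgebra ℛ
  open Limits ℛ
  open Cosine ℛ using (expTerm; expTerm-suc)
  open ListSums ℛ
  open InnerProduct ℛ
  open Compositions
  private
    module ∑ = CMSum +-commutativeMonoid
  open SetoidReasoning setoid

  1/!ᵛ : ∀ {m} → Vector ℕ m → ℝ
  1/!ᵛ r = 1/ℕ (r !ᵛ) {{r !ᵛ≢0}}

  antidiagonal≈partialSum : ∀ f n → antidiagonal f n ≈ partialSum (λ k → f k (n ℕ.∸ k)) (suc n)
  antidiagonal≈partialSum f zero    = sym (+-identityˡ _)
  antidiagonal≈partialSum f (suc n) = trans (+-congˡ (antidiagonal≈partialSum (f ∘ suc) n))
    (sym (partialSum-shift (λ k → f k (suc n ℕ.∸ k)) (suc n)))

  antidiagonal-∑ : ∀ {m} (f : Fin m → ℕ → ℕ → ℝ) n →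
    antidiagonal (λ k l → ∑.sum λ j → f j k l) n ≈ ∑.sum λ j → antidiagonal (f j) n
  antidiagonal-∑ f zero    = refl
  antidiagonal-∑ f (suc n) = trans (+-congˡ (antidiagonal-∑ (λ j → f j ∘ suc) n))
    (sym (∑.∑-distrib-+ (λ j → f j 0 (suc n)) (λ j → antidiagonal (f j ∘ suc) n)))

  *-∑ : ∀ {m} x (f : Vector ℝ m) → x * ∑.sum f ≈ ∑.sum λ j → x * f j
  *-∑ {zero}  x f = zeroʳ x
  *-∑ {suc m} x f = trans (distribˡ x _ _) (+-congˡ (*-∑ x (f ∘ suc)))

  module _ (h : ℝ → ℝ) (h-cong : ∀ {x y} → x ≈ y → h x ≈ h y) where

    -- For h = exp this is (∑ⱼ vⱼ exp θⱼ)ⁿ exp φ / n!.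
    multinomialSum : ∀ m → ℕ → Vector ℝ m → Vector ℝ m → ℝ → ℝ
    multinomialSum m n v θ φ = sumOver (compositions m n) λ r → v ^ᵛ r * 1/!ᵛ r * h (φ + (+_ ∘ r) ∙ θ)

    multinomialSum-cong : ∀ m n v θ {φ ψ} → φ ≈ ψ → multinomialSum m n v θ φ ≈ multinomialSum m n v θ ψ
    multinomialSum-cong m n v θ φ≈ψ = sumOver-cong (compositions m n) λ r → *-congˡ (h-cong (+-congʳ φ≈ψ))

    multinomialSum-suc : ∀ m n v θ φ → multinomialSum (suc m) n v θ φ ≈
      antidiagonal (λ k l → expTerm (v zero) k * multinomialSum m l (v ∘ suc) (θ ∘ suc) (φ + fromℕ k * θ zero)) n
    multinomialSum-suc m n v θ φ = begin
      multinomialSum (suc m) n v θ φ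
        ≈⟨ sumOver-concatMap (λ k → map (k ∷ᵛ_) (compositions m (n ℕ.∸ k))) (upTo (suc n)) _ ⟩
      sumOver (upTo (suc n)) (λ k → sumOver (map (k ∷ᵛ_) (compositions m (n ℕ.∸ k))) f)
        ≈⟨ sumOver-applyUpTo (λ k → k) (suc n) _ ⟩
      partialSum (λ k → sumOver (map (k ∷ᵛ_) (compositions m (n ℕ.∸ k))) f) (suc n)
        ≈⟨ partialSum-cong (λ k → trans (sumOver-map (k ∷ᵛ_) (compositions m (n ℕ.∸ k)) f)
             (trans (sumOver-cong (compositions m (n ℕ.∸ k)) (factor k)) (*-sumOver _ (compositions m (n ℕ.∸ k)) _))) (suc n) ⟩
      partialSum (λ k → expTerm (v zero) k * multinomialSum m (n ℕ.∸ k) (v ∘ suc) (θ ∘ suc) (φ + fromℕ k * θ zero)) (suc n)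
        ≈⟨ antidiagonal≈partialSum _ n ⟨
      antidiagonal (λ k l → expTerm (v zero) k * multinomialSum m l (v ∘ suc) (θ ∘ suc) (φ + fromℕ k * θ zero)) n ∎
      where
      f : Vector ℕ (suc m) → ℝ
      f r = v ^ᵛ r * 1/!ᵛ r * h (φ + (+_ ∘ r) ∙ θ)
      factor : ∀ k r → f (k ∷ᵛ r) ≈
        expTerm (v zero) k * ((v ∘ suc) ^ᵛ r * 1/!ᵛ r * h (φ + fromℕ k * θ zero + (+_ ∘ r) ∙ (θ ∘ suc)))
      factor k r = begin
        v zero ^ k * (v ∘ suc) ^ᵛ r * 1/!ᵛ (k ∷ᵛ r) * h (φ + (fromℕ k * θ zero + (+_ ∘ r) ∙ (θ ∘ suc)))
          ≈⟨ *-cong (*-congˡ (1/ℕ-homo-* (k !) (r !ᵛ) {{k ℕₚ.!≢0}} {{r !ᵛ≢0}} {{(k ∷ᵛ r) !ᵛ≢0}}))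
               (h-cong (sym (+-assoc _ _ _))) ⟩
        v zero ^ k * (v ∘ suc) ^ᵛ r * (1/ℕ (k !) {{k ℕₚ.!≢0}} * 1/!ᵛ r) * h (φ + fromℕ k * θ zero + (+_ ∘ r) ∙ (θ ∘ suc))
          ≈⟨ solve 5 (λ a b c d e → a :* b :* (c :* d) :* e := a :* c :* (b :* d :* e)) refl _ _ _ _ _ ⟩
        expTerm (v zero) k * ((v ∘ suc) ^ᵛ r * 1/!ᵛ r * h (φ + fromℕ k * θ zero + (+_ ∘ r) ∙ (θ ∘ suc))) ∎

    multinomialSum-zero : ∀ m v θ φ → multinomialSum m 0 v θ φ ≈ h φ
    multinomialSum-zero zero    v θ φ = trans (+-identityʳ _)
      (trans (*-cong (trans (*-identityˡ _) 1/ℕ-1) (h-cong (+-identityʳ φ))) (*-identityˡ _))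
    multinomialSum-zero (suc m) v θ φ = begin
      multinomialSum (suc m) 0 v θ φ
        ≈⟨ multinomialSum-suc m 0 v θ φ ⟩
      1# * 1/ℕ 1 * multinomialSum m 0 (v ∘ suc) (θ ∘ suc) (φ + 0# * θ zero)
        ≈⟨ *-cong (trans (*-identityˡ _) 1/ℕ-1) (multinomialSum-zero m _ _ _) ⟩
      1# * h (φ + 0# * θ zero)
        ≈⟨ trans (*-identityˡ _) (h-cong (trans (+-congˡ (zeroˡ _)) (+-identityʳ φ))) ⟩
      h φ ∎

    -- Removes one unit from one part of the composition. The Leibniz rule separates the first part
    -- from the others, which are handled by induction on m. As h is not assumed multiplicative, the
    -- factor exp θⱼ of the exponential case appears as a translation of the phase.
    multinomialSum-pascal : ∀ m n v θ φ →
      fromℕ (suc n) * multinomialSum m (suc n) v θ φ ≈ ∑.sum λ j → v j * multinomialSum m n v θ (φ + θ j)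
    multinomialSum-pascal zero    n v θ φ = zeroʳ _
    multinomialSum-pascal (suc m) n v θ φ = begin
      fromℕ (suc n) * multinomialSum (suc m) (suc n) v θ φ
        ≈⟨ *-congˡ (multinomialSum-suc m (suc n) v θ φ) ⟩
      fromℕ (suc n) * antidiagonal F (suc n)
        ≈⟨ antidiagonal-suc F n ⟩
      antidiagonal (λ k l → fromℕ (suc k) * F (suc k) l) n + antidiagonal (λ k l → fromℕ (suc l) * F k (suc l)) n
        ≈⟨ +-cong first rest ⟩
      v zero * multinomialSum (suc m) n v θ (φ + θ zero)
        + (∑.sum λ j → v (suc j) * multinomialSum (suc m) n v θ (φ + θ (suc j))) ∎
      where
      E : ℕ → ℝ → ℝ
      E l = multinomialSum m l (v ∘ suc) (θ ∘ suc)
      e : ℕ → ℝ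
      e = expTerm (v zero)
      G : ℝ → ℕ → ℕ → ℝ
      G φ k l = e k * E l (φ + fromℕ k * θ zero)
      F = G φ

      first : antidiagonal (λ k l → fromℕ (suc k) * F (suc k) l) n ≈ v zero * multinomialSum (suc m) n v θ (φ + θ zero)
      first = begin
        antidiagonal (λ k l → fromℕ (suc k) * F (suc k) l) n
          ≈⟨ antidiagonal-cong (λ k l → trans (sym (*-assoc _ _ _)) (trans
               (*-cong (expTerm-suc (v zero) k) (multinomialSum-cong m l (v ∘ suc) (θ ∘ suc)
                 (solve 3 (λ p k t → p :+ (con 1ℤ :+ k) :* t := p :+ t :+ k :* t) refl φ (fromℕ k) (θ zero))))
               (*-assoc _ _ _))) n ⟩
        antidiagonal (λ k l → v zero * G (φ + θ zero) k l) n
          ≈⟨ *-antidiagonal (v zero) (G (φ + θ zero)) n ⟩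
        v zero * antidiagonal (G (φ + θ zero)) n
          ≈⟨ *-congˡ (multinomialSum-suc m n v θ (φ + θ zero)) ⟨
        v zero * multinomialSum (suc m) n v θ (φ + θ zero) ∎

      rest : antidiagonal (λ k l → fromℕ (suc l) * F k (suc l)) n ≈
             ∑.sum λ j → v (suc j) * multinomialSum (suc m) n v θ (φ + θ (suc j))
      rest = begin
        antidiagonal (λ k l → fromℕ (suc l) * F k (suc l)) n
          ≈⟨ antidiagonal-cong distribute n ⟩
        antidiagonal (λ k l → ∑.sum λ j → v (suc j) * G (φ + θ (suc j)) k l) n
          ≈⟨ antidiagonal-∑ (λ j k l → v (suc j) * G (φ + θ (suc j)) k l) n ⟩
        (∑.sum λ j → antidiagonal (λ k l → v (suc j) * G (φ + θ (suc j)) k l) n)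
          ≈⟨ ∑.sum-cong-≋ (λ j → trans (*-antidiagonal (v (suc j)) (G (φ + θ (suc j))) n)
               (*-congˡ (sym (multinomialSum-suc m n v θ (φ + θ (suc j)))))) ⟩
        (∑.sum λ j → v (suc j) * multinomialSum (suc m) n v θ (φ + θ (suc j))) ∎
        where
        swap : ∀ a b c → a * (b * c) ≈ b * (a * c)
        swap = solve 3 (λ a b c → a :* (b :* c) := b :* (a :* c)) refl

        distribute : ∀ k l → fromℕ (suc l) * F k (suc l) ≈ ∑.sum λ j → v (suc j) * G (φ + θ (suc j)) k l
        distribute k l = begin
          fromℕ (suc l) * (e k * E (suc l) ψ)
            ≈⟨ swap _ (e k) _ ⟩
          e k * (fromℕ (suc l) * E (suc l) ψ)
            ≈⟨ *-congˡ (multinomialSum-pascal m l (v ∘ suc) (θ ∘ suc) ψ) ⟩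
          e k * (∑.sum λ j → v (suc j) * E l (ψ + θ (suc j)))
            ≈⟨ *-∑ (e k) (λ j → v (suc j) * E l (ψ + θ (suc j))) ⟩
          (∑.sum λ j → e k * (v (suc j) * E l (ψ + θ (suc j))))
            ≈⟨ ∑.sum-cong-≋ (λ j → trans (swap (e k) (v (suc j)) (E l (ψ + θ (suc j))))
                 (*-congˡ (*-congˡ (multinomialSum-cong m l (v ∘ suc) (θ ∘ suc)
                   (solve 3 (λ p a b → p :+ a :+ b := p :+ b :+ a) refl φ (fromℕ k * θ zero) (θ (suc j))))))) ⟩
          (∑.sum λ j → v (suc j) * G (φ + θ (suc j)) k l) ∎
          where ψ = φ + fromℕ k * θ zero

-- Powers of a cosine sum as sums over walks.

module CosineMultinomial {c ℓ₁ ℓ₂} (ℛ : RealNumbers c ℓ₁ ℓ₂) (π : Reals.ℝ ℛ) (isPi : Reals.IsPi ℛ π) where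
  open Reals ℛ hiding (zero)
  open RealAlgebra ℛ
  open Periodicity ℛ π isPi
  open ListSums ℛ
  open InnerProduct ℛ
  open Multinomial ℛ
  private
    module ∑ = CMSum +-commutativeMonoid
    module R = RingProperties ring
  open SetoidReasoning setoid

  -- The directions ξᵢ and -ξᵢ carry the same weight wᵢ, so their translations always occur as cos(φ
  -- + ξᵢ) + cos(φ - ξᵢ) = 2 cos φ cos ξᵢ. The pair acts as multiplication by 2wᵢ cos ξᵢ, and the
  -- phase φ is restored for the induction on n.
  cosine-multinomial : ∀ {d} (w ξ : Vector ℝ d) n φ →
    fromℕ (n !) * multinomialSum cos₁ cos₁-cong (d ℕ.+ d) n (w ++ᵛ w) (ξ ++ᵛ (λ i → - ξ i)) φ ≈
    (⟨ w , cos₁ ∘ ξ ⟩ + ⟨ w , cos₁ ∘ ξ ⟩) ^ n * cos₁ φ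
  cosine-multinomial {d} w ξ zero    φ = *-cong (+-identityʳ 1#) (multinomialSum-zero cos₁ cos₁-cong (d ℕ.+ d) _ _ φ)
  cosine-multinomial {d} w ξ (suc n) φ = begin
    fromℕ (suc n !) * S (suc n) φ
      ≈⟨ *-congʳ (fromℕ-homo-* (suc n) (n !)) ⟩
    fromℕ (suc n) * fromℕ (n !) * S (suc n) φ
      ≈⟨ solve 3 (λ a b c → a :* b :* c := b :* (a :* c)) refl _ _ _ ⟩
    fromℕ (n !) * (fromℕ (suc n) * S (suc n) φ)
      ≈⟨ trans (*-congˡ (multinomialSum-pascal cos₁ cos₁-cong (d ℕ.+ d) n v θ φ)) (*-∑ _ (λ j → v j * S n (φ + θ j))) ⟩
    (∑.sum λ j → fromℕ (n !) * (v j * S n (φ + θ j)))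
      ≈⟨ ∑.sum-cong-≋ (λ j → trans (solve 3 (λ a b c → a :* (b :* c) := b :* (a :* c)) refl _ (v j) _)
           (*-congˡ (cosine-multinomial w ξ n (φ + θ j)))) ⟩
    ∑.sum t
      ≈⟨ sum-↑ +-commutativeMonoid d t ⟩
    ∑.sum (λ i → t (i ↑ˡ d)) + ∑.sum (λ i → t (d ↑ʳ i))
      ≈⟨ ∑.∑-distrib-+ (λ i → t (i ↑ˡ d)) (λ i → t (d ↑ʳ i)) ⟨
    ∑.sum (λ i → t (i ↑ˡ d) + t (d ↑ʳ i))
      ≈⟨ ∑-linear (X ^ n * cos₁ φ) (X ^ n * cos₁ φ) _ (λ i → w i * cos₁ (ξ i)) (λ i → w i * cos₁ (ξ i)) product ⟩
    X ^ n * cos₁ φ * ⟨ w , cos₁ ∘ ξ ⟩ + X ^ n * cos₁ φ * ⟨ w , cos₁ ∘ ξ ⟩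
      ≈⟨ solve 3 (λ p c x → p :* c :* x :+ p :* c :* x := (x :+ x) :* p :* c) refl (X ^ n) _ _ ⟩
    X ^ suc n * cos₁ φ ∎
    where
    v = w ++ᵛ w
    θ = ξ ++ᵛ (λ i → - ξ i)
    S : ℕ → ℝ → ℝ
    S n = multinomialSum cos₁ cos₁-cong (d ℕ.+ d) n v θ
    X = ⟨ w , cos₁ ∘ ξ ⟩ + ⟨ w , cos₁ ∘ ξ ⟩
    t : Vector ℝ (d ℕ.+ d)
    t j = v j * (X ^ n * cos₁ (φ + θ j))
    product : ∀ i → t (i ↑ˡ d) + t (d ↑ʳ i) ≈
      X ^ n * cos₁ φ * (w i * cos₁ (ξ i)) + X ^ n * cos₁ φ * (w i * cos₁ (ξ i))
    product i = begin
      t (i ↑ˡ d) + t (d ↑ʳ i)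
        ≈⟨ +-cong
             (reflexive (≡.cong₂ (λ a b → a * (X ^ n * cos₁ (φ + b))) (Vectorₚ.lookup-++ˡ w w i) (Vectorₚ.lookup-++ˡ ξ _ i)))
             (reflexive (≡.cong₂ (λ a b → a * (X ^ n * cos₁ (φ + b))) (Vectorₚ.lookup-++ʳ w w i) (Vectorₚ.lookup-++ʳ ξ _ i))) ⟩
      w i * (X ^ n * cos₁ (φ + ξ i)) + w i * (X ^ n * cos₁ (φ - ξ i))
        ≈⟨ solve 4 (λ w x a b → w :* (x :* a) :+ w :* (x :* b) := w :* x :* (a :+ b)) refl (w i) (X ^ n) _ _ ⟩
      w i * X ^ n * (cos₁ (φ + ξ i) + cos₁ (φ - ξ i))
        ≈⟨ *-congˡ (cos₁-add φ (ξ i)) ⟩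
      w i * X ^ n * (cos₁ φ * cos₁ (ξ i) + cos₁ φ * cos₁ (ξ i))
        ≈⟨ solve 4 (λ w x a b → w :* x :* (a :* b :+ a :* b) := x :* a :* (w :* b) :+ x :* a :* (w :* b)) refl (w i) (X ^ n) _ _ ⟩
      X ^ n * cos₁ φ * (w i * cos₁ (ξ i)) + X ^ n * cos₁ φ * (w i * cos₁ (ξ i)) ∎

-- Walks in terms of displacement and cancelling pairs of steps.

module SignedSplitting where
  private
    module ∑ℕ = CMSum ℕₚ.+-0-commutativeMonoid
    module ∏ℕ = CMSum ℕₚ.*-1-commutativeMonoid
  open ℕSolver

  -- The numbers of steps p and q in the two opposite directions, recovered
  -- from the displacement p - q and the number min p q of cancelling pairs.
  split : ℤ → ℕ → ℕ × ℕ
  split (+ a)    y = a ℕ.+ y , y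
  split -[1+ a ] y = y , suc a ℕ.+ y

  private
    split-suc : ∀ x y → split x (suc y) ≡ (suc (proj₁ (split x y)) , suc (proj₂ (split x y)))
    split-suc (+ a)    y = ≡.cong (_, suc y) (ℕₚ.+-suc a y)
    split-suc -[1+ a ] y = ≡.cong (suc y ,_) (ℕₚ.+-suc (suc a) y)

  split-⊖-⊓ : ∀ p q → split (p ⊖ q) (p ⊓ q) ≡ (p , q)
  split-⊖-⊓ zero    zero    = ≡.refl
  split-⊖-⊓ zero    (suc q) = ≡.cong (λ k → 0 , suc k) (ℕₚ.+-identityʳ q)
  split-⊖-⊓ (suc p) zero    = ≡.cong (λ k → suc k , 0) (ℕₚ.+-identityʳ p)
  split-⊖-⊓ (suc p) (suc q) = ≡.trans (≡.cong (λ z → split z (suc (p ⊓ q))) (ℤₚ.[1+m]⊖[1+n]≡m⊖n p q))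
    (≡.trans (split-suc (p ⊖ q) (p ⊓ q)) (≡.cong (λ (p , q) → suc p , suc q) (split-⊖-⊓ p q)))

  split-⊖ : ∀ x y → proj₁ (split x y) ⊖ proj₂ (split x y) ≡ x
  split-⊖ (+ zero)  zero = ≡.refl
  split-⊖ (+ suc a) zero = ≡.cong (λ k → + suc k) (ℕₚ.+-identityʳ a)
  split-⊖ -[1+ a ]  zero = ≡.cong -[1+_] (ℕₚ.+-identityʳ a)
  split-⊖ x      (suc y) = ≡.trans (≡.cong (λ (p , q) → p ⊖ q) (split-suc x y))
    (≡.trans (ℤₚ.[1+m]⊖[1+n]≡m⊖n _ (proj₂ (split x y))) (split-⊖ x y))

  split-⊓ : ∀ x y → proj₁ (split x y) ⊓ proj₂ (split x y) ≡ y
  split-⊓ (+ a)    zero = ℕₚ.⊓-zeroʳ (a ℕ.+ 0)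
  split-⊓ -[1+ a ] zero = ≡.refl
  split-⊓ x     (suc y) = ≡.trans (≡.cong (λ (p , q) → p ⊓ q) (split-suc x y)) (≡.cong suc (split-⊓ x y))

  split-+ : ∀ x y → proj₁ (split x y) ℕ.+ proj₂ (split x y) ≡ ∣ x ∣ ℕ.+ 2 ℕ.* y
  split-+ (+ a)    y = solve 2 (λ a y → a :+ y :+ y := a :+ con 2 :* y) ≡.refl a y
  split-+ -[1+ a ] y = solve 2 (λ a y → y :+ (con 1 :+ a :+ y) := con 1 :+ a :+ con 2 :* y) ≡.refl a y

  split-! : ∀ x y → proj₁ (split x y) ! ℕ.* proj₂ (split x y) ! ≡ (∣ x ∣ ℕ.+ y) ! ℕ.* y !
  split-! (+ a)    y = ≡.refl
  split-! -[1+ a ] y = ℕₚ.*-comm (y !) _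

  module _ {d : ℕ} where

    -- A relation because it is entered from both sides: `splits` starts from the walk,
    -- `join-splits` from the pair, and the consequences below serve both.
    Splits : Vector ℕ (d ℕ.+ d) → Vector ℤ d → Vector ℕ d → Set
    Splits r x y = ∀ i → split (x i) (y i) ≡ (r (i ↑ˡ d) , r (d ↑ʳ i))

    displacement : Vector ℕ (d ℕ.+ d) → Vector ℤ d
    displacement r i = r (i ↑ˡ d) ⊖ r (d ↑ʳ i)

    cancellations : Vector ℕ (d ℕ.+ d) → Vector ℕ d
    cancellations r i = r (i ↑ˡ d) ⊓ r (d ↑ʳ i)

    join : Vector ℤ d → Vector ℕ d → Vector ℕ (d ℕ.+ d)
    join x y = (λ i → proj₁ (split (x i) (y i))) ++ᵛ (λ i → proj₂ (split (x i) (y i)))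

    splits : ∀ r → Splits r (displacement r) (cancellations r)
    splits r i = split-⊖-⊓ (r (i ↑ˡ d)) (r (d ↑ʳ i))

    join-splits : ∀ x y → Splits (join x y) x y
    join-splits x y i = ≡.cong₂ _,_
      (≡.sym (Vectorₚ.lookup-++ˡ _ (λ i → proj₂ (split (x i) (y i))) i))
      (≡.sym (Vectorₚ.lookup-++ʳ (λ i → proj₁ (split (x i) (y i))) _ i))

    splits-unique : ∀ r r′ {x x′ y y′} → Splits r x y → Splits r′ x′ y′ → x ≗ x′ → y ≗ y′ → r ≗ r′
    splits-unique r r′ s s′ x≗x′ y≗y′ j = ≡.subst (λ k → r k ≡ r′ k) (Finₚ.join-splitAt d d j) (case (Fin.splitAt d j))
      where
      pair : ∀ i → (r (i ↑ˡ d) , r (d ↑ʳ i)) ≡ (r′ (i ↑ˡ d) , r′ (d ↑ʳ i))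
      pair i = ≡.trans (≡.sym (s i)) (≡.trans (≡.cong₂ split (x≗x′ i) (y≗y′ i)) (s′ i))
      case : ∀ (s : Fin d ⊎ Fin d) → r (Fin.join d d s) ≡ r′ (Fin.join d d s)
      case (inj₁ i) = ≡.cong proj₁ (pair i)
      case (inj₂ i) = ≡.cong proj₂ (pair i)

    module _ r x y (s : Splits r x y) where

      displacement≗ : displacement r ≗ x
      displacement≗ i = ≡.trans (≡.cong (λ (p , q) → p ⊖ q) (≡.sym (s i))) (split-⊖ (x i) (y i))

      cancellations≗ : cancellations r ≗ y
      cancellations≗ i = ≡.trans (≡.cong (λ (p , q) → p ⊓ q) (≡.sym (s i))) (split-⊓ (x i) (y i))

      exponents : ∀ i → r (i ↑ˡ d) ℕ.+ r (d ↑ʳ i) ≡ ∣ x i ∣ ℕ.+ 2 ℕ.* y i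
      exponents i = ≡.trans (≡.cong (λ (p , q) → p ℕ.+ q) (≡.sym (s i))) (split-+ (x i) (y i))

      total-splits : ∑ℕ.sum r ≡ ∣ abs x ∣₁ ℕ.+ 2 ℕ.* ∣ y ∣₁
      total-splits = begin
        ∑ℕ.sum r                                                       ≡⟨ sum-↑ ℕₚ.+-0-commutativeMonoid d r ⟩
        ∑ℕ.sum (λ i → r (i ↑ˡ d)) ℕ.+ ∑ℕ.sum (λ i → r (d ↑ʳ i))        ≡⟨ ∑ℕ.∑-distrib-+ (λ i → r (i ↑ˡ d)) (λ i → r (d ↑ʳ i)) ⟨
        ∑ℕ.sum (λ i → r (i ↑ˡ d) ℕ.+ r (d ↑ʳ i))                       ≡⟨ ∑ℕ.sum-cong-≗ exponents ⟩
        ∑ℕ.sum (λ i → ∣ x i ∣ ℕ.+ 2 ℕ.* y i)                           ≡⟨ ∑ℕ.∑-distrib-+ (abs x) (λ i → 2 ℕ.* y i) ⟩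
        ∣ abs x ∣₁ ℕ.+ ∑ℕ.sum (λ i → 2 ℕ.* y i)                        ≡⟨ ≡.cong (∣ abs x ∣₁ ℕ.+_) (double y) ⟩
        ∣ abs x ∣₁ ℕ.+ 2 ℕ.* ∣ y ∣₁                                    ∎
        where
        open ≡.≡-Reasoning
        double : ∀ {n} (y : Vector ℕ n) → ∑ℕ.sum (λ i → 2 ℕ.* y i) ≡ 2 ℕ.* ∑ℕ.sum y
        double {zero}  y = ≡.refl
        double {suc n} y = ≡.trans (≡.cong (2 ℕ.* y zero ℕ.+_) (double (y ∘ suc))) (≡.sym (ℕₚ.*-distribˡ-+ 2 (y zero) _))

      !ᵛ-splits : r !ᵛ ≡ (abs x +ᵛ y) !ᵛ ℕ.* y !ᵛ
      !ᵛ-splits = begin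
        r !ᵛ                                                              ≡⟨ sum-↑ ℕₚ.*-1-commutativeMonoid d (λ j → r j !) ⟩
        ∏ℕ.sum (λ i → r (i ↑ˡ d) !) ℕ.* ∏ℕ.sum (λ i → r (d ↑ʳ i) !)
          ≡⟨ ∏ℕ.∑-distrib-+ (λ i → r (i ↑ˡ d) !) (λ i → r (d ↑ʳ i) !) ⟨
        ∏ℕ.sum (λ i → r (i ↑ˡ d) ! ℕ.* r (d ↑ʳ i) !)
          ≡⟨ ∏ℕ.sum-cong-≗ (λ i → ≡.trans (≡.cong (λ (p , q) → p ! ℕ.* q !) (≡.sym (s i))) (split-! (x i) (y i))) ⟩
        ∏ℕ.sum (λ i → (∣ x i ∣ ℕ.+ y i) ! ℕ.* y i !)
          ≡⟨ ∏ℕ.∑-distrib-+ (λ i → (abs x +ᵛ y) i !) (λ i → y i !) ⟩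
        (abs x +ᵛ y) !ᵛ ℕ.* y !ᵛ                                          ∎
        where open ≡.≡-Reasoning

  index⁺ : ∀ n k s → n ≡ k ℕ.+ 2 ℕ.* s → (+ s) / 1 ≡ (+ n -ℤ + k) / 2
  -- `mkℚᵘ` stores the denominator minus one: the fractions are s/1 and (n - k)/2, compared by
  -- cross-multiplication.
  index⁺ n k s ≡.refl = fromℚᵘ-cong {mkℚᵘ (+ s) 0} {mkℚᵘ (+ n -ℤ + k) 1} (*≡* (begin
    + s ℤ.* + 2
      ≡⟨ ℤS.solve 2 (λ k s → s ℤS.:* ℤS.con (+ 2) ℤS.:=
           (k ℤS.:+ ℤS.con (+ 2) ℤS.:* s ℤS.:- k) ℤS.:* ℤS.con 1ℤ) ≡.refl (+ k) (+ s) ⟩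
    (+ k ℤ.+ + 2 ℤ.* + s -ℤ + k) ℤ.* 1ℤ      ≡⟨ ≡.cong (λ z → (+ k ℤ.+ z -ℤ + k) ℤ.* 1ℤ) (ℤₚ.pos-* 2 s) ⟨
    (+ (k ℕ.+ 2 ℕ.* s) -ℤ + k) ℤ.* 1ℤ        ∎))
    where
    open ≡.≡-Reasoning

  index⁻ : ∀ n k s → (+ s) / 1 ≡ (+ n -ℤ + k) / 2 → n ≡ k ℕ.+ 2 ℕ.* s
  index⁻ n k s eq with /-injective-≃ (mkℚᵘ (+ s) 0) (mkℚᵘ (+ n -ℤ + k) 1) eq
  ... | *≡* 2s≡n-k = ℤₚ.+-injective (begin
    + n
      ≡⟨ ℤS.solve 2 (λ n k → n ℤS.:= k ℤS.:+ (n ℤS.:- k) ℤS.:* ℤS.con 1ℤ) ≡.refl (+ n) (+ k) ⟩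
    + k ℤ.+ (+ n -ℤ + k) ℤ.* 1ℤ          ≡⟨ ≡.cong (ℤ._+_ (+ k)) 2s≡n-k ⟨
    + k ℤ.+ + s ℤ.* + 2                  ≡⟨ ≡.cong (ℤ._+_ (+ k)) (ℤₚ.*-comm (+ s) (+ 2)) ⟩
    + k ℤ.+ + 2 ℤ.* + s                  ≡⟨ ≡.cong (ℤ._+_ (+ k)) (ℤₚ.pos-* 2 s) ⟨
    + (k ℕ.+ 2 ℕ.* s)                    ∎)
    where
    open ≡.≡-Reasoning

-- Sublists cut out by a decidable predicate.

module Selection where
  private variable
    a p q : Level
    A : Set a

  module _ {P : A → Set p} (P? : ∀ a → Dec (P a)) where

    -- Keeps the proofs, which are needed to build the elements of `Image A` and `𝒫` from the
    -- selected walks.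
    select : List A → List (Σ A P)
    select []       = []
    select (a ∷ as) with P? a
    ... | yes pa = (a , pa) ∷ select as
    ... | no  _  = select as

    select-all : ∀ {Q : A → Set q} {as} → All Q as → All (Q ∘ proj₁) (select as)
    select-all All.[] = All.[]
    select-all {as = a ∷ _} (qa All.∷ qas) with P? a
    ... | yes _ = qa All.∷ select-all qas
    ... | no  _ = select-all qas

    select-allPairs : ∀ {R : A → A → Set q} {as} → AllPairs R as → AllPairs (λ u v → R (proj₁ u) (proj₁ v)) (select as)
    select-allPairs AllPairs.[] = AllPairs.[]
    select-allPairs {as = a ∷ _} (r AllPairs.∷ rs) with P? a
    ... | yes _ = select-all r AllPairs.∷ select-allPairs rs
    ... | no  _ = select-allPairs rs

    select-any : ∀ {Q : A → Set q} {as} → (∀ {a} → Q a → P a) → Any Q as → Any (Q ∘ proj₁) (select as)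
    select-any {as = a ∷ _} Q⊆P (here qa) with P? a
    ... | yes _  = here qa
    ... | no ¬pa = ⊥-elim (¬pa (Q⊆P qa))
    select-any {as = a ∷ _} Q⊆P (there i) with P? a
    ... | yes _ = there (select-any Q⊆P i)
    ... | no  _ = select-any Q⊆P i

-- Sums restricted by indicators.

module Indicators {c ℓ₁ ℓ₂} (ℛ : RealNumbers c ℓ₁ ℓ₂) where
  open Reals ℛ hiding (zero)
  open ListSums ℛ
  open Selection
  private variable
    a p q : Level
    A : Set a

  indicator : {P : Set p} → Dec P → ℝ → ℝ
  indicator (yes _) r = r
  indicator (no  _) r = 0#

  indicator-cong : {P : Set p} {Q : Set q} (P? : Dec P) (Q? : Dec Q) → (P → Q) → (Q → P) → ∀ r →
                   indicator P? r ≈ indicator Q? r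
  indicator-cong (yes p) (yes q) f g r = refl
  indicator-cong (yes p) (no ¬q) f g r = ⊥-elim (¬q (f p))
  indicator-cong (no ¬p) (yes q) f g r = ⊥-elim (¬p (g q))
  indicator-cong (no ¬p) (no ¬q) f g r = refl

  sumOver-select : ∀ {P : A → Set p} (P? : ∀ a → Dec (P a)) as (f : Σ A P → ℝ) {g : A → ℝ} → (∀ u → f u ≈ g (proj₁ u)) →
    sumOver (select P? as) f ≈ sumOver as (λ a → indicator (P? a) (g a))
  sumOver-select P? []       f f≈g = refl
  sumOver-select P? (a ∷ as) f f≈g with P? a
  ... | yes pa = +-cong (f≈g (a , pa)) (sumOver-select P? as f f≈g)
  ... | no  _  = trans (sumOver-select P? as f f≈g) (sym (+-identityˡ _))

  sumOver-indicator-∄ : ∀ {P : A → Set p} (P? : ∀ a → Dec (P a)) {as} r → All (λ a → ¬ P a) as →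
    sumOver as (λ a → indicator (P? a) r) ≈ 0#
  sumOver-indicator-∄ P? r All.[] = refl
  sumOver-indicator-∄ P? {a ∷ _} r (¬pa All.∷ ¬pas) with P? a
  ... | yes pa = ⊥-elim (¬pa pa)
  ... | no  _  = trans (+-identityˡ _) (sumOver-indicator-∄ P? r ¬pas)

  -- `Any` provides one position where the predicate holds; a second one would be separated from it
  -- by `R`, which `excl` forbids.
  sumOver-indicator-∃! : ∀ {P : A → Set p} {R : A → A → Set q} (P? : ∀ a → Dec (P a)) {as} r →
    AllPairs R as → (∀ {a b} → P a → P b → ¬ R a b) → Any P as →
    sumOver as (λ a → indicator (P? a) r) ≈ r
  sumOver-indicator-∃! P? {a ∷ _} r (ra AllPairs.∷ rs) excl i with P? a | i
  ... | yes pa | _       = trans (+-congˡ (sumOver-indicator-∄ P? r (All.map (λ rab pb → excl pa pb rab) ra))) (+-identityʳ r)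
  ... | no ¬pa | here pa = ⊥-elim (¬pa pa)
  ... | no ¬pa | there j = trans (+-identityˡ _) (sumOver-indicator-∃! P? r rs excl j)

  sumOver-cong-all : ∀ {Q : A → Set q} {as} {f g : A → ℝ} → All Q as → (∀ a → Q a → f a ≈ g a) → sumOver as f ≈ sumOver as g
  sumOver-cong-all All.[]         f≈g = refl
  sumOver-cong-all (qa All.∷ qas) f≈g = +-cong (f≈g _ qa) (sumOver-cong-all qas f≈g)

-- The three sums of the theorem, and their comparison.

module TraceFormula {c ℓ₁ ℓ₂} (ℛ : RealNumbers c ℓ₁ ℓ₂) (π : Reals.ℝ ℛ) (isPi : Reals.IsPi ℛ π)
                    {d : ℕ} (A : Matrix ℤ d) (det≢0 : det A ≢ 0ℤ)
                    (w : Vector (Reals.ℝ ℛ) d) (n : ℕ) where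
  open Reals ℛ hiding (zero)
  open RealAlgebra ℛ
  open Periodicity ℛ π isPi
  open ListSums ℛ
  open InnerProduct ℛ
  open Multinomial ℛ
  open CosineMultinomial ℛ π isPi
  open DualTorus ℛ π isPi
  open Indicators ℛ
  open Reduction
  open Compositions
  open SignedSplitting
  open Selection
  open Transversal (transversal A det≢0) renaming (terms to dualTerms)
  private
    module ∑ = CMSum +-commutativeMonoid
    module ∏ = CMSum *-commutativeMonoid
    module ∑ℕ = CMSum ℕₚ.+-0-commutativeMonoid
    module ∏ℕ = CMSum ℕₚ.*-1-commutativeMonoid
  open SetoidReasoning setoid

  private module I = Setoid (Image A)

  Walk : Set
  Walk = Vector ℕ (d ℕ.+ d)

  walks : List Walk
  walks = compositions (d ℕ.+ d) n

  walkWeight : Walk → ℝ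
  walkWeight r = fromℕ (n !) * ((w ++ᵛ w) ^ᵛ r * 1/!ᵛ r)

  ^ᵛ-congʳ : ∀ {m} (v : Vector ℝ m) {y y′ : Vector ℕ m} → y ≗ y′ → v ^ᵛ y ≈ v ^ᵛ y′
  ^ᵛ-congʳ v y≗y′ = ∏.sum-cong-≋ λ i → reflexive (≡.cong (v i ^_) (y≗y′ i))

  multinomialTerm-cong : ∀ x x′ y y′ → x ≗ x′ → y ≗ y′ → multinomialTerm w n x y ≈ multinomialTerm w n x′ y′
  multinomialTerm-cong x x′ y y′ x≗x′ y≗y′ = *-cong
    (*-congˡ (1/ℕ-cong
      {{ℕₚ.m*n≢0 _ _ {{(abs x +ᵛ y) !ᵛ≢0}} {{y !ᵛ≢0}}}} {{ℕₚ.m*n≢0 _ _ {{(abs x′ +ᵛ y′) !ᵛ≢0}} {{y′ !ᵛ≢0}}}}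
      (≡.cong₂ ℕ._*_ (∏ℕ.sum-cong-≗ λ i → ≡.cong₂ (λ a b → (∣ a ∣ ℕ.+ b) !) (x≗x′ i) (y≗y′ i))
        (∏ℕ.sum-cong-≗ λ i → ≡.cong _! (y≗y′ i)))))
    (^ᵛ-congʳ w λ i → ≡.cong₂ (λ a b → ∣ a ∣ ℕ.+ 2 ℕ.* b) (x≗x′ i) (y≗y′ i))

  multinomialTerm≈walkWeight : ∀ r x y → Splits r x y → multinomialTerm w n x y ≈ walkWeight r
  multinomialTerm≈walkWeight r x y s = begin
    multinomialTerm w n x y
      ≈⟨ *-cong (*-congˡ (1/ℕ-cong
           {{ℕₚ.m*n≢0 _ _ {{(abs x +ᵛ y) !ᵛ≢0}} {{y !ᵛ≢0}}}} {{r !ᵛ≢0}} (≡.sym (!ᵛ-splits r x y s)))) power ⟩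
    fromℕ (n !) * 1/!ᵛ r * (w ++ᵛ w) ^ᵛ r
      ≈⟨ solve 3 (λ a b c → a :* b :* c := a :* (c :* b)) refl _ _ _ ⟩
    walkWeight r ∎
    where
    power : w ^ᵛ (abs x +ᵛ 2 ·ᵛ y) ≈ (w ++ᵛ w) ^ᵛ r
    power = begin
      w ^ᵛ (abs x +ᵛ 2 ·ᵛ y)
        ≈⟨ ^ᵛ-congʳ w (λ i → ≡.sym (exponents r x y s i)) ⟩
      w ^ᵛ (λ i → r (i ↑ˡ d) ℕ.+ r (d ↑ʳ i))
        ≈⟨ ∏.sum-cong-≋ (λ i → Exp.^-homo-* semiring (w i) (r (i ↑ˡ d)) (r (d ↑ʳ i))) ⟩
      ∏.sum (λ i → w i ^ r (i ↑ˡ d) * w i ^ r (d ↑ʳ i))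
        ≈⟨ ∏.∑-distrib-+ (λ i → w i ^ r (i ↑ˡ d)) (λ i → w i ^ r (d ↑ʳ i)) ⟩
      ∏.sum (λ i → w i ^ r (i ↑ˡ d)) * ∏.sum (λ i → w i ^ r (d ↑ʳ i))
        ≈⟨ *-cong
             (∏.sum-cong-≋ λ i → reflexive (≡.cong (_^ r (i ↑ˡ d)) (≡.sym (Vectorₚ.lookup-++ˡ w w i))))
             (∏.sum-cong-≋ λ i → reflexive (≡.cong (_^ r (d ↑ʳ i)) (≡.sym (Vectorₚ.lookup-++ʳ w w i)))) ⟩
      ∏.sum (λ i → t (i ↑ˡ d)) * ∏.sum (λ i → t (d ↑ʳ i))
        ≈⟨ sum-↑ *-commutativeMonoid d t ⟨
      (w ++ᵛ w) ^ᵛ r ∎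
      where
      t : Vector ℝ (d ℕ.+ d)
      t j = (w ++ᵛ w) j ^ r j

  displacement-∙ : ∀ r (ξ : Vector ℝ d) → (+_ ∘ r) ∙ (ξ ++ᵛ (λ i → - ξ i)) ≈ displacement r ∙ ξ
  displacement-∙ r ξ = begin
    (+_ ∘ r) ∙ (ξ ++ᵛ (λ i → - ξ i))
      ≈⟨ sum-↑ +-commutativeMonoid d t ⟩
    ∑.sum (λ i → t (i ↑ˡ d)) + ∑.sum (λ i → t (d ↑ʳ i))
      ≈⟨ ∑.∑-distrib-+ (λ i → t (i ↑ˡ d)) (λ i → t (d ↑ʳ i)) ⟨
    ∑.sum (λ i → t (i ↑ˡ d) + t (d ↑ʳ i))
      ≈⟨ ∑.sum-cong-≋ (λ i → begin
           t (i ↑ˡ d) + t (d ↑ʳ i)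
             ≡⟨ ≡.cong₂ (λ a b → fromℕ (r (i ↑ˡ d)) * a + fromℕ (r (d ↑ʳ i)) * b)
                  (Vectorₚ.lookup-++ˡ ξ _ i) (Vectorₚ.lookup-++ʳ ξ _ i) ⟩
           fromℕ (r (i ↑ˡ d)) * ξ i + fromℕ (r (d ↑ʳ i)) * - ξ i
             ≈⟨ solve 3 (λ p q x → p :* x :+ q :* (:- x) := (p :- q) :* x) refl _ _ (ξ i) ⟩
           (fromℕ (r (i ↑ˡ d)) - fromℕ (r (d ↑ʳ i))) * ξ i
             ≈⟨ *-congʳ (fromℤ-⊖ (r (i ↑ˡ d)) (r (d ↑ʳ i))) ⟨
           fromℤ (displacement r i) * ξ i ∎) ⟩
    displacement r ∙ ξ ∎
    where
    t : Vector ℝ (d ℕ.+ d)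
    t j = fromℕ (r j) * (ξ ++ᵛ (λ i → - ξ i)) j

  -- Includes the length, so that a selected walk brings the proof that `part` turns into the index
  -- equation.
  Reaches : Vector ℤ d → Walk → Set
  Reaches x r = ∑ℕ.sum r ≡ n × displacement r ≗ x

  reaches? : ∀ x r → Dec (Reaches x r)
  reaches? x r = (∑ℕ.sum r ℕₚ.≟ n) ×-dec Finₚ.all? (λ i → displacement r i ℤₚ.≟ x i)

  Part : Vector ℤ d → Set
  Part x = Setoid.Carrier (𝒫 ((+ n -ℤ + ∣ abs x ∣₁) / 2) d)

  part : ∀ x → Σ Walk (Reaches x) → Part x
  part x (r , ∑r≡n , r≗x) = y , index⁺ n ∣ abs x ∣₁ ∣ y ∣₁ (≡.trans (≡.sym ∑r≡n)
    (≡.trans (total-splits r (displacement r) y (splits r))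
      (≡.cong (ℕ._+ 2 ℕ.* ∣ y ∣₁) (∑ℕ.sum-cong-≗ λ i → ≡.cong ∣_∣ (r≗x i)))))
    where
    y : Vector ℕ d
    y = cancellations r

  parts : ∀ x → List (Part x)
  parts x = map (part x) (select (reaches? x) walks)

  inner : I.Carrier → ℝ
  inner (x , _) = sumOver (parts x) (λ (y , _) → multinomialTerm w n x y)

  -- For a fixed endpoint x, walks of length n correspond to their vectors of cancelling pairs:
  -- `splits-unique` makes the listed vectors distinct, and `join` produces a walk for each element
  -- of the index set. The list is therefore the whole set, and the support condition is vacuous.
  inner-isSum : ∀ x → IsSum (𝒫 ((+ n -ℤ + ∣ abs (proj₁ x) ∣₁) / 2) d)
                        (λ (y , _) → multinomialTerm w n (proj₁ x) y) (inner x)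
  inner-isSum (x , _) = record
    { well-defined = λ {u} {v} → multinomialTerm-cong x x (proj₁ u) (proj₁ v) (λ _ → ≡.refl)
    ; terms        = parts x
    ; distinct     = AllPairsₚ.map⁺ (AllPairs.map
        (λ {u} {v} r≉r′ y≗y′ → r≉r′ (splits-unique (proj₁ u) (proj₁ v) (splits (proj₁ u)) (splits (proj₁ v))
          (λ i → ≡.trans (proj₂ (proj₂ u) i) (≡.sym (proj₂ (proj₂ v) i))) y≗y′))
        (select-allPairs (reaches? x) (compositions-unique (d ℕ.+ d) n)))
    ; support      = λ y y∉ → ⊥-elim (y∉ (exhaustive-parts y))
    ; total        = refl
    }
    where
    exhaustive-parts : ∀ y → Membership._∈_ (𝒫 ((+ n -ℤ + ∣ abs x ∣₁) / 2) d) y (parts x)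
    exhaustive-parts (y , index) = Anyₚ.map⁺ (Any.map
        (λ {u} eq i → ≡.trans (≡.sym (cancellations≗ (join x y) x y s i)) (≡.cong₂ _⊓_ (eq (i ↑ˡ d)) (eq (d ↑ʳ i))))
        (select-any (reaches? x) (λ eq →
            ≡.trans (≡.sym (∑ℕ.sum-cong-≗ eq)) total ,
            λ i → ≡.trans (≡.cong₂ _⊖_ (≡.sym (eq (i ↑ˡ d))) (≡.sym (eq (d ↑ʳ i)))) (displacement≗ (join x y) x y s i))
          (compositions-complete (d ℕ.+ d) n (join x y) total)))
      where
      s : Splits (join x y) x y
      s = join-splits x y
      total : ∑ℕ.sum (join x y) ≡ n
      total = ≡.trans (total-splits (join x y) x y s) (≡.sym (index⁻ n ∣ abs x ∣₁ ∣ y ∣₁ index))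

  -- With the condition on x moved into an indicator the list of walks no longer depends on x. Both
  -- the invariance of `inner` and the exchange of summations rest on this form.
  inner≈ : ∀ x → inner x ≈ sumOver walks (λ r → indicator (reaches? (proj₁ x) r) (walkWeight r))
  inner≈ (x , _) = trans (sumOver-map (part x) (select (reaches? x) walks) _)
    (sumOver-select (reaches? x) walks _ λ (r , _ , r≗x) →
      trans
        (multinomialTerm-cong x (displacement r) (cancellations r) (cancellations r)
          (λ i → ≡.sym (r≗x i)) (λ _ → ≡.refl))
        (multinomialTerm≈walkWeight r (displacement r) (cancellations r) (splits r)))

  imageDecSetoid : DecSetoid _ _
  imageDecSetoid = record
    { Carrier = I.Carrier
    ; _≈_     = I._≈_
    ; isDecEquivalence = record
      { isEquivalence = I.isEquivalence
      ; _≟_           = λ (x , _) (x′ , _) → Finₚ.all? λ i → x i ℤₚ.≟ x′ i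
      }
    }

  -- Different walks may share an endpoint, so repetitions are removed. At a point of the image that
  -- no walk of length n reaches, `inner` is an empty sum.
  endpoints : List I.Carrier
  endpoints = deduplicate (DecSetoid._≟_ imageDecSetoid)
    (map (λ (r , r∈A) → displacement r , r∈A) (select (image? ∘ displacement) walks))

  endpoints-complete : ∀ x r → Reaches (proj₁ x) r → Membership._∈_ (Image A) x endpoints
  endpoints-complete (x , m , Am≡x) r (∑r≡n , r≗x) =
    Anyₚ.deduplicate⁺ (DecSetoid._≟_ imageDecSetoid) (λ q p i → ≡.trans (p i) (≡.sym (q i)))
      (Anyₚ.map⁺ (Any.map (λ {u} eq i → ≡.trans (≡.sym (r≗x i)) (≡.cong₂ _⊖_ (eq (i ↑ˡ d)) (eq (d ↑ʳ i))))
        (select-any (image? ∘ displacement)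
          (λ eq → m , λ i → ≡.trans (Am≡x i) (≡.trans (≡.sym (r≗x i)) (≡.cong₂ _⊖_ (eq (i ↑ˡ d)) (eq (d ↑ʳ i)))))
          (compositions-complete (d ℕ.+ d) n r ∑r≡n))))

  outer : ℝ
  outer = sumOver endpoints inner

  outer-isSum : IsSum (Image A) inner outer
  outer-isSum = record
    { well-defined = λ {x} {x′} x≗x′ → trans (inner≈ x) (trans
        (sumOver-cong walks λ r → indicator-cong (reaches? _ r) (reaches? _ r)
          (λ (∑r≡n , r≗x) → ∑r≡n , λ i → ≡.trans (r≗x i) (x≗x′ i))
          (λ (∑r≡n , r≗x′) → ∑r≡n , λ i → ≡.trans (r≗x′ i) (≡.sym (x≗x′ i))) (walkWeight r))
        (sym (inner≈ x′)))
    ; terms        = endpoints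
    ; distinct     = UniqueDecₚ.deduplicate-! imageDecSetoid _
    ; support      = λ x x∉ → trans (sumOver-map (part (proj₁ x)) (select (reaches? (proj₁ x)) walks) _)
        (sumOver-0 (select (reaches? (proj₁ x)) walks) λ (r , reaches) → ⊥-elim (x∉ (endpoints-complete x r reaches)))
    ; total        = refl
    }

  lhs : ℝ
  lhs = sumOver dualTerms (λ (ξ , _) → ⟨ w , cos2π π ξ ⟩ ^ n)

  lhs-isSum : IsSum (T* A) (λ (ξ , _) → ⟨ w , cos2π π ξ ⟩ ^ n) lhs
  lhs-isSum = record
    { well-defined = λ {ξ} {η} (l , ξ-η≈l) → Exp.^-congˡ semiring n (∑.sum-cong-≋ λ i → *-congˡ
        (cos₁-≈-+ℤ (l i) (trans (solve 2 (λ x y → x := y :+ (x :- y)) refl (proj₁ ξ i) (proj₁ η i)) (+-congˡ (ξ-η≈l i)))))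
    ; terms        = dualTerms
    ; distinct     = distinct
    ; support      = λ ξ ξ∉ → ⊥-elim (ξ∉ (exhaustive ξ))
    ; total        = refl
    }

  dualSum : Vector ℤ d → ℝ
  dualSum x = sumOver dualTerms (λ (ξ , _) → cos₁ (0# + x ∙ ξ))

  -- Every x·ξ is an integer, so each cosine is 1 and the sum counts the dual group.
  dualSum-∈ : ∀ {x} → x ∈Image A → dualSum x ≈ fromℕ ∣ det A ∣
  dualSum-∈ {x} (m , Am≡x) = begin
    dualSum x
      ≈⟨ sumOver-cong dualTerms (λ (ξ , z , p) →
           let (k , x∙ξ≈k) = Submodule.respects (integral ξ) Am≡x
                               (image-combination (integral ξ) A (λ j → z j , p j) m)
           in trans (cos₁-≈-+ℤ k (+-congˡ x∙ξ≈k)) cos₁-0) ⟩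
    sumOver dualTerms (λ _ → 1#)     ≈⟨ sumOver-const dualTerms 1# ⟩
    fromℕ (length dualTerms) * 1#    ≈⟨ *-identityʳ _ ⟩
    fromℕ (length dualTerms)         ≡⟨ ≡.cong fromℕ count ⟩
    fromℕ ∣ det A ∣                  ∎

  2^n-* : ∀ x k → fromℕ (2 ^ℕ k) * x ^ k ≈ (x + x) ^ k
  2^n-* x zero    = trans (*-identityʳ _) (+-identityʳ 1#)
  2^n-* x (suc k) = begin
    fromℕ (2 ℕ.* 2 ^ℕ k) * (x * x ^ k)
      ≈⟨ *-congʳ (fromℕ-homo-* 2 (2 ^ℕ k)) ⟩
    fromℕ 2 * fromℕ (2 ^ℕ k) * (x * x ^ k)
      ≈⟨ solve 3 (λ a x p → (con 1ℤ :+ (con 1ℤ :+ con 0ℤ)) :* a :* (x :* p) := (x :+ x) :* (a :* p)) refl _ x _ ⟩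
    (x + x) * (fromℕ (2 ^ℕ k) * x ^ k)
      ≈⟨ *-congˡ (2^n-* x k) ⟩
    (x + x) ^ suc k ∎

  -- The case φ = 0 of `cosine-multinomial`, where the trailing cosine is 1; the power of 2 comes
  -- from the doubled inner product there.
  power-expansion : ∀ (ξ : Vector ℝ d) → fromℕ (2 ^ℕ n) * ⟨ w , cos2π π ξ ⟩ ^ n ≈
    sumOver walks (λ r → walkWeight r * cos₁ (0# + displacement r ∙ ξ))
  power-expansion ξ = begin
    fromℕ (2 ^ℕ n) * ⟨ w , cos₁ ∘ ξ ⟩ ^ n
      ≈⟨ 2^n-* _ n ⟩
    (⟨ w , cos₁ ∘ ξ ⟩ + ⟨ w , cos₁ ∘ ξ ⟩) ^ n
      ≈⟨ trans (*-congˡ cos₁-0) (*-identityʳ _) ⟨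
    (⟨ w , cos₁ ∘ ξ ⟩ + ⟨ w , cos₁ ∘ ξ ⟩) ^ n * cos₁ 0#
      ≈⟨ cosine-multinomial w ξ n 0# ⟨
    fromℕ (n !) * multinomialSum cos₁ cos₁-cong (d ℕ.+ d) n (w ++ᵛ w) (ξ ++ᵛ (λ i → - ξ i)) 0#
      ≈⟨ *-sumOver (fromℕ (n !)) walks _ ⟨
    sumOver walks (λ r → fromℕ (n !) * ((w ++ᵛ w) ^ᵛ r * 1/!ᵛ r * cos₁ (0# + (+_ ∘ r) ∙ (ξ ++ᵛ (λ i → - ξ i)))))
      ≈⟨ sumOver-cong walks (λ r → trans (sym (*-assoc _ _ _)) (*-congˡ (cos₁-cong (+-congˡ (displacement-∙ r ξ))))) ⟩
    sumOver walks (λ r → walkWeight r * cos₁ (0# + displacement r ∙ ξ)) ∎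

  -- A walk ending in the image meets exactly one listed endpoint, and its dual sum is |det A|. For
  -- any other walk both sides are 0: the left by orthogonality, the right because no listed
  -- endpoint matches.
  walk-contribution : ∀ r → ∑ℕ.sum r ≡ n → walkWeight r * dualSum (displacement r) ≈
    fromℕ ∣ det A ∣ * sumOver endpoints (λ (x , _) → indicator (reaches? x r) (walkWeight r))
  walk-contribution r ∑r≡n with image? (displacement r)
  ... | yes r∈A = trans (*-comm _ _) (*-cong (dualSum-∈ r∈A) (sym
    (sumOver-indicator-∃! (λ (x , _) → reaches? x r) (walkWeight r)
      (UniqueDecₚ.deduplicate-! imageDecSetoid _)
      (λ (_ , p) (_ , q) x≉y → x≉y λ i → ≡.trans (≡.sym (p i)) (q i))
      (Any.map (λ eq → ∑r≡n , eq) (endpoints-complete (displacement r , r∈A) r (∑r≡n , λ _ → ≡.refl))))))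
  ... | no r∉A = trans (*-congˡ (vanishing 0# (displacement r) r∉A)) (trans (zeroʳ _) (sym (trans (*-congˡ
    (sumOver-indicator-∄ (λ (x , _) → reaches? x r) (walkWeight r)
      (All.universal (λ (x , m , Am≡x) (_ , r≗x) → r∉A (m , λ i → ≡.trans (Am≡x i) (≡.sym (r≗x i)))) endpoints)))
    (zeroʳ _))))

  formula : lhs ≈ (∣ det A ∣ /ℕ (2 ^ℕ n)) {{m^n≢0 2 n}} * outer
  formula = trans (1/ℕ-cancel (2 ^ℕ n) {{m^n≢0 2 n}} (begin
      fromℕ (2 ^ℕ n) * lhs
        ≈⟨ *-sumOver _ dualTerms _ ⟨
      sumOver dualTerms (λ (ξ , _) → fromℕ (2 ^ℕ n) * ⟨ w , cos2π π ξ ⟩ ^ n)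
        ≈⟨ sumOver-cong dualTerms (λ (ξ , _) → power-expansion ξ) ⟩
      sumOver dualTerms (λ (ξ , _) → sumOver walks (λ r → walkWeight r * cos₁ (0# + displacement r ∙ ξ)))
        ≈⟨ sumOver-comm dualTerms walks _ ⟩
      sumOver walks (λ r → sumOver dualTerms (λ (ξ , _) → walkWeight r * cos₁ (0# + displacement r ∙ ξ)))
        ≈⟨ sumOver-cong-all (compositions-sound (d ℕ.+ d) n) (λ r ∑r≡n →
             trans (*-sumOver (walkWeight r) dualTerms _) (walk-contribution r ∑r≡n)) ⟩
      sumOver walks (λ r → D * sumOver endpoints (λ (x , _) → indicator (reaches? x r) (walkWeight r)))
        ≈⟨ *-sumOver D walks _ ⟩
      D * sumOver walks (λ r → sumOver endpoints (λ (x , _) → indicator (reaches? x r) (walkWeight r)))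
        ≈⟨ *-congˡ (trans (sumOver-comm walks endpoints _) (sumOver-cong endpoints (λ x → sym (inner≈ x)))) ⟩
      D * outer ∎))
    (trans (sym (*-assoc _ _ _)) (*-congʳ (*-comm _ _)))
    where D = fromℕ ∣ det A ∣

theorem1p1 : ∀ {c ℓ₁ ℓ₂} (ℛ : RealNumbers c ℓ₁ ℓ₂) → let open Reals ℛ in
    (π : ℝ) → IsPi π →
    (d : ℕ) (A : Matrix ℤ d) → det A ≢ 0ℤ →
    (w : Vector ℝ d) (n : ℕ) → n ≥ 1 →
    Σ[ lhs ∈ ℝ ] Σ[ inner ∈ (Setoid.Carrier (Image A) → ℝ) ] Σ[ outer ∈ ℝ ]
    ( IsSum (T* A) (λ (ξ , _) → ⟨ w , cos2π π ξ ⟩ ^ n) lhs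
    × (∀ x → IsSum (𝒫 ((+ n -ℤ + ∣ abs (proj₁ x) ∣₁) / 2) d)
    (λ (y , _) → multinomialTerm w n (proj₁ x) y) (inner x))
    × IsSum (Image A) inner outer
    × lhs ≈ (∣ det A ∣ /ℕ (2 ^ℕ n)) {{m^n≢0 2 n}} * outer )
theorem1p1 ℛ π isPi d A det≢0 w n _ =
  lhs , inner , outer , lhs-isSum , inner-isSum , outer-isSum , formula
  where open TraceFormula ℛ π isPi A det≢0 w n
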